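{- There is an absolute constant $C>0$ and a one-pass insertion-only streaming algorithm (CountSieve) such that, for every stream in which some item $H\in[n]$ is a $400C^2$-heavy hitter, the algorithm returns $H$ with probability at least $0.95$. The algorithm uses $O(\log n\log\log n)$ bits of storage and can be implemented with $O(\log n\log\log n)$ stored random bits.
   Context: An insertion-only stream is a sequence $p_1,\ldots,p_m$ with $p_i\in[n]$, with $\log m=O(\log n)$; $f_j=\#\{t\le m:p_t=j\}$. For $\alpha>0$, an item $H\in[n]$ is an $\alpha$-heavy hitter if $f_H^2\ge \alpha\sum_{j\ne H} f_j^2$. A streaming algorithm reads the items once in order and must count in its storage any random bits it stores. -}

module Defs where

open import Data.Nat using (ℕ; zero; suc; _+_; _*_; _^_; _≤_)
open import Data.Nat.Logarithm using (⌊log₂_⌋)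
open import Data.Bool using (Bool; true; false)
open import Data.Fin using (Fin)
open import Data.Fin.Properties using (_≟_)
open import Data.Nat.ListAction using (sum)
open import Data.List using (List; []; _∷_; foldl; length; map; filter; allFin; concatMap)
open import Data.Vec using (Vec; []; _∷_)
open import Relation.Nullary using (¬_; does)
open import Relation.Nullary.Decidable using (¬?)

-- All bit strings of length r (each exactly once): the uniform sample space.
allBits : (r : ℕ) → List (Vec Bool r)
allBits zero = [] ∷ []
allBits (suc r) = concatMap (λ v → (false ∷ v) ∷ (true ∷ v) ∷ []) (allBits r)

-- A one-pass streaming algorithm over the universe [n] = Fin n with
-- s bits of storage, whose randomness is an r-bit seed (uniform) that
-- is used to set the initial memory contents (so stored random bits
-- live in the s bits of memory).  Items are processed one at a time in
-- order by a deterministic update of the memory; at the end an item is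
-- output from the memory contents.
record StreamAlg (n s r : ℕ) : Set where
  field
    init : Vec Bool r → Vec Bool s
    step : Fin n → Vec Bool s → Vec Bool s
    out  : Vec Bool s → Fin n

open StreamAlg public

run : ∀ {n s r} → StreamAlg n s r → Vec Bool r → List (Fin n) → Fin n
run A ρ σ = out A (foldl (λ mem p → step A p mem) (init A ρ) σ)

successes : ∀ {n s r} → StreamAlg n s r → List (Fin n) → Fin n → ℕ
successes {r = r} A σ H = length (filter (λ ρ → run A ρ σ ≟ H) (allBits r))

freq : ∀ {n} → List (Fin n) → Fin n → ℕ
freq σ j = length (filter (λ p → p ≟ j) σ)

restF2 : ∀ {n} → List (Fin n) → Fin n → ℕ
restF2 {n} σ H = sum (map (λ j → freq σ j * freq σ j) (filter (λ j → ¬? (j ≟ H)) (allFin n)))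

HeavyHitter : ∀ {n} → ℕ → List (Fin n) → Fin n → Set
HeavyHitter α σ H = α * restF2 σ H ≤ freq σ H * freq σ H

{-# OPTIONS --safe #-}
-- The algorithm is a variant of the BPTree recursion rather than CountSieve. Signs ε come from a four-wise
-- independent family ⟨v_j, s⟩ over GF(2), where the v_j are chosen greedily so that no v_j is a sum of three
-- earlier ones. For such signs the maximum over prefixes of a signed count has fourth moment O(F₂²), because
-- F₂ is superadditive under concatenation. So the running sum X of all signs follows ± f_H up to a small multiple of f_H.
--
-- Each time |X| reaches a power M of two a new phase begins, which learns the Toeplitz hash of H bit by bit. In
-- round r only the items whose hash agrees with the r bits learned so far are counted, with signs, in two counters
-- according to their next bit; the first counter to reach (M / 150) (9/10)^r decides the bit. The surviving noise has
-- second moment 2^-r F₂ in expectation, so the failure probabilities (∝ 2^-r (10/9)^4r) and the numbers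
-- of occurrences of H consumed (∝ (9/10)^r M) both form convergent geometric series. After about 2 log₂ M
-- rounds only H survives, and the next surviving item is stored; the answer is the item stored by the last
-- completed phase.
module Submission where

open import Defs
open import Algebra.Bundles using (CommutativeSemiring; CommutativeRing)
open import Level using (0ℓ)
open import Data.Nat using (ℕ; zero; suc; _+_; _*_; _^_; _∸_; _⊔_; _≤_; _<_; z≤n; s≤s; _≤?_; _≡ᵇ_; _<?_; NonZero; >-nonZero)
open import Data.Nat.Properties hiding (_≟_)
open import Data.Nat.DivMod using (_/_; _%_; m%n<n; m<n*o⇒m/o<n; m≡m%n+[m/n]*n)
open import Data.Nat.Logarithm using (⌊log₂_⌋; ⌊log₂⌋-mono-≤; ⌊log₂[2^n]⌋≡n)
open import Data.Nat.Tactic.RingSolver using (solve-∀)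
open import Data.Integer as ℤ using (ℤ; -[1+_]; ∣_∣) renaming (+_ to pos)
import Data.Integer.Properties as ℤ
import Data.Integer.Tactic.RingSolver as ℤSolver
open import Data.Bool using (Bool; true; false; not; _∧_; _xor_; if_then_else_)
open import Data.Bool.Properties using (xor-assoc; xor-comm; xor-same; ∧-distribʳ-xor; xor-∧-commutativeRing) renaming (_≟_ to _≟ᵇ_)
open import Data.Fin using (Fin; zero; suc; toℕ; fromℕ<)
open import Data.Fin.Properties using (_≟_; toℕ<n; fromℕ<-toℕ)
open import Data.List using (List; []; _∷_; _++_; [_]; length; map; filter; concatMap; drop; allFin; tabulate; cartesianProductWith; foldl; applyUpTo)
open import Data.List.Membership.Propositional using (_∈_; _∉_)
open import Data.List.Membership.Propositional.Properties using (∈-filter⁺; ∈-filter⁻; ∈-allFin; ∈-tabulate⁺; ∈-++⁺ʳ; ∈-applyUpTo⁺; ∈-cartesianProductWith⁺)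
open import Data.List.Relation.Unary.Any using (here; there)
open import Data.Nat.ListAction using (sum)
import Data.List.Properties as List
open import Data.Vec using (Vec; []; _∷_; toList)
import Data.Vec as Vec
open import Data.Product using (Σ; _×_; _,_; proj₁; proj₂; ∃-syntax)
open import Data.Sum using (_⊎_; inj₁; inj₂)
open import Data.Unit using (⊤; tt)
open import Data.Empty using (⊥; ⊥-elim)
open import Function using (_∘_)
open import Relation.Nullary using (¬_; Dec; yes; no; does; contradiction)
open import Relation.Nullary.Decidable using (¬?; _×-dec_; dec-true; dec-false)
open import Relation.Binary.PropositionalEquality using (_≡_; _≢_; refl; sym; trans; cong; cong₂; subst; subst₂; module ≡-Reasoning)

-- The size of `f_H` is unknown in advance, hence phases at every power of two; only those with
-- `F ≤ 3 * 2 ^ i` are controlled, and on a good seed the last completed phase is one of them.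
-- Rounds start at times that depend on the seed, which would spoil a direct moment bound for the
-- noise they collect. Instead, each depth `r` and bit `c` has one substream fixed by the hash
-- alone: the items other than `H` that share the first `r` hash bits of `H` and have next bit `c`.
-- What a counter collects from other items during a round is a difference of two prefix sums of
-- that substream, so a bound over all prefixes covers every starting time at once.
--
-- Fourth moments are taken because `F₂` of two halves can add up to all of `F₂`, so that a
-- second-moment recursion would lose at every halving, whereas `F₂²` drops to a quarter on each
-- half. Of the hash only the probability of a single collision is used, since `F₂²` of a substream
-- is at most its `F₂` times that of all other items. The vectors `v_j` belong to the transition
-- function and cost no storage.

-- Finite sums over lists in a commutative semiring, for use over the naturals and the integers

module ListSum (R : CommutativeSemiring 0ℓ 0ℓ) where
  open CommutativeSemiring R using (_≈_; 0#) renaming (Carrier to C; _+_ to _⊕_; _*_ to _⊗_)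
  private module R = CommutativeSemiring R
  open import Algebra.Properties.CommutativeSemigroup R.+-commutativeSemigroup using (interchange)
  open import Relation.Binary.Reasoning.Setoid R.setoid

  ∑ : {A : Set} → List A → (A → C) → C
  ∑ [] f = 0#
  ∑ (x ∷ xs) f = f x ⊕ ∑ xs f

  ∑-cong : {A : Set} (xs : List A) {f g : A → C} → (∀ x → f x ≈ g x) → ∑ xs f ≈ ∑ xs g
  ∑-cong [] h = R.refl
  ∑-cong (x ∷ xs) h = R.+-cong (h x) (∑-cong xs h)

  ∑-++ : {A : Set} (xs ys : List A) (f : A → C) → ∑ (xs ++ ys) f ≈ ∑ xs f ⊕ ∑ ys f
  ∑-++ [] ys f = R.sym (R.+-identityˡ _)
  ∑-++ (x ∷ xs) ys f = R.trans (R.+-congˡ (∑-++ xs ys f)) (R.sym (R.+-assoc _ _ _))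

  ∑-zero : {A : Set} (xs : List A) → ∑ xs (λ _ → 0#) ≈ 0#
  ∑-zero [] = R.refl
  ∑-zero (x ∷ xs) = R.trans (R.+-identityˡ _) (∑-zero xs)

  ∑-+ : {A : Set} (xs : List A) (f g : A → C) → ∑ xs (λ x → f x ⊕ g x) ≈ ∑ xs f ⊕ ∑ xs g
  ∑-+ [] f g = R.sym (R.+-identityˡ _)
  ∑-+ (x ∷ xs) f g = R.trans (R.+-congˡ (∑-+ xs f g)) (interchange _ _ _ _)

  ∑-*ˡ : {A : Set} (c : C) (xs : List A) (f : A → C) → ∑ xs (λ x → c ⊗ f x) ≈ c ⊗ ∑ xs f
  ∑-*ˡ c [] f = R.sym (R.zeroʳ c)
  ∑-*ˡ c (x ∷ xs) f = R.trans (R.+-congˡ (∑-*ˡ c xs f)) (R.sym (R.distribˡ c _ _))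

  ∑-*ʳ : {A : Set} (c : C) (xs : List A) (f : A → C) → ∑ xs (λ x → f x ⊗ c) ≈ ∑ xs f ⊗ c
  ∑-*ʳ c xs f = R.trans (∑-cong xs λ x → R.*-comm (f x) c) (R.trans (∑-*ˡ c xs f) (R.*-comm c _))

  ∑-swap : {A B : Set} (xs : List A) (ys : List B) (f : A → B → C) →
           ∑ xs (λ x → ∑ ys (f x)) ≈ ∑ ys (λ y → ∑ xs (λ x → f x y))
  ∑-swap [] ys f = R.sym (∑-zero ys)
  ∑-swap (x ∷ xs) ys f = R.trans (R.+-congˡ (∑-swap xs ys f)) (R.sym (∑-+ ys (f x) _))

  ∑-product : {A B : Set} (xs : List A) (ys : List B) (f : A → C) (g : B → C) →
              ∑ xs f ⊗ ∑ ys g ≈ ∑ xs (λ x → ∑ ys (λ y → f x ⊗ g y))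
  ∑-product xs ys f g = begin
    ∑ xs f ⊗ ∑ ys g                    ≈⟨ ∑-*ʳ (∑ ys g) xs f ⟨
    ∑ xs (λ x → f x ⊗ ∑ ys g)          ≈⟨ ∑-cong xs (λ x → R.sym (∑-*ˡ (f x) ys g)) ⟩
    ∑ xs (λ x → ∑ ys (λ y → f x ⊗ g y)) ∎

  ∑-allBits : ∀ r (f : Vec Bool (suc r) → C) →
              ∑ (allBits (suc r)) f ≈ ∑ (allBits r) (λ v → f (false ∷ v) ⊕ f (true ∷ v))
  ∑-allBits r f = go (allBits r)
    where
    go : ∀ vs → ∑ (concatMap (λ v → (false ∷ v) ∷ (true ∷ v) ∷ []) vs) f ≈ ∑ vs (λ v → f (false ∷ v) ⊕ f (true ∷ v))
    go [] = R.refl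
    go (v ∷ vs) = R.trans (R.sym (R.+-assoc _ _ _)) (R.+-congˡ (go vs))

open ListSum +-*-commutativeSemiring
module ∑ℤ = ListSum ℤ.+-*-commutativeSemiring

∑-mono : {A : Set} (xs : List A) {f g : A → ℕ} → (∀ x → f x ≤ g x) → ∑ xs f ≤ ∑ xs g
∑-mono [] h = z≤n
∑-mono (x ∷ xs) h = +-mono-≤ (h x) (∑-mono xs h)

∑-pos : {A : Set} (xs : List A) (f : A → ℕ) → ∑ℤ.∑ xs (λ x → pos (f x)) ≡ pos (∑ xs f)
∑-pos [] f = refl
∑-pos (x ∷ xs) f = cong (ℤ._+_ (pos (f x))) (∑-pos xs f)

∑-ones : {A : Set} (xs : List A) → ∑ xs (λ _ → 1) ≡ length xs
∑-ones [] = refl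
∑-ones (x ∷ xs) = cong suc (∑-ones xs)

∑-allBits-const : ∀ r c → ∑ (allBits r) (λ _ → c) ≡ c * 2 ^ r
∑-allBits-const zero c = trans (+-identityʳ c) (sym (*-identityʳ c))
∑-allBits-const (suc r) c = begin
  ∑ (allBits (suc r)) (λ _ → c)     ≡⟨ ∑-allBits r (λ _ → c) ⟩
  ∑ (allBits r) (λ _ → c + c)       ≡⟨ ∑-allBits-const r (c + c) ⟩
  (c + c) * 2 ^ r                   ≡⟨ lem c (2 ^ r) ⟩
  c * 2 ^ suc r ∎
  where
  open ≡-Reasoning
  lem : ∀ c t → (c + c) * t ≡ c * (2 * t)
  lem = solve-∀

∑-allBits-++ : ∀ a b (f : Vec Bool (a + b) → ℕ) →
               ∑ (allBits (a + b)) f ≡ ∑ (allBits a) (λ x → ∑ (allBits b) (λ y → f (x Vec.++ y)))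
∑-allBits-++ zero b f = sym (+-identityʳ _)
∑-allBits-++ (suc a) b f = begin
  ∑ (allBits (suc a + b)) f
    ≡⟨ ∑-allBits (a + b) f ⟩
  ∑ (allBits (a + b)) (λ v → f (false ∷ v) + f (true ∷ v))
    ≡⟨ ∑-allBits-++ a b _ ⟩
  ∑ (allBits a) (λ x → ∑ (allBits b) (λ y → f (false ∷ x Vec.++ y) + f (true ∷ x Vec.++ y)))
    ≡⟨ ∑-cong (allBits a) (λ x → ∑-+ (allBits b) _ _) ⟩
  ∑ (allBits a) (λ x → ∑ (allBits b) (λ y → f (false ∷ x Vec.++ y)) + ∑ (allBits b) (λ y → f (true ∷ x Vec.++ y)))
    ≡⟨ ∑-allBits a _ ⟨
  ∑ (allBits (suc a)) (λ x → ∑ (allBits b) (λ y → f (x Vec.++ y))) ∎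
  where open ≡-Reasoning

⟦_⟧ : Bool → ℕ
⟦ b ⟧ = if b then 1 else 0

length-filter : {A : Set} {P : A → Set} (P? : ∀ x → Dec (P x)) (xs : List A) →
                length (filter P? xs) ≡ ∑ xs (λ x → ⟦ does (P? x) ⟧)
length-filter P? [] = refl
length-filter P? (x ∷ xs) with does (P? x)
... | true  = cong suc (length-filter P? xs)
... | false = length-filter P? xs

-- Inner products over GF(2)

infixl 6 _⊕_
_⊕_ : ∀ {k} → Vec Bool k → Vec Bool k → Vec Bool k
[] ⊕ [] = []
(a ∷ v) ⊕ (b ∷ w) = (a xor b) ∷ (v ⊕ w)

-- The seed is a list so that it can be shifted by `drop`; entries past its end count as `false`.
dot : ∀ {k} → Vec Bool k → List Bool → Bool
dot [] _ = false
dot (b ∷ v) [] = false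
dot (b ∷ v) (s ∷ ss) = (b ∧ s) xor dot v ss

dot-⊕ : ∀ {k} (v w : Vec Bool k) s → dot (v ⊕ w) s ≡ dot v s xor dot w s
dot-⊕ [] [] s = refl
dot-⊕ (a ∷ v) (b ∷ w) [] = refl
dot-⊕ (a ∷ v) (b ∷ w) (s ∷ ss) = trans (cong₂ _xor_ (∧-distribʳ-xor s a b) (dot-⊕ v w ss))
  (interchange (a ∧ s) (b ∧ s) (dot v ss) (dot w ss))
  where open import Algebra.Properties.CommutativeSemigroup (CommutativeRing.+-commutativeSemigroup xor-∧-commutativeRing) using (interchange)

isZero : ∀ {k} → Vec Bool k → Bool
isZero [] = true
isZero (b ∷ v) = not b ∧ isZero v

sign : Bool → ℤ
sign false = pos 1
sign true = -[1+ 0 ]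

sign-xor : ∀ a b → sign (a xor b) ≡ sign a ℤ.* sign b
sign-xor false b = sym (ℤ.*-identityˡ (sign b))
sign-xor true false = refl
sign-xor true true = refl

∣sign∣ : ∀ b → ∣ sign b ∣ ≡ 1
∣sign∣ false = refl
∣sign∣ true = refl

-- Orthogonality of characters: a leading `true` in `w` makes the two values of the first seed bit
-- cancel, a leading `false` makes them double.
character-sum : ∀ {k} (w : Vec Bool k) →
                ∑ℤ.∑ (allBits k) (λ s → sign (dot w (toList s))) ≡ pos (⟦ isZero w ⟧ * 2 ^ k)
character-sum [] = refl
character-sum {suc k} (false ∷ w) = begin
  ∑ℤ.∑ (allBits (suc k)) (λ s → sign (dot (false ∷ w) (toList s)))
    ≡⟨ ∑ℤ.∑-allBits k _ ⟩
  ∑ℤ.∑ (allBits k) (λ s → χ s ℤ.+ χ s)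
    ≡⟨ ∑ℤ.∑-+ (allBits k) χ χ ⟩
  ∑ℤ.∑ (allBits k) χ ℤ.+ ∑ℤ.∑ (allBits k) χ
    ≡⟨ cong₂ ℤ._+_ (character-sum w) (character-sum w) ⟩
  pos (z * 2 ^ k + z * 2 ^ k)
    ≡⟨ cong pos (lem z (2 ^ k)) ⟩
  pos (z * 2 ^ suc k) ∎
  where
  open ≡-Reasoning
  χ : Vec Bool k → ℤ
  χ s = sign (dot w (toList s))
  z = ⟦ isZero w ⟧
  lem : ∀ c t → c * t + c * t ≡ c * (2 * t)
  lem = solve-∀
character-sum {suc k} (true ∷ w) = trans (∑ℤ.∑-allBits k _)
  (trans (∑ℤ.∑-cong (allBits k) (λ s → cancel (dot w (toList s)))) (∑ℤ.∑-zero (allBits k)))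
  where
  cancel : ∀ b → sign b ℤ.+ sign (not b) ≡ pos 0
  cancel false = refl
  cancel true = refl

-- Moments and maxima of signed sums

p4 : ℕ → ℕ
p4 x = (x * x) * (x * x)

p4-abs : ∀ i → (i ℤ.* i) ℤ.* (i ℤ.* i) ≡ pos (p4 ∣ i ∣)
p4-abs i = trans (cong₂ ℤ._*_ (sq i) (sq i)) (sym (ℤ.pos-* (∣ i ∣ * ∣ i ∣) (∣ i ∣ * ∣ i ∣)))
  where
  sq : ∀ i → i ℤ.* i ≡ pos (∣ i ∣ * ∣ i ∣)
  sq (pos n) = sym (ℤ.pos-* n n)
  sq (-[1+ n ]) = refl

δ : ∀ {n} → Fin n → Fin n → ℕ
δ a b = ⟦ does (a ≟ b) ⟧

δ-refl : ∀ {n} (a : Fin n) → δ a a ≡ 1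
δ-refl a with a ≟ a
... | yes _ = refl
... | no a≢a = contradiction refl a≢a

-- The second frequency moment, as the number of pairs of equal entries.
F₂ : ∀ {n} → List (Fin n) → ℕ
F₂ w = ∑ w (λ a → ∑ w (δ a))

signedSum : ∀ {n} → (Fin n → ℤ) → List (Fin n) → ℤ
signedSum e w = ∑ℤ.∑ w e

PairedQuad : ∀ {n} → Fin n → Fin n → Fin n → Fin n → Set
PairedQuad a b c d = (a ≡ b × c ≡ d) ⊎ (a ≡ c × b ≡ d) ⊎ (a ≡ d × b ≡ c)

-- The vectors form a Sidon set in GF(2)^k. The case of equal `b`, `c`, `d` gives injectivity of
-- `v`, so the same vectors can serve for hashing.
QuadFree : ∀ {n k} → (Fin n → Vec Bool k) → Set
QuadFree v = ∀ a b c d → isZero ((v a ⊕ v b) ⊕ (v c ⊕ v d)) ≡ true → PairedQuad a b c d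

signs : ∀ {n k} → (Fin n → Vec Bool k) → Vec Bool k → Fin n → ℤ
signs v s j = sign (dot (v j) (toList s))

-- Expanding the fourth power gives one character per quadruple of positions, and averaging keeps
-- those whose four vectors cancel. `QuadFree` leaves the three ways of pairing a quadruple, each
-- contributing `F₂ w * F₂ w`; quadruples that can be paired in several ways are counted repeatedly,
-- whence an inequality.
fourth-moment : ∀ {n k} (v : Fin n → Vec Bool k) → QuadFree v → (w : List (Fin n)) →
                ∑ (allBits k) (λ s → p4 ∣ signedSum (signs v s) w ∣) ≤ 3 * (F₂ w * F₂ w) * 2 ^ k
fourth-moment {n} {k} v qf w = subst (_≤ 3 * (F₂ w * F₂ w) * 2 ^ k) (sym expansion) bound
  where
  z : Fin n → Fin n → Fin n → Fin n → ℕ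
  z a b c d = ⟦ isZero ((v a ⊕ v b) ⊕ (v c ⊕ v d)) ⟧
  product : ∀ s a b c d → (signs v s a ℤ.* signs v s b) ℤ.* (signs v s c ℤ.* signs v s d)
            ≡ sign (dot ((v a ⊕ v b) ⊕ (v c ⊕ v d)) (toList s))
  product s a b c d = sym (trans (mul (v a ⊕ v b) (v c ⊕ v d)) (cong₂ ℤ._*_ (mul (v a) (v b)) (mul (v c) (v d))))
    where
    mul : ∀ x y → sign (dot (x ⊕ y) (toList s)) ≡ sign (dot x (toList s)) ℤ.* sign (dot y (toList s))
    mul x y = trans (cong sign (dot-⊕ x y (toList s))) (sign-xor (dot x (toList s)) (dot y (toList s)))
  quartic : ∀ (e : Fin n → ℤ) → let S = signedSum e w in
            (S ℤ.* S) ℤ.* (S ℤ.* S) ≡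
            ∑ℤ.∑ w (λ a → ∑ℤ.∑ w (λ b → ∑ℤ.∑ w (λ c → ∑ℤ.∑ w (λ d → (e a ℤ.* e b) ℤ.* (e c ℤ.* e d)))))
  quartic e = begin
    (S ℤ.* S) ℤ.* (S ℤ.* S)
      ≡⟨ cong (λ x → x ℤ.* x) (∑ℤ.∑-product w w e e) ⟩
    S2 ℤ.* S2
      ≡⟨ ∑ℤ.∑-*ʳ S2 w _ ⟨
    ∑ℤ.∑ w (λ a → ∑ℤ.∑ w (λ b → e a ℤ.* e b) ℤ.* S2)
      ≡⟨ ∑ℤ.∑-cong w (λ a → sym (∑ℤ.∑-*ʳ S2 w _)) ⟩
    ∑ℤ.∑ w (λ a → ∑ℤ.∑ w (λ b → (e a ℤ.* e b) ℤ.* S2))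
      ≡⟨ ∑ℤ.∑-cong w (λ a → ∑ℤ.∑-cong w (λ b → sym (∑ℤ.∑-*ˡ (e a ℤ.* e b) w _))) ⟩
    ∑ℤ.∑ w (λ a → ∑ℤ.∑ w (λ b → ∑ℤ.∑ w (λ c → (e a ℤ.* e b) ℤ.* ∑ℤ.∑ w (λ d → e c ℤ.* e d))))
      ≡⟨ ∑ℤ.∑-cong w (λ a → ∑ℤ.∑-cong w (λ b → ∑ℤ.∑-cong w (λ c → sym (∑ℤ.∑-*ˡ (e a ℤ.* e b) w _)))) ⟩
    ∑ℤ.∑ w (λ a → ∑ℤ.∑ w (λ b → ∑ℤ.∑ w (λ c → ∑ℤ.∑ w (λ d → (e a ℤ.* e b) ℤ.* (e c ℤ.* e d))))) ∎
    where
    open ≡-Reasoning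
    S = signedSum e w
    S2 = ∑ℤ.∑ w (λ c → ∑ℤ.∑ w (λ d → e c ℤ.* e d))
  seeds = allBits k
  expansion : ∑ seeds (λ s → p4 ∣ signedSum (signs v s) w ∣) ≡
              ∑ w (λ a → ∑ w (λ b → ∑ w (λ c → ∑ w (λ d → z a b c d * 2 ^ k))))
  expansion = ℤ.+-injective (begin
    pos (∑ seeds (λ s → p4 ∣ signedSum (signs v s) w ∣))
      ≡⟨ ∑-pos seeds _ ⟨
    ∑ℤ.∑ seeds (λ s → pos (p4 ∣ signedSum (signs v s) w ∣))
      ≡⟨ ∑ℤ.∑-cong seeds (λ s → trans (sym (p4-abs (signedSum (signs v s) w))) (quartic (signs v s))) ⟩
    ∑ℤ.∑ seeds (λ s → ∑ℤ.∑ w (λ a → ∑ℤ.∑ w (λ b → ∑ℤ.∑ w (λ c → ∑ℤ.∑ w (λ d → t a b c d s)))))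
      ≡⟨ ∑ℤ.∑-swap seeds w _ ⟩
    ∑ℤ.∑ w (λ a → ∑ℤ.∑ seeds (λ s → ∑ℤ.∑ w (λ b → ∑ℤ.∑ w (λ c → ∑ℤ.∑ w (λ d → t a b c d s)))))
      ≡⟨ ∑ℤ.∑-cong w (λ a → trans (∑ℤ.∑-swap seeds w _)
        (∑ℤ.∑-cong w (λ b → trans (∑ℤ.∑-swap seeds w _)
          (∑ℤ.∑-cong w (λ c → trans (∑ℤ.∑-swap seeds w _)
            (∑ℤ.∑-cong w (λ d → trans (∑ℤ.∑-cong seeds (λ s → product s a b c d)) (character-sum ((v a ⊕ v b) ⊕ (v c ⊕ v d)))))))))) ⟩
    ∑ℤ.∑ w (λ a → ∑ℤ.∑ w (λ b → ∑ℤ.∑ w (λ c → ∑ℤ.∑ w (λ d → pos (z a b c d * 2 ^ k)))))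
      ≡⟨ ∑ℤ.∑-cong w (λ a → trans (∑ℤ.∑-cong w (λ b → trans (∑ℤ.∑-cong w (λ c → ∑-pos w _)) (∑-pos w _))) (∑-pos w _)) ⟩
    ∑ℤ.∑ w (λ a → pos (∑ w (λ b → ∑ w (λ c → ∑ w (λ d → z a b c d * 2 ^ k)))))
      ≡⟨ ∑-pos w _ ⟩
    pos (∑ w (λ a → ∑ w (λ b → ∑ w (λ c → ∑ w (λ d → z a b c d * 2 ^ k))))) ∎)
    where
    open ≡-Reasoning
    t : Fin n → Fin n → Fin n → Fin n → Vec Bool k → ℤ
    t a b c d s = (signs v s a ℤ.* signs v s b) ℤ.* (signs v s c ℤ.* signs v s d)
  pairs : Fin n → Fin n → Fin n → Fin n → ℕ
  pairs a b c d = δ a b * δ c d + (δ a c * δ b d + δ a d * δ b c)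
  z≤pairs : ∀ a b c d → z a b c d ≤ pairs a b c d
  z≤pairs a b c d with isZero ((v a ⊕ v b) ⊕ (v c ⊕ v d)) in eq
  ... | false = z≤n
  ... | true with qf a b c d eq
  ... | inj₁ (refl , refl) rewrite δ-refl a | δ-refl c = s≤s z≤n
  ... | inj₂ (inj₁ (refl , refl)) rewrite δ-refl a | δ-refl b = ≤-trans (m≤m+n 1 _) (m≤n+m _ _)
  ... | inj₂ (inj₂ (refl , refl)) rewrite δ-refl a | δ-refl b = ≤-trans (m≤n+m 1 (δ a b * δ b a)) (m≤n+m _ (δ a b * δ b a))
  open ≡-Reasoning
  ∑⁴ : (Fin n → Fin n → Fin n → Fin n → ℕ) → ℕ
  ∑⁴ f = ∑ w (λ a → ∑ w (λ b → ∑ w (λ c → ∑ w (λ d → f a b c d))))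
  ∑⁴-mono : ∀ {f g} → (∀ a b c d → f a b c d ≤ g a b c d) → ∑⁴ f ≤ ∑⁴ g
  ∑⁴-mono h = ∑-mono w (λ a → ∑-mono w (λ b → ∑-mono w (λ c → ∑-mono w (λ d → h a b c d))))
  ∑⁴-+ : ∀ f g → ∑⁴ (λ a b c d → f a b c d + g a b c d) ≡ ∑⁴ f + ∑⁴ g
  ∑⁴-+ f g = trans (∑-cong w (λ a → trans (∑-cong w (λ b → trans (∑-cong w (λ c → ∑-+ w _ _)) (∑-+ w _ _))) (∑-+ w _ _))) (∑-+ w _ _)
  ∑⁴-*ʳ : ∀ m f → ∑⁴ (λ a b c d → f a b c d * m) ≡ ∑⁴ f * m
  ∑⁴-*ʳ m f = trans (∑-cong w (λ a → trans (∑-cong w (λ b → trans (∑-cong w (λ c → ∑-*ʳ m w _)) (∑-*ʳ m w _))) (∑-*ʳ m w _))) (∑-*ʳ m w _)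
  ab-cd : ∑⁴ (λ a b c d → δ a b * δ c d) ≡ F₂ w * F₂ w
  ab-cd = sym (trans (sym (∑-*ʳ (F₂ w) w _)) (∑-cong w (λ a → trans (sym (∑-*ʳ (F₂ w) w _))
            (∑-cong w (λ b → trans (sym (∑-*ˡ (δ a b) w _)) (∑-cong w (λ c → sym (∑-*ˡ (δ a b) w _))))))))
  ac-bd : ∑⁴ (λ a b c d → δ a c * δ b d) ≡ F₂ w * F₂ w
  ac-bd = trans (∑-cong w (λ a → ∑-swap w w _)) ab-cd
  ad-bc : ∑⁴ (λ a b c d → δ a d * δ b c) ≡ F₂ w * F₂ w
  ad-bc = trans (∑-cong w (λ a → ∑-cong w (λ b → ∑-swap w w _))) ac-bd
  three : ∀ x → x + (x + x) ≡ 3 * x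
  three = solve-∀
  bound : ∑⁴ (λ a b c d → z a b c d * 2 ^ k) ≤ 3 * (F₂ w * F₂ w) * 2 ^ k
  bound = ≤-trans (≤-reflexive (∑⁴-*ʳ (2 ^ k) z)) (*-monoˡ-≤ (2 ^ k) (≤-trans (∑⁴-mono z≤pairs) (≤-reflexive (begin
    ∑⁴ pairs
      ≡⟨ trans (∑⁴-+ (λ a b c d → δ a b * δ c d) (λ a b c d → δ a c * δ b d + δ a d * δ b c))
               (cong (_+_ (∑⁴ (λ a b c d → δ a b * δ c d))) (∑⁴-+ (λ a b c d → δ a c * δ b d) (λ a b c d → δ a d * δ b c))) ⟩
    ∑⁴ (λ a b c d → δ a b * δ c d) + (∑⁴ (λ a b c d → δ a c * δ b d) + ∑⁴ (λ a b c d → δ a d * δ b c))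
      ≡⟨ cong₂ _+_ ab-cd (cong₂ _+_ ac-bd ad-bc) ⟩
    F₂ w * F₂ w + (F₂ w * F₂ w + F₂ w * F₂ w)
      ≡⟨ three (F₂ w * F₂ w) ⟩
    3 * (F₂ w * F₂ w) ∎))))

maxPrefix : ∀ {n} → (Fin n → ℤ) → ℤ → List (Fin n) → ℕ
maxPrefix e z [] = ∣ z ∣
maxPrefix e z (x ∷ w) = ∣ z ∣ ⊔ maxPrefix e (z ℤ.+ e x) w

maxSum : ∀ {n} → (Fin n → ℤ) → List (Fin n) → ℕ
maxSum e = maxPrefix e (pos 0)

maxPrefix-++ : ∀ {n} (e : Fin n → ℤ) z u x v →
               maxPrefix e z (u ++ x ∷ v) ≡ maxPrefix e z u ⊔ maxPrefix e (z ℤ.+ signedSum e (u ++ [ x ])) v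
maxPrefix-++ e z [] x v = cong (λ i → ∣ z ∣ ⊔ maxPrefix e (z ℤ.+ i) v) (sym (ℤ.+-identityʳ (e x)))
maxPrefix-++ e z (y ∷ u) x v = begin
  ∣ z ∣ ⊔ maxPrefix e (z ℤ.+ e y) (u ++ x ∷ v)
    ≡⟨ cong (∣ z ∣ ⊔_) (maxPrefix-++ e (z ℤ.+ e y) u x v) ⟩
  ∣ z ∣ ⊔ (maxPrefix e (z ℤ.+ e y) u ⊔ maxPrefix e ((z ℤ.+ e y) ℤ.+ S) v)
    ≡⟨ ⊔-assoc ∣ z ∣ _ _ ⟨
  (∣ z ∣ ⊔ maxPrefix e (z ℤ.+ e y) u) ⊔ maxPrefix e ((z ℤ.+ e y) ℤ.+ S) v
    ≡⟨ cong (λ i → (∣ z ∣ ⊔ maxPrefix e (z ℤ.+ e y) u) ⊔ maxPrefix e i v) (ℤ.+-assoc z (e y) S) ⟩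
  (∣ z ∣ ⊔ maxPrefix e (z ℤ.+ e y) u) ⊔ maxPrefix e (z ℤ.+ (e y ℤ.+ S)) v ∎
  where
  open ≡-Reasoning
  S = signedSum e (u ++ [ x ])

maxPrefix-shift : ∀ {n} (e : Fin n → ℤ) y z w → maxPrefix e (y ℤ.+ z) w ≤ ∣ y ∣ + maxPrefix e z w
maxPrefix-shift e y z [] = ℤ.∣i+j∣≤∣i∣+∣j∣ y z
maxPrefix-shift e y z (x ∷ w) = ⊔-lub
  (≤-trans (ℤ.∣i+j∣≤∣i∣+∣j∣ y z) (+-monoʳ-≤ ∣ y ∣ (m≤m⊔n _ _)))
  (≤-trans (≤-reflexive (cong (λ i → maxPrefix e i w) (ℤ.+-assoc y z (e x))))
    (≤-trans (maxPrefix-shift e y (z ℤ.+ e x) w) (+-monoʳ-≤ ∣ y ∣ (m≤n⊔m ∣ z ∣ _))))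

prefix≤maxPrefix : ∀ {n} (e : Fin n → ℤ) z u v → ∣ z ℤ.+ signedSum e u ∣ ≤ maxPrefix e z (u ++ v)
prefix≤maxPrefix e z [] [] = ≤-reflexive (cong ∣_∣ (ℤ.+-identityʳ z))
prefix≤maxPrefix e z [] (x ∷ v) = ≤-trans (≤-reflexive (cong ∣_∣ (ℤ.+-identityʳ z))) (m≤m⊔n _ _)
prefix≤maxPrefix e z (x ∷ u) v = ≤-trans (≤-reflexive (cong ∣_∣ (sym (ℤ.+-assoc z (e x) _))))
  (≤-trans (prefix≤maxPrefix e (z ℤ.+ e x) u v) (m≤n⊔m ∣ z ∣ _))

prefix≤maxSum : ∀ {n} (e : Fin n → ℤ) u v → ∣ signedSum e u ∣ ≤ maxSum e (u ++ v)
prefix≤maxSum e u v = subst (λ i → ∣ i ∣ ≤ maxSum e (u ++ v)) (ℤ.+-identityˡ (signedSum e u)) (prefix≤maxPrefix e (pos 0) u v)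

-- The pivot `x` goes to neither side, to suit the cut made by `F₂-halving`: the right-hand maximum
-- is rebased at the sum up to and including `x`.
maxSum-split : ∀ {n} (e : Fin n → ℤ) u x v →
               maxSum e (u ++ x ∷ v) ≤ maxSum e u ⊔ (∣ signedSum e (u ++ [ x ]) ∣ + maxSum e v)
maxSum-split e u x v = ≤-trans (≤-reflexive (maxPrefix-++ e (pos 0) u x v)) (⊔-monoʳ-≤ (maxSum e u)
  (subst (λ i → maxPrefix e i v ≤ ∣ S ∣ + maxSum e v) (trans (ℤ.+-identityʳ S) (sym (ℤ.+-identityˡ S)))
    (maxPrefix-shift e S (pos 0) v)))
  where S = signedSum e (u ++ [ x ])

p4-mono : ∀ {x y} → x ≤ y → p4 x ≤ p4 y
p4-mono x≤y = *-mono-≤ (*-mono-≤ x≤y x≤y) (*-mono-≤ x≤y x≤y)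

p4-⊔ : ∀ x y → p4 (x ⊔ y) ≤ p4 x + p4 y
p4-⊔ x y with ≤-total x y
... | inj₁ x≤y rewrite m≤n⇒m⊔n≡n x≤y = m≤n+m _ _
... | inj₂ y≤x rewrite m≥n⇒m⊔n≡m y≤x = m≤m+n _ _

2xy≤x²+y² : ∀ x y → 2 * (x * y) ≤ x * x + y * y
2xy≤x²+y² x y with ≤-total x y
... | inj₁ x≤y with m≤n⇒∃[o]m+o≡n x≤y
... | o , refl = ≤-trans (m≤m+n _ (o * o)) (≤-reflexive (lem x o))
  where
  lem : ∀ x o → 2 * (x * (x + o)) + o * o ≡ x * x + (x + o) * (x + o)
  lem = solve-∀
2xy≤x²+y² x y | inj₂ y≤x with m≤n⇒∃[o]m+o≡n y≤x
... | o , refl = ≤-trans (m≤m+n _ (o * o)) (≤-reflexive (lem y o))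
  where
  lem : ∀ y o → 2 * ((y + o) * y) + o * o ≡ (y + o) * (y + o) + y * y
  lem = solve-∀

-- Weighted AM-GM: `(x + y)²` is at most `(1 + 4) x² + (1 + 1/4) y²`, here multiplied by 4.
4[x+y]²≤20x²+5y² : ∀ x y → 4 * ((x + y) * (x + y)) ≤ 20 * (x * x) + 5 * (y * y)
4[x+y]²≤20x²+5y² x y = begin
  4 * ((x + y) * (x + y))                           ≡⟨ expand x y ⟩
  4 * (x * x) + 4 * (y * y) + 2 * ((4 * x) * y)     ≤⟨ +-monoʳ-≤ (4 * (x * x) + 4 * (y * y)) (2xy≤x²+y² (4 * x) y) ⟩
  4 * (x * x) + 4 * (y * y) + ((4 * x) * (4 * x) + y * y) ≡⟨ collect x y ⟩
  20 * (x * x) + 5 * (y * y) ∎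
  where
  open ≤-Reasoning
  expand : ∀ x y → 4 * ((x + y) * (x + y)) ≡ 4 * (x * x) + 4 * (y * y) + 2 * ((4 * x) * y)
  expand = solve-∀
  collect : ∀ x y → 4 * (x * x) + 4 * (y * y) + ((4 * x) * (4 * x) + y * y) ≡ 20 * (x * x) + 5 * (y * y)
  collect = solve-∀

-- (x + y)⁴ ≤ (1 + 1/η)³ x⁴ + (1 + η)³ y⁴ with η = 1/4; (1 + η)³ < 3 is what makes the induction in maximal-inequality close.
p4-+ : ∀ x y → 64 * p4 (x + y) ≤ 8000 * p4 x + 125 * p4 y
p4-+ x y = begin
  64 * p4 (x + y)                                 ≡⟨ e₁ ((x + y) * (x + y)) ⟩
  4 * ((4 * X) * (4 * X))                         ≤⟨ *-monoʳ-≤ 4 (*-mono-≤ (4[x+y]²≤20x²+5y² x y) (4[x+y]²≤20x²+5y² x y)) ⟩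
  4 * ((20 * (x * x) + 5 * (y * y)) * (20 * (x * x) + 5 * (y * y))) ≡⟨ e₂ (x * x) (y * y) ⟩
  25 * (4 * ((4 * (x * x) + y * y) * (4 * (x * x) + y * y))) ≤⟨ *-monoʳ-≤ 25 (4[x+y]²≤20x²+5y² (4 * (x * x)) (y * y)) ⟩
  25 * (20 * ((4 * (x * x)) * (4 * (x * x))) + 5 * ((y * y) * (y * y))) ≡⟨ e₃ (x * x) (y * y) ⟩
  8000 * p4 x + 125 * p4 y ∎
  where
  open ≤-Reasoning
  X = (x + y) * (x + y)
  e₁ : ∀ a → 64 * (a * a) ≡ 4 * ((4 * a) * (4 * a))
  e₁ = solve-∀
  e₂ : ∀ a b → 4 * ((20 * a + 5 * b) * (20 * a + 5 * b)) ≡ 25 * (4 * ((4 * a + b) * (4 * a + b)))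
  e₂ = solve-∀
  e₃ : ∀ a b → 25 * (20 * ((4 * a) * (4 * a)) + 5 * (b * b)) ≡ 8000 * (a * a) + 125 * (b * b)
  e₃ = solve-∀

F₂-++ : ∀ {n} (u v : List (Fin n)) → F₂ u + F₂ v ≤ F₂ (u ++ v)
F₂-++ u v = begin
  F₂ u + F₂ v
    ≤⟨ +-mono-≤ (∑-mono u (λ a → ≤-trans (m≤m+n _ (∑ v (δ a))) (≤-reflexive (sym (∑-++ u v (δ a))))))
                (∑-mono v (λ a → ≤-trans (m≤n+m _ (∑ u (δ a))) (≤-reflexive (sym (∑-++ u v (δ a)))))) ⟩
  ∑ u (λ a → ∑ (u ++ v) (δ a)) + ∑ v (λ a → ∑ (u ++ v) (δ a))
    ≡⟨ ∑-++ u v _ ⟨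
  F₂ (u ++ v) ∎
  where open ≤-Reasoning

-- The cut moves right as long as the prefix including `x` carries at most half. Once that prefix
-- exceeds half, superadditivity leaves less than half for what follows. A single entry can jump
-- over the midpoint, which is why it is kept out of both pieces.
F₂-halving : ∀ {n} (y : Fin n) w → ∃[ u ] ∃[ x ] ∃[ v ] (y ∷ w ≡ u ++ x ∷ v × 2 * F₂ u ≤ F₂ (y ∷ w) × 2 * F₂ v ≤ F₂ (y ∷ w))
F₂-halving {n} y w = go [] y w z≤n
  where
  go : ∀ u x v → 2 * F₂ u ≤ F₂ (u ++ x ∷ v) →
       ∃[ u' ] ∃[ x' ] ∃[ v' ] (u ++ x ∷ v ≡ u' ++ x' ∷ v' × 2 * F₂ u' ≤ F₂ (u ++ x ∷ v) × 2 * F₂ v' ≤ F₂ (u ++ x ∷ v))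
  go u x [] h = u , x , [] , refl , h , z≤n
  go u x (x' ∷ v) h with 2 * F₂ (u ++ [ x ]) ≤? F₂ (u ++ x ∷ x' ∷ v)
  ... | yes h' = subst (λ l → ∃[ u' ] ∃[ x″ ] ∃[ v' ] (l ≡ u' ++ x″ ∷ v' × 2 * F₂ u' ≤ F₂ l × 2 * F₂ v' ≤ F₂ l))
                   (List.++-assoc u [ x ] (x' ∷ v))
                   (go (u ++ [ x ]) x' v (≤-trans h' (≤-reflexive (cong F₂ (sym (List.++-assoc u [ x ] (x' ∷ v)))))))
  ... | no h' = u , x , x' ∷ v , refl , h , half
    where
    open ≤-Reasoning
    total = F₂ (u ++ x ∷ x' ∷ v)
    parts : F₂ (u ++ [ x ]) + F₂ (x' ∷ v) ≤ total
    parts = ≤-trans (F₂-++ (u ++ [ x ]) (x' ∷ v)) (≤-reflexive (cong F₂ (List.++-assoc u [ x ] (x' ∷ v))))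
    e : ∀ a b → 2 * b + 2 * a ≡ 2 * (a + b)
    e = solve-∀
    e' : ∀ a → 2 * a ≡ a + a
    e' = solve-∀
    half : 2 * F₂ (x' ∷ v) ≤ total
    half = +-cancelʳ-≤ total _ _ (begin
      2 * F₂ (x' ∷ v) + total                  ≤⟨ +-monoʳ-≤ _ (<⇒≤ (≰⇒> h')) ⟩
      2 * F₂ (x' ∷ v) + 2 * F₂ (u ++ [ x ])    ≡⟨ e (F₂ (u ++ [ x ])) (F₂ (x' ∷ v)) ⟩
      2 * (F₂ (u ++ [ x ]) + F₂ (x' ∷ v))      ≤⟨ *-monoʳ-≤ 2 parts ⟩
      2 * total                                ≡⟨ e' total ⟩
      total + total ∎)

-- Splitting at the point where F₂ reaches half its value leaves two pieces with F₂² at most a quarter each,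
-- so the contributions of the pieces sum to less than the whole and leave room for the fourth moment at the split.
-- The constant 1500 is a solution A of 64 A + 125 A + 96000 ≤ 256 A.
maximal-inequality : ∀ {n k} (v : Fin n → Vec Bool k) → QuadFree v → (w : List (Fin n)) →
                     ∑ (allBits k) (λ s → p4 (maxSum (signs v s) w)) ≤ 1500 * (F₂ w * F₂ w) * 2 ^ k
maximal-inequality {n} {k} v qf w = go (length w) w ≤-refl
  where
  seeds = allBits k
  T = 2 ^ k
  Φ : List (Fin n) → ℕ
  Φ w = ∑ seeds (λ s → p4 (maxSum (signs v s) w))
  Ψ : List (Fin n) → ℕ
  Ψ w = ∑ seeds (λ s → p4 ∣ signedSum (signs v s) w ∣)
  open ≤-Reasoning
  pointwise : ∀ e u x t → 64 * p4 (maxSum e (u ++ x ∷ t)) ≤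
              64 * p4 (maxSum e u) + (8000 * p4 ∣ signedSum e (u ++ [ x ]) ∣ + 125 * p4 (maxSum e t))
  pointwise e u x t = begin
    64 * p4 (maxSum e (u ++ x ∷ t))
      ≤⟨ *-monoʳ-≤ 64 (≤-trans (p4-mono (maxSum-split e u x t)) (p4-⊔ (maxSum e u) _)) ⟩
    64 * (p4 (maxSum e u) + p4 (∣ signedSum e (u ++ [ x ]) ∣ + maxSum e t))
      ≡⟨ *-distribˡ-+ 64 (p4 (maxSum e u)) _ ⟩
    64 * p4 (maxSum e u) + 64 * p4 (∣ signedSum e (u ++ [ x ]) ∣ + maxSum e t)
      ≤⟨ +-monoʳ-≤ (64 * p4 (maxSum e u)) (p4-+ ∣ signedSum e (u ++ [ x ]) ∣ (maxSum e t)) ⟩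
    64 * p4 (maxSum e u) + (8000 * p4 ∣ signedSum e (u ++ [ x ]) ∣ + 125 * p4 (maxSum e t)) ∎
  summed : ∀ u x t → 64 * Φ (u ++ x ∷ t) ≤ 64 * Φ u + (8000 * Ψ (u ++ [ x ]) + 125 * Φ t)
  summed u x t = begin
    64 * Φ (u ++ x ∷ t)
      ≡⟨ ∑-*ˡ 64 seeds _ ⟨
    ∑ seeds (λ s → 64 * p4 (maxSum (signs v s) (u ++ x ∷ t)))
      ≤⟨ ∑-mono seeds (λ s → pointwise (signs v s) u x t) ⟩
    ∑ seeds (λ s → 64 * p4 (maxSum (signs v s) u) + (8000 * p4 ∣ signedSum (signs v s) (u ++ [ x ]) ∣ + 125 * p4 (maxSum (signs v s) t)))
      ≡⟨ trans (∑-+ seeds _ _) (cong₂ _+_ (∑-*ˡ 64 seeds _) (trans (∑-+ seeds _ _) (cong₂ _+_ (∑-*ˡ 8000 seeds _) (∑-*ˡ 125 seeds _)))) ⟩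
    64 * Φ u + (8000 * Ψ (u ++ [ x ]) + 125 * Φ t) ∎
  quarter : ∀ {a b} → 2 * a ≤ b → 4 * (a * a) ≤ b * b
  quarter {a} {b} h = ≤-trans (≤-reflexive (e a)) (*-mono-≤ h h)
    where
    e : ∀ a → 4 * (a * a) ≡ (2 * a) * (2 * a)
    e = solve-∀
  combine : ∀ {φ φu ψ φt fu ft f} → 64 * φ ≤ 64 * φu + (8000 * ψ + 125 * φt) →
            φu ≤ 1500 * fu * T → ψ ≤ 3 * f * T → φt ≤ 1500 * ft * T → 4 * fu ≤ f → 4 * ft ≤ f →
            φ ≤ 1500 * f * T
  combine {φ} {φu} {ψ} {φt} {fu} {ft} {f} h hu hψ ht qu qt = *-cancelˡ-≤ 256 (begin
    256 * φ                                               ≡⟨ e₁ φ ⟩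
    4 * (64 * φ)                                          ≤⟨ *-monoʳ-≤ 4 h ⟩
    4 * (64 * φu + (8000 * ψ + 125 * φt))
      ≤⟨ *-monoʳ-≤ 4 (+-mono-≤ (*-monoʳ-≤ 64 hu) (+-mono-≤ (*-monoʳ-≤ 8000 hψ) (*-monoʳ-≤ 125 ht))) ⟩
    4 * (64 * (1500 * fu * T) + (8000 * (3 * f * T) + 125 * (1500 * ft * T)))
      ≡⟨ e₂ fu ft f T ⟩
    (96000 * (4 * fu) + 187500 * (4 * ft) + 96000 * f) * T
      ≤⟨ *-monoˡ-≤ T (+-monoˡ-≤ (96000 * f) (+-mono-≤ (*-monoʳ-≤ 96000 qu) (*-monoʳ-≤ 187500 qt))) ⟩
    (96000 * f + 187500 * f + 96000 * f) * T
      -- `4500` is the slack `256 * 1500 - (96000 + 187500 + 96000)`.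
      ≤⟨ m≤m+n _ (4500 * f * T) ⟩
    (96000 * f + 187500 * f + 96000 * f) * T + 4500 * f * T
      ≡⟨ e₃ f T ⟩
    256 * (1500 * f * T) ∎)
    where
    e₁ : ∀ x → 256 * x ≡ 4 * (64 * x)
    e₁ = solve-∀
    e₂ : ∀ fu ft f T → 4 * (64 * (1500 * fu * T) + (8000 * (3 * f * T) + 125 * (1500 * ft * T)))
         ≡ (96000 * (4 * fu) + 187500 * (4 * ft) + 96000 * f) * T
    e₂ = solve-∀
    e₃ : ∀ f T → (96000 * f + 187500 * f + 96000 * f) * T + 4500 * f * T ≡ 256 * (1500 * f * T)
    e₃ = solve-∀
  go : ∀ m w → length w ≤ m → Φ w ≤ 1500 * (F₂ w * F₂ w) * T
  go m [] _ = ≤-trans (≤-reflexive (∑-zero seeds)) z≤n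
  go (suc m) (y ∷ w) (s≤s len) with F₂-halving y w
  ... | u , x , t , eq , hu , ht = subst (λ l → Φ l ≤ 1500 * (F₂ l * F₂ l) * T) (sym eq)
    (combine {fu = F₂ u * F₂ u} {ft = F₂ t * F₂ t} (summed u x t) (go m u u-short) (≤-trans (fourth-moment v qf (u ++ [ x ])) ψ-mono) (go m t t-short)
      (quarter {F₂ u} hu') (quarter {F₂ t} ht'))
    where
    hu' : 2 * F₂ u ≤ F₂ (u ++ x ∷ t)
    hu' = subst (λ l → 2 * F₂ u ≤ F₂ l) eq hu
    ht' : 2 * F₂ t ≤ F₂ (u ++ x ∷ t)
    ht' = subst (λ l → 2 * F₂ t ≤ F₂ l) eq ht
    total-length : suc (length u + length t) ≤ suc m
    total-length = begin
      suc (length u + length t)   ≡⟨ +-suc (length u) (length t) ⟨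
      length u + length (x ∷ t)   ≡⟨ List.length-++ u ⟨
      length (u ++ x ∷ t)         ≡⟨ cong length eq ⟨
      suc (length w)              ≤⟨ s≤s len ⟩
      suc m ∎
    u-short : length u ≤ m
    u-short = ≤-trans (m≤m+n _ _) (≤-pred total-length)
    t-short : length t ≤ m
    t-short = ≤-trans (m≤n+m _ (length u)) (≤-pred total-length)
    F₂≤ : F₂ (u ++ [ x ]) ≤ F₂ (u ++ x ∷ t)
    F₂≤ = ≤-trans (m≤m+n _ (F₂ t)) (≤-trans (F₂-++ (u ++ [ x ]) t) (≤-reflexive (cong F₂ (List.++-assoc u [ x ] t))))
    ψ-mono : 3 * (F₂ (u ++ [ x ]) * F₂ (u ++ [ x ])) * T ≤ 3 * (F₂ (u ++ x ∷ t) * F₂ (u ++ x ∷ t)) * T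
    ψ-mono = *-monoˡ-≤ T (*-monoʳ-≤ 3 (*-mono-≤ F₂≤ F₂≤))

-- Quad-free vectors, chosen greedily

⊕-comm : ∀ {k} (x y : Vec Bool k) → x ⊕ y ≡ y ⊕ x
⊕-comm [] [] = refl
⊕-comm (a ∷ x) (b ∷ y) = cong₂ _∷_ (xor-comm a b) (⊕-comm x y)

⊕-cancel : ∀ {k} (x y : Vec Bool k) → x ⊕ (x ⊕ y) ≡ y
⊕-cancel [] [] = refl
⊕-cancel (a ∷ x) (b ∷ y) = cong₂ _∷_ (trans (sym (xor-assoc a a b)) (cong (_xor b) (xor-same a))) (⊕-cancel x y)

⊕-self : ∀ {k} (x y : Vec Bool k) → x ⊕ x ≡ y ⊕ y
⊕-self [] [] = refl
⊕-self (a ∷ x) (b ∷ y) = cong₂ _∷_ (trans (xor-same a) (sym (xor-same b))) (⊕-self x y)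

⊕-injectiveˡ : ∀ {k} (x : Vec Bool k) {y z} → x ⊕ y ≡ x ⊕ z → y ≡ z
⊕-injectiveˡ x {y} {z} eq = trans (sym (⊕-cancel x y)) (trans (cong (x ⊕_) eq) (⊕-cancel x z))

isZero-⊕ : ∀ {k} (x y : Vec Bool k) → isZero (x ⊕ y) ≡ true → x ≡ y
isZero-⊕ [] [] _ = refl
isZero-⊕ (false ∷ x) (false ∷ y) eq = cong (false ∷_) (isZero-⊕ x y eq)
isZero-⊕ (true ∷ x) (true ∷ y) eq = cong (true ∷_) (isZero-⊕ x y eq)

isZero-self : ∀ {k} (x : Vec Bool k) → isZero (x ⊕ x) ≡ true
isZero-self [] = refl
isZero-self (false ∷ x) = isZero-self x
isZero-self (true ∷ x) = isZero-self x

tailsOf : ∀ {k} → Bool → List (Vec Bool (suc k)) → List (Vec Bool k)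
tailsOf b [] = []
tailsOf false ((false ∷ v) ∷ vs) = v ∷ tailsOf false vs
tailsOf false ((true ∷ v) ∷ vs) = tailsOf false vs
tailsOf true ((false ∷ v) ∷ vs) = tailsOf true vs
tailsOf true ((true ∷ v) ∷ vs) = v ∷ tailsOf true vs

length-tailsOf : ∀ {k} (vs : List (Vec Bool (suc k))) → length (tailsOf false vs) + length (tailsOf true vs) ≡ length vs
length-tailsOf [] = refl
length-tailsOf ((false ∷ v) ∷ vs) = cong suc (length-tailsOf vs)
length-tailsOf ((true ∷ v) ∷ vs) = trans (+-suc _ _) (cong suc (length-tailsOf vs))

∈-tailsOf : ∀ {k} b {v : Vec Bool k} {vs} → (b ∷ v) ∈ vs → v ∈ tailsOf b vs
∈-tailsOf false (here refl) = here refl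
∈-tailsOf true (here refl) = here refl
∈-tailsOf false {vs = (false ∷ _) ∷ _} (there m) = there (∈-tailsOf false m)
∈-tailsOf false {vs = (true ∷ _) ∷ _} (there m) = ∈-tailsOf false m
∈-tailsOf true {vs = (false ∷ _) ∷ _} (there m) = ∈-tailsOf true m
∈-tailsOf true {vs = (true ∷ _) ∷ _} (there m) = there (∈-tailsOf true m)

-- Pigeonhole, one coordinate at a time: a list shorter than the cube leaves one of the two half
-- cubes with fewer listed vectors than points.
∃-∉ : ∀ {k} (vs : List (Vec Bool k)) → length vs < 2 ^ k → ∃[ v ] v ∉ vs
∃-∉ {zero} [] _ = [] , λ ()
∃-∉ {zero} (v ∷ vs) (s≤s ())
∃-∉ {suc k} vs few with length (tailsOf false vs) <? 2 ^ k
... | yes lt = let v , v∉ = ∃-∉ (tailsOf false vs) lt in false ∷ v , λ m → v∉ (∈-tailsOf false m)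
... | no nlt = let v , v∉ = ∃-∉ (tailsOf true vs) lt in true ∷ v , λ m → v∉ (∈-tailsOf true m)
  where
  open ≤-Reasoning
  lt : length (tailsOf true vs) < 2 ^ k
  lt = +-cancelˡ-< (2 ^ k) _ _ (begin-strict
    2 ^ k + length (tailsOf true vs)                   ≤⟨ +-monoˡ-≤ _ (≮⇒≥ nlt) ⟩
    length (tailsOf false vs) + length (tailsOf true vs) ≡⟨ length-tailsOf vs ⟩
    length vs                                          <⟨ few ⟩
    2 ^ k + (2 ^ k + 0)                                ≡⟨ cong (_+_ (2 ^ k)) (+-identityʳ (2 ^ k)) ⟩
    2 ^ k + 2 ^ k ∎)

quadFree-injective : ∀ {n k} {v : Fin n → Vec Bool k} → QuadFree v → ∀ {a b} → v a ≡ v b → a ≡ b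
quadFree-injective {v = v} qf {a} {b} eq
  with qf a b b b (subst (λ x → isZero ((x ⊕ v b) ⊕ (v b ⊕ v b)) ≡ true) (sym eq) (isZero-self (v b ⊕ v b)))
... | inj₁ (e , _) = e
... | inj₂ (inj₁ (e , _)) = e
... | inj₂ (inj₂ (e , _)) = e

consVec : ∀ {t k} → Vec Bool k → (Fin t → Vec Bool k) → Fin (suc t) → Vec Bool k
consVec u v zero = u
consVec u v (suc i) = v i

-- Sort by how often the new vector occurs among the four. Once would make it a sum of three old
-- ones; three times would make it equal to some `v i`, which is again such a sum,
-- `v i ⊕ (v i ⊕ v i)`; an even number cancels and leaves a relation between old vectors.
quadFree-cons : ∀ {t k} (u : Vec Bool k) (v : Fin t → Vec Bool k) →
                (∀ i j l → u ≢ v i ⊕ (v j ⊕ v l)) → QuadFree v → QuadFree (consVec u v)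
quadFree-cons {t} u v fresh qf a b c d iz = go a b c d (isZero-⊕ (consVec u v a ⊕ consVec u v b) _ iz)
  where
  v' = consVec u v
  inj : ∀ {i j} → v i ≡ v j → suc i ≡ suc j
  inj eq = cong suc (quadFree-injective {v = v} qf eq)
  single : ∀ i j l → u ⊕ v i ≡ v j ⊕ v l → ⊥
  single i j l eq = fresh i j l (⊕-injectiveˡ (v i) (trans (⊕-comm (v i) u) (trans eq (sym (⊕-cancel (v i) _)))))
  triple : ∀ i → u ⊕ u ≡ u ⊕ v i → ⊥
  triple i eq = fresh i i i (trans (⊕-injectiveˡ u eq) (sym (⊕-cancel (v i) (v i))))
  go : ∀ a b c d → v' a ⊕ v' b ≡ v' c ⊕ v' d → PairedQuad a b c d
  go zero zero zero zero eq = inj₁ (refl , refl)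
  go zero zero zero (suc d) eq = ⊥-elim (triple d eq)
  go zero zero (suc c) zero eq = ⊥-elim (triple c (trans eq (⊕-comm (v c) u)))
  go zero zero (suc c) (suc d) eq = inj₁ (refl , inj (⊕-injectiveˡ (v c) (trans (⊕-self (v c) u) eq)))
  go zero (suc b) zero zero eq = ⊥-elim (triple b (sym eq))
  go zero (suc b) zero (suc d) eq = inj₂ (inj₁ (refl , inj (⊕-injectiveˡ u eq)))
  go zero (suc b) (suc c) zero eq = inj₂ (inj₂ (refl , inj (⊕-injectiveˡ u (trans eq (⊕-comm (v c) u)))))
  go zero (suc b) (suc c) (suc d) eq = ⊥-elim (single b c d eq)
  go (suc a) zero zero zero eq = ⊥-elim (triple a (trans (sym eq) (⊕-comm (v a) u)))
  go (suc a) zero zero (suc d) eq = inj₂ (inj₂ (inj (⊕-injectiveˡ u (trans (⊕-comm u (v a)) eq)) , refl))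
  go (suc a) zero (suc c) zero eq = inj₂ (inj₁ (inj (⊕-injectiveˡ u (trans (⊕-comm u (v a)) (trans eq (⊕-comm (v c) u)))) , refl))
  go (suc a) zero (suc c) (suc d) eq = ⊥-elim (single a c d (trans (⊕-comm u (v a)) eq))
  go (suc a) (suc b) zero zero eq = inj₁ (inj (⊕-injectiveˡ (v b) (trans (⊕-comm (v b) (v a)) (trans eq (⊕-self u (v b))))) , refl)
  go (suc a) (suc b) zero (suc d) eq = ⊥-elim (single d a b (sym eq))
  go (suc a) (suc b) (suc c) zero eq = ⊥-elim (single c a b (trans (⊕-comm u (v c)) (sym eq)))
  go (suc a) (suc b) (suc c) (suc d) eq
    with qf a b c d (subst (λ x → isZero (x ⊕ (v c ⊕ v d)) ≡ true) (sym eq) (isZero-self (v c ⊕ v d)))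
  ... | inj₁ (e , e') = inj₁ (cong suc e , cong suc e')
  ... | inj₂ (inj₁ (e , e')) = inj₂ (inj₁ (cong suc e , cong suc e'))
  ... | inj₂ (inj₂ (e , e')) = inj₂ (inj₂ (cong suc e , cong suc e'))

length-cartesianProductWith : {A B C : Set} (f : A → B → C) (xs : List A) (ys : List B) →
                              length (cartesianProductWith f xs ys) ≡ length xs * length ys
length-cartesianProductWith f [] ys = refl
length-cartesianProductWith f (x ∷ xs) ys = trans (List.length-++ (map (f x) ys))
  (cong₂ _+_ (List.length-map (f x) ys) (length-cartesianProductWith f xs ys))

-- Greedy choice in the manner of Gilbert and Varshamov: `t` old vectors rule out at most
-- `t * (t * t)` candidates, fewer than the `2 ^ k` available.
∃-quadFree : ∀ k t → t * (t * t) ≤ 2 ^ k → Σ (Fin t → Vec Bool k) QuadFree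
∃-quadFree k zero _ = (λ ()) , λ ()
∃-quadFree k (suc t) le = consVec u v , quadFree-cons u v fresh qf
  where
  cube< : t * (t * t) < suc t * (suc t * suc t)
  cube< = *-mono-< {t} ≤-refl (*-mono-< {t} ≤-refl (n<1+n t))
  prev = ∃-quadFree k t (≤-trans (<⇒≤ cube<) le)
  v = proj₁ prev
  qf = proj₂ prev
  vs = tabulate v
  sums = cartesianProductWith _⊕_ vs (cartesianProductWith _⊕_ vs vs)
  length-sums : length sums ≡ t * (t * t)
  length-sums = trans (length-cartesianProductWith _⊕_ vs (cartesianProductWith _⊕_ vs vs))
    (cong₂ _*_ (List.length-tabulate v) (trans (length-cartesianProductWith _⊕_ vs vs)
      (cong₂ _*_ (List.length-tabulate v) (List.length-tabulate v))))
  new = ∃-∉ sums (subst (_< 2 ^ k) (sym length-sums) (<-≤-trans cube< le))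
  u = proj₁ new
  fresh : ∀ i j l → u ≢ v i ⊕ (v j ⊕ v l)
  fresh i j l eq = proj₂ new (subst (_∈ sums) (sym eq)
    (∈-cartesianProductWith⁺ _⊕_ (∈-tabulate⁺ i) (∈-cartesianProductWith⁺ _⊕_ (∈-tabulate⁺ j) (∈-tabulate⁺ l))))

-- Toeplitz hashing

-- Row `i` of a Toeplitz matrix: the seed window is shifted by `i`, so `r` hash bits take about
-- `r + k` seed bits and not `r * k`.
hashBit : ∀ {k} → Vec Bool k → List Bool → ℕ → Bool
hashBit v ρ i = dot v (drop i ρ)

-- Newest bit first, so that learning a bit is a cons.
prefixBits : (ℕ → Bool) → ℕ → List Bool
prefixBits b zero = []
prefixBits b (suc r) = b r ∷ prefixBits b r

hashPrefix : ∀ {k} → Vec Bool k → List Bool → ℕ → List Bool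
hashPrefix v ρ = prefixBits (hashBit v ρ)

_≟ᴸ_ : (b c : List Bool) → Dec (b ≡ c)
_≟ᴸ_ = List.≡-dec _≟ᵇ_

-- The hash is linear, so a collision of `u` and `v` is an event about `u ⊕ v` alone; this is that
-- event.
vanishes : ∀ {k} → Vec Bool k → ℕ → List Bool → Bool
vanishes w zero ρ = true
vanishes w (suc r) ρ = not (dot w ρ) ∧ vanishes w r (drop 1 ρ)

dot-[] : ∀ {k} (w : Vec Bool k) → dot w [] ≡ false
dot-[] [] = refl
dot-[] (b ∷ w) = refl

vanishes-false∷ : ∀ {k} (w : Vec Bool k) r ρ → vanishes (false ∷ w) r ρ ≡ vanishes w r (drop 1 ρ)
vanishes-false∷ w zero ρ = refl
vanishes-false∷ w (suc r) [] rewrite dot-[] w = vanishes-false∷ w r []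
vanishes-false∷ w (suc r) (s ∷ ρ) = cong (not (dot w ρ) ∧_) (vanishes-false∷ w r ρ)

-- Look at the leading coordinate of `w`. If it is `false`, the first seed bit enters none of the
-- conditions and the vector can be shortened. If it is `true`, the first seed bit enters the first
-- condition only, and exactly one of its two values satisfies it. With `r + k ≤ m` all windows stay
-- inside the seed.
vanishes-count : ∀ {k} (w : Vec Bool k) → isZero w ≡ false → ∀ r m → r + k ≤ m →
                 2 ^ r * ∑ (allBits m) (λ s → ⟦ vanishes w r (toList s) ⟧) ≡ 2 ^ m
vanishes-count {suc k} (b ∷ w) nz zero m le =
  trans (+-identityʳ _) (trans (∑-allBits-const m 1) (+-identityʳ _))
vanishes-count {suc k} (b ∷ w) nz (suc r) (suc m) (s≤s le) with b
... | false = begin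
  2 ^ suc r * ∑ (allBits (suc m)) (λ s → ⟦ vanishes (false ∷ w) (suc r) (toList s) ⟧)
    ≡⟨ cong (2 ^ suc r *_) (∑-allBits m _) ⟩
  2 ^ suc r * ∑ (allBits m) (λ s → f false s + f true s)
    ≡⟨ cong (2 ^ suc r *_) (∑-cong (allBits m) λ s →
         trans (cong₂ _+_ (cong ⟦_⟧ (vanishes-false∷ w (suc r) (false ∷ toList s))) (cong ⟦_⟧ (vanishes-false∷ w (suc r) (true ∷ toList s))))
               (e (g s))) ⟩
  2 ^ suc r * ∑ (allBits m) (λ s → 2 * g s)
    ≡⟨ cong (2 ^ suc r *_) (∑-*ˡ 2 (allBits m) g) ⟩
  2 ^ suc r * (2 * ∑ (allBits m) g)
    ≡⟨ e' (2 ^ suc r) (∑ (allBits m) g) ⟩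
  2 * (2 ^ suc r * ∑ (allBits m) g)
    ≡⟨ cong (2 *_) (vanishes-count w nz (suc r) m (≤-trans (≤-reflexive (sym (+-suc r k))) le)) ⟩
  2 ^ suc m ∎
  where
  open ≡-Reasoning
  f : Bool → Vec Bool m → ℕ
  f b s = ⟦ vanishes (false ∷ w) (suc r) (b ∷ toList s) ⟧
  g : Vec Bool m → ℕ
  g s = ⟦ vanishes w (suc r) (toList s) ⟧
  e : ∀ x → x + x ≡ 2 * x
  e = solve-∀
  e' : ∀ x y → x * (2 * y) ≡ 2 * (x * y)
  e' = solve-∀
... | true = begin
  2 ^ suc r * ∑ (allBits (suc m)) (λ s → ⟦ vanishes (true ∷ w) (suc r) (toList s) ⟧)
    ≡⟨ cong (2 ^ suc r *_) (∑-allBits m _) ⟩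
  2 ^ suc r * ∑ (allBits m) (λ s → f false s + f true s)
    ≡⟨ cong (2 ^ suc r *_) (∑-cong (allBits m) (λ s → e (dot w (toList s)) (vanishes (true ∷ w) r (toList s)))) ⟩
  2 ^ suc r * ∑ (allBits m) (λ s → ⟦ vanishes (true ∷ w) r (toList s) ⟧)
    ≡⟨ *-assoc 2 (2 ^ r) _ ⟩
  2 * (2 ^ r * ∑ (allBits m) (λ s → ⟦ vanishes (true ∷ w) r (toList s) ⟧))
    ≡⟨ cong (2 *_) (vanishes-count (true ∷ w) refl r m le) ⟩
  2 ^ suc m ∎
  where
  open ≡-Reasoning
  f : Bool → Vec Bool m → ℕ
  f b s = ⟦ vanishes (true ∷ w) (suc r) (b ∷ toList s) ⟧
  e : ∀ d x → ⟦ not d ∧ x ⟧ + ⟦ not (not d) ∧ x ⟧ ≡ ⟦ x ⟧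
  e false x = +-identityʳ _
  e true x = refl

hashPrefix≡⇒vanishes : ∀ {k} (u v : Vec Bool k) ρ r → hashPrefix u ρ r ≡ hashPrefix v ρ r → vanishes (u ⊕ v) r ρ ≡ true
hashPrefix≡⇒vanishes u v ρ r eq = go r ρ (bits r eq)
  where
  bits : ∀ r → hashPrefix u ρ r ≡ hashPrefix v ρ r → ∀ i → i < r → hashBit u ρ i ≡ hashBit v ρ i
  bits (suc r) eq i (s≤s i≤r) with m≤n⇒m<n∨m≡n i≤r
  ... | inj₁ i<r = bits r (List.∷-injectiveʳ eq) i i<r
  ... | inj₂ refl = List.∷-injectiveˡ eq
  go : ∀ r ρ → (∀ i → i < r → hashBit u ρ i ≡ hashBit v ρ i) → vanishes (u ⊕ v) r ρ ≡ true
  go zero ρ h = refl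
  go (suc r) ρ h rewrite dot-⊕ u v ρ | h 0 (s≤s z≤n) | xor-same (dot v ρ) =
    go r (drop 1 ρ) (λ i i<r → trans (cong (dot u) (List.drop-drop 1 i ρ)) (trans (h (suc i) (s≤s i<r)) (cong (dot v) (sym (List.drop-drop 1 i ρ)))))

hashPrefix-collision : ∀ {k} (u v : Vec Bool k) → u ≢ v → ∀ r m → r + k ≤ m →
  2 ^ r * ∑ (allBits m) (λ s → ⟦ does (hashPrefix u (toList s) r ≟ᴸ hashPrefix v (toList s) r) ⟧) ≤ 2 ^ m
hashPrefix-collision u v u≢v r m le = ≤-trans (*-monoʳ-≤ (2 ^ r) (∑-mono (allBits m) pointwise))
  (≤-reflexive (vanishes-count (u ⊕ v) nz r m le))
  where
  nz : isZero (u ⊕ v) ≡ false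
  nz with isZero (u ⊕ v) in eq
  ... | true = contradiction (isZero-⊕ u v eq) u≢v
  ... | false = refl
  pointwise : ∀ s → ⟦ does (hashPrefix u (toList s) r ≟ᴸ hashPrefix v (toList s) r) ⟧ ≤ ⟦ vanishes (u ⊕ v) r (toList s) ⟧
  pointwise s with hashPrefix u (toList s) r ≟ᴸ hashPrefix v (toList s) r
  ... | yes eq rewrite hashPrefix≡⇒vanishes u v (toList s) r eq = ≤-refl
  ... | no _ = z≤n

-- Frequency moments of substreams

∑-mono-∈ : {A : Set} (xs : List A) {f g : A → ℕ} → (∀ x → x ∈ xs → f x ≤ g x) → ∑ xs f ≤ ∑ xs g
∑-mono-∈ [] h = z≤n
∑-mono-∈ (x ∷ xs) h = +-mono-≤ (h x (here refl)) (∑-mono-∈ xs (λ y m → h y (there m)))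

∑-filter-≤ : {A : Set} {P : A → Set} (P? : ∀ x → Dec (P x)) (xs : List A) (f : A → ℕ) → ∑ (filter P? xs) f ≤ ∑ xs f
∑-filter-≤ P? [] f = z≤n
∑-filter-≤ P? (x ∷ xs) f with does (P? x)
... | true  = +-monoʳ-≤ (f x) (∑-filter-≤ P? xs f)
... | false = ≤-trans (∑-filter-≤ P? xs f) (m≤n+m _ (f x))

∑-member : {A : Set} (xs : List A) (f : A → ℕ) {x : A} → x ∈ xs → f x ≤ ∑ xs f
∑-member (y ∷ xs) f (here refl) = m≤m+n _ _
∑-member (y ∷ xs) f (there m) = ≤-trans (∑-member xs f m) (m≤n+m _ (f y))

sum-map : {A : Set} (f : A → ℕ) (xs : List A) → sum (map f xs) ≡ ∑ xs f
sum-map f [] = refl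
sum-map f (x ∷ xs) = cong (_+_ (f x)) (sum-map f xs)

others : ∀ {n} → Fin n → List (Fin n) → List (Fin n)
others H = filter (λ x → ¬? (x ≟ H))

-- One side counts pairs of positions, the other squares frequencies of values. Every entry of `w`
-- is among the values `J`, so the factor `∑ J (δ a)` can be inserted, which groups the equal pairs
-- by value.
F₂-others : ∀ {n} (σ : List (Fin n)) H → F₂ (others H σ) ≤ restF2 σ H
F₂-others {n} σ H = begin
  F₂ w
    ≤⟨ ∑-mono-∈ w (λ a a∈w → ∑-mono w (λ b → ≤-trans (≤-reflexive (sym (*-identityʳ (δ a b)))) (*-monoʳ-≤ (δ a b) (hit a a∈w)))) ⟩
  ∑ w (λ a → ∑ w (λ b → δ a b * ∑ J (δ a)))
    ≡⟨ ∑-cong w (λ a → ∑-cong w (λ b → sym (∑-*ˡ (δ a b) J (δ a)))) ⟩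
  ∑ w (λ a → ∑ w (λ b → ∑ J (λ j → δ a b * δ a j)))
    ≤⟨ ∑-mono w (λ a → ∑-mono w (λ b → ∑-mono J (λ j → swap a b j))) ⟩
  ∑ w (λ a → ∑ w (λ b → ∑ J (λ j → δ a j * δ b j)))
    ≡⟨ ∑-cong w (λ a → ∑-swap w J _) ⟩
  ∑ w (λ a → ∑ J (λ j → ∑ w (λ b → δ a j * δ b j)))
    ≡⟨ ∑-swap w J _ ⟩
  ∑ J (λ j → ∑ w (λ a → ∑ w (λ b → δ a j * δ b j)))
    ≡⟨ ∑-cong J (λ j → sym (∑-product w w (λ a → δ a j) (λ b → δ b j))) ⟩
  ∑ J (λ j → ∑ w (λ a → δ a j) * ∑ w (λ b → δ b j))
    ≤⟨ ∑-mono J (λ j → *-mono-≤ (count j) (count j)) ⟩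
  ∑ J (λ j → freq σ j * freq σ j)
    ≡⟨ sum-map _ J ⟨
  restF2 σ H ∎
  where
  open ≤-Reasoning
  w = others H σ
  J = filter (λ j → ¬? (j ≟ H)) (allFin n)
  hit : ∀ a → a ∈ w → 1 ≤ ∑ J (δ a)
  hit a a∈w = ≤-trans (≤-reflexive (sym (δ-refl a)))
    (∑-member J (δ a) (∈-filter⁺ (λ j → ¬? (j ≟ H)) (∈-allFin a) (proj₂ (∈-filter⁻ (λ j → ¬? (j ≟ H)) {xs = σ} a∈w))))
  swap : ∀ a b j → δ a b * δ a j ≤ δ a j * δ b j
  swap a b j with a ≟ b
  ... | no _ = z≤n
  ... | yes refl with a ≟ j
  ... | yes _ = s≤s z≤n
  ... | no _ = z≤n
  count : ∀ j → ∑ w (λ a → δ a j) ≤ freq σ j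
  count j = ≤-trans (∑-filter-≤ (λ x → ¬? (x ≟ H)) σ (λ a → δ a j)) (≤-reflexive (sym (length-filter (λ p → p ≟ j) σ)))

length≤F₂ : ∀ {n} (w : List (Fin n)) → length w ≤ F₂ w
length≤F₂ w = ≤-trans (≤-reflexive (sym (∑-ones w)))
  (∑-mono-∈ w (λ a a∈w → ≤-trans (≤-reflexive (sym (δ-refl a))) (∑-member w (δ a) a∈w)))

-- The streaming algorithm

-- Truncated: in a phase of scale 2 ^ i ≤ 16 heaviness of H leaves no other items, and no bit is learned.
rounds : ℕ → ℕ
rounds i = 2 * (i ∸ 4)

record Phase (n : ℕ) : Set where
  constructor mkPhase
  field
    candidate : Fin n
    learned : List Bool
    counter₀ counter₁ : ℤ
open Phase

record State (n : ℕ) : Set where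
  constructor mkState
  field
    total : ℤ
    level : ℕ
    answer : Fin n
    phase : Phase n
open State

counter : ∀ {n} → Bool → Phase n → ℤ
counter false = counter₀
counter true = counter₁

setCounter : ∀ {n} → Bool → ℤ → Phase n → Phase n
setCounter c y ph = mkPhase (candidate ph) (learned ph) (if c then counter₀ ph else y) (if c then y else counter₁ ph)

counter-setCounter : ∀ {n} c y (ph : Phase n) → counter c (setCounter c y ph) ≡ y
counter-setCounter false y ph = refl
counter-setCounter true y ph = refl

counter-setCounter-≢ : ∀ {n} {c d} y (ph : Phase n) → d ≢ c → counter d (setCounter c y ph) ≡ counter d ph
counter-setCounter-≢ {c = false} {false} y ph d≢c = contradiction refl d≢c
counter-setCounter-≢ {c = false} {true} y ph d≢c = refl
counter-setCounter-≢ {c = true} {false} y ph d≢c = refl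
counter-setCounter-≢ {c = true} {true} y ph d≢c = contradiction refl d≢c

freshPhase : ∀ {n} → Fin n → Phase n
freshPhase c = mkPhase c [] (pos 0) (pos 0)

counter-zero : ∀ {n} d (c : Fin n) b → counter d (mkPhase c b (pos 0) (pos 0)) ≡ pos 0
counter-zero false c b = refl
counter-zero true c b = refl

initialState : ∀ {n} → Fin n → State n
initialState c = mkState (pos 0) 0 c (freshPhase c)

foldl-invariant : {A S : Set} (f : S → A → S) (Inv : List A → S → Set) (σ : List A) →
  (∀ w x v s → w ++ x ∷ v ≡ σ → Inv w s → Inv (w ++ [ x ]) (f s x)) →
  ∀ s₀ → Inv [] s₀ → Inv σ (foldl f s₀ σ)
foldl-invariant f Inv σ step s₀ inv₀ = go [] σ s₀ refl inv₀
  where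
  go : ∀ w v s → w ++ v ≡ σ → Inv w s → Inv σ (foldl f s v)
  go w [] s eq inv = subst (λ l → Inv l s) (trans (sym (List.++-identityʳ w)) eq) inv
  go w (x ∷ v) s eq inv = go (w ++ [ x ]) v (f s x) (trans (List.++-assoc w [ x ] v) eq) (step w x v s eq inv)

length-∷ʳ : {A : Set} (w : List A) (x : A) → length (w ++ [ x ]) ≡ suc (length w)
length-∷ʳ w x = trans (List.length-++ w) (+-comm (length w) 1)

module Sketch {n : ℕ} (e : Fin n → ℤ) (hb : Fin n → ℕ → Bool) where

  pf : Fin n → ℕ → List Bool
  pf x = prefixBits (hb x)

  bump : Fin n → Phase n → Phase n
  bump x ph = setCounter c (counter c ph ℤ.+ e x) ph
    where c = hb x (length (learned ph))

  -- The threshold `(2 ^ i / 150) (9/10) ^ r`, cleared of denominators. With noise below half the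
  -- threshold, a round uses up at most 3/2 of it in occurrences of `H`, plus one; 150 makes this
  -- `(2 ^ i / 100) (9/10) ^ r`.
  Crosses : ℕ → Fin n → Phase n → Set
  Crosses i x ph = 2 ^ i * 9 ^ r ≤ 150 * 10 ^ r * ∣ counter (hb x r) (bump x ph) ∣
    where r = length (learned ph)

  crosses? : ∀ i x ph → Dec (Crosses i x ph)
  crosses? i x ph = _ ≤? _

  extend : Fin n → Phase n → Phase n
  extend x ph = mkPhase (candidate ph) (hb x (length (learned ph)) ∷ learned ph) (pos 0) (pos 0)

  module _ (i : ℕ) (x : Fin n) (ph : Phase n) where

    onCrossing : Dec (Crosses i x ph) → Phase n
    onCrossing (yes _) = extend x ph
    onCrossing (no _) = bump x ph

    onLength : Dec (length (learned ph) < rounds i) → Phase n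
    onLength (yes _) = onCrossing (crosses? i x ph)
    onLength (no _) = record ph { candidate = x }

    onMatch : Dec (pf x (length (learned ph)) ≡ learned ph) → Phase n
    onMatch (yes _) = onLength (length (learned ph) <? rounds i)
    onMatch (no _) = ph

    phaseStep : Phase n
    phaseStep = onMatch (pf x (length (learned ph)) ≟ᴸ learned ph)

  module _ (x : Fin n) (st : State n) where

    onTotal : Dec (2 ^ level st ≤ ∣ total st ℤ.+ e x ∣) → State n
    onTotal (yes _) = mkState (total st ℤ.+ e x) (suc (level st)) (candidate ph) (freshPhase (candidate ph))
      where ph = phaseStep (level st) x (phase st)
    onTotal (no _) = mkState (total st ℤ.+ e x) (level st) (answer st) (phaseStep (level st) x (phase st))

    advance : State n
    advance = onTotal (2 ^ level st ≤? ∣ total st ℤ.+ e x ∣)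

  data PhaseStep (i : ℕ) (x : Fin n) (ph : Phase n) : Phase n → Set where
    skips   : pf x (length (learned ph)) ≢ learned ph → PhaseStep i x ph ph
    stores  : pf x (length (learned ph)) ≡ learned ph → ¬ length (learned ph) < rounds i →
              PhaseStep i x ph (record ph { candidate = x })
    extends : pf x (length (learned ph)) ≡ learned ph → length (learned ph) < rounds i →
              Crosses i x ph → PhaseStep i x ph (extend x ph)
    bumps   : pf x (length (learned ph)) ≡ learned ph → length (learned ph) < rounds i →
              ¬ Crosses i x ph → PhaseStep i x ph (bump x ph)

  phaseStep-view : ∀ i x ph → PhaseStep i x ph (phaseStep i x ph)
  phaseStep-view i x ph = view (pf x (length (learned ph)) ≟ᴸ learned ph)
    where
    view : ∀ d → PhaseStep i x ph (onMatch i x ph d)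
    view (no ¬match) = skips ¬match
    view (yes match) = view-length (length (learned ph) <? rounds i)
      where
      view-length : ∀ d → PhaseStep i x ph (onLength i x ph d)
      view-length (no r≮R) = stores match r≮R
      view-length (yes r<R) = view-crossing (crosses? i x ph)
        where
        view-crossing : ∀ d → PhaseStep i x ph (onCrossing i x ph d)
        view-crossing (yes cr) = extends match r<R cr
        view-crossing (no ¬cr) = bumps match r<R ¬cr

  data Step (x : Fin n) (st : State n) : State n → Set where
    promotes : 2 ^ level st ≤ ∣ total st ℤ.+ e x ∣ →
               Step x st (mkState (total st ℤ.+ e x) (suc (level st)) (candidate (phaseStep (level st) x (phase st)))
                           (freshPhase (candidate (phaseStep (level st) x (phase st)))))
    stays    : ¬ 2 ^ level st ≤ ∣ total st ℤ.+ e x ∣ →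
               Step x st (mkState (total st ℤ.+ e x) (level st) (answer st) (phaseStep (level st) x (phase st)))

  advance-view : ∀ x st → Step x st (advance x st)
  advance-view x st = view (2 ^ level st ≤? ∣ total st ℤ.+ e x ∣)
    where
    view : ∀ d → Step x st (onTotal x st d)
    view (yes p) = promotes p
    view (no ¬p) = stays ¬p

  -- These bounds hold on every seed, good or bad, after `m` items and are what makes a state fit
  -- its bits. A positive level was entered when the total reached half of `2 ^ level`, hence
  -- `2 ^ level ≤ 2 * m`; the `suc` covers level 0.
  record Valid (m : ℕ) (st : State n) : Set where
    constructor valid
    field
      total≤ : ∣ total st ∣ ≤ m
      level≤ : 2 ^ level st ≤ suc (2 * m)
      learned≤ : length (learned (phase st)) ≤ rounds (level st)
      counter≤ : ∀ c → ∣ counter c (phase st) ∣ ≤ m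

  module _ (∣e∣ : ∀ x → ∣ e x ∣ ≡ 1) where

    ∣+e∣≤ : ∀ i x → ∣ i ℤ.+ e x ∣ ≤ suc ∣ i ∣
    ∣+e∣≤ i x = begin
      ∣ i ℤ.+ e x ∣     ≤⟨ ℤ.∣i+j∣≤∣i∣+∣j∣ i (e x) ⟩
      ∣ i ∣ + ∣ e x ∣   ≡⟨ cong (_+_ ∣ i ∣) (∣e∣ x) ⟩
      ∣ i ∣ + 1         ≡⟨ +-comm ∣ i ∣ 1 ⟩
      suc ∣ i ∣ ∎
      where open ≤-Reasoning

    ∣counter-bump∣≤ : ∀ x ph c → ∣ counter c (bump x ph) ∣ ≤ suc ∣ counter c ph ∣
    ∣counter-bump∣≤ x ph c with c ≟ᵇ hb x (length (learned ph))
    ... | yes refl = ≤-trans (≤-reflexive (cong ∣_∣ (counter-setCounter c _ ph))) (∣+e∣≤ (counter c ph) x)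
    ... | no c≢ = ≤-trans (≤-reflexive (cong ∣_∣ (counter-setCounter-≢ _ ph c≢))) (n≤1+n _)

    phaseStep-valid : ∀ {i m} x {ph ph'} → PhaseStep i x ph ph' →
      length (learned ph) ≤ rounds i → (∀ c → ∣ counter c ph ∣ ≤ m) →
      length (learned ph') ≤ rounds i × (∀ c → ∣ counter c ph' ∣ ≤ suc m)
    phaseStep-valid x (skips _) l≤ c≤ = l≤ , λ c → m≤n⇒m≤1+n (c≤ c)
    phaseStep-valid x (stores _ _) l≤ c≤ = l≤ , λ { false → m≤n⇒m≤1+n (c≤ false) ; true → m≤n⇒m≤1+n (c≤ true) }
    phaseStep-valid x (extends _ l< _) l≤ c≤ = l< , λ c → ≤-trans (≤-reflexive (cong ∣_∣ (counter-zero c _ _))) z≤n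
    phaseStep-valid x {ph} (bumps _ _ _) l≤ c≤ =
      l≤ , λ c → ≤-trans (∣counter-bump∣≤ x ph c) (s≤s (c≤ c))

    advance-valid : ∀ {m} x st → Valid m st → Valid (suc m) (advance x st)
    advance-valid {m} x st (valid t≤ l≤ b≤ c≤) = go (advance-view x st)
      where
      t≤' : ∣ total st ℤ.+ e x ∣ ≤ suc m
      t≤' = ≤-trans (∣+e∣≤ (total st) x) (s≤s t≤)
      pv = phaseStep-valid x (phaseStep-view (level st) x (phase st)) b≤ c≤
      go : ∀ {st'} → Step x st st' → Valid (suc m) st'
      go (promotes p) = valid t≤' (≤-trans (*-monoʳ-≤ 2 (≤-trans p t≤')) (n≤1+n _)) z≤n
                          λ c → ≤-trans (≤-reflexive (cong ∣_∣ (counter-zero c _ _))) z≤n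
      go (stays ¬p) = valid t≤' (≤-trans l≤ (s≤s (*-monoʳ-≤ 2 (n≤1+n m)))) (proj₁ pv) (proj₂ pv)

    initial-valid : ∀ c → Valid 0 (initialState c)
    initial-valid c = valid z≤n ≤-refl z≤n λ d → ≤-reflexive (cong ∣_∣ (counter-zero d c []))

-- Correctness on a good seed

noise-rescale : ∀ {Q N F M p} → 1800 * Q * N < F * p → F ≤ 3 * M → 600 * Q * N < M * p
noise-rescale {Q} {N} {F} {M} {p} lt F≤ = *-cancelˡ-< 3 _ _ (begin-strict
  3 * (600 * Q * N)  ≡⟨ e₁ Q N ⟩
  1800 * Q * N       <⟨ lt ⟩
  F * p              ≤⟨ *-monoˡ-≤ p F≤ ⟩
  3 * M * p          ≡⟨ *-assoc 3 M p ⟩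
  3 * (M * p) ∎)
  where
  open ≤-Reasoning
  e₁ : ∀ Q N → 3 * (600 * Q * N) ≡ 1800 * Q * N
  e₁ = solve-∀

-- With threshold `P / (150 * Q)`, the noise now and the noise at the start of the round are each
-- below a quarter of it, so a counter that holds only noise stays below half.
no-crossing : ∀ {Q N m y P} → 600 * Q * N < P → 600 * Q * m < P → y ≤ N + m → ¬ P ≤ 150 * Q * y
no-crossing {Q} {N} {m} {y} {P} hN hm hy cr = <-irrefl refl (begin-strict
  P + P                          <⟨ +-mono-<-≤ {P} {P + P} (m<m+n P 0<P) (m≤m+n P P) ⟩
  (P + P) + (P + P)              ≡⟨ e₁ P ⟩
  4 * P                          ≤⟨ *-monoʳ-≤ 4 cr ⟩
  4 * (150 * Q * y)              ≤⟨ *-monoʳ-≤ 4 (*-monoʳ-≤ (150 * Q) hy) ⟩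
  4 * (150 * Q * (N + m))        ≡⟨ e₂ Q N m ⟩
  600 * Q * N + 600 * Q * m      ≤⟨ +-mono-≤ (<⇒≤ hN) (<⇒≤ hm) ⟩
  P + P ∎)
  where
  open ≤-Reasoning
  0<P : 0 < P
  0<P = ≤-<-trans z≤n hN
  e₁ : ∀ P → (P + P) + (P + P) ≡ 4 * P
  e₁ = solve-∀
  e₂ : ∀ Q N m → 4 * (150 * Q * (N + m)) ≡ 600 * Q * N + 600 * Q * m
  e₂ = solve-∀

-- One threshold for the counter and two quarters for noise and offset make 3/2 of `P / (150 * Q)`,
-- that is `P / (100 * Q)`. The summand `a` is 1 when the item that ends the round is counted as
-- well, and 0 otherwise.
round-cost : ∀ {Q P h y N m} a → 150 * Q * y < P → 600 * Q * N < P → 600 * Q * m < P → h ≤ a + y + (N + m) →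
             100 * Q * h ≤ 100 * Q * a + P
round-cost {Q} {P} {h} {y} {N} {m} a hy hN hm hh = *-cancelˡ-≤ 6 (begin
  6 * (100 * Q * h)                                            ≤⟨ *-monoʳ-≤ 6 (*-monoʳ-≤ (100 * Q) hh) ⟩
  6 * (100 * Q * (a + y + (N + m)))                            ≡⟨ e₁ Q a y N m ⟩
  600 * Q * a + (4 * (150 * Q * y) + (600 * Q * N + 600 * Q * m))
    ≤⟨ +-monoʳ-≤ (600 * Q * a) (+-mono-≤ (*-monoʳ-≤ 4 (<⇒≤ hy)) (+-mono-≤ (<⇒≤ hN) (<⇒≤ hm))) ⟩
  600 * Q * a + (4 * P + (P + P))                              ≡⟨ e₂ Q a P ⟩
  6 * (100 * Q * a + P) ∎)
  where
  open ≤-Reasoning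
  e₁ : ∀ Q a y N m → 6 * (100 * Q * (a + y + (N + m))) ≡ 600 * Q * a + (4 * (150 * Q * y) + (600 * Q * N + 600 * Q * m))
  e₁ = solve-∀
  e₂ : ∀ Q a P → 600 * Q * a + (4 * P + (P + P)) ≡ 6 * (100 * Q * a + P)
  e₂ = solve-∀

-- The budget telescopes: `(M / 10) ((9/10) ^ r - (9/10) ^ (r + 1))` is exactly the round cost
-- `(M / 100) (9/10) ^ r`, and the one extra occurrence is booked in `suc r`.
extend-budget : ∀ {Q M p g h r} → 10 * Q * g + M * p ≤ M * Q + 10 * Q * r → 100 * Q * h ≤ 100 * Q * 1 + M * p →
                10 * (10 * Q) * (g + h) + M * (9 * p) ≤ M * (10 * Q) + 10 * (10 * Q) * suc r
extend-budget {Q} {M} {p} {g} {h} {r} b c = begin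
  10 * (10 * Q) * (g + h) + M * (9 * p)                        ≡⟨ e₁ Q M p g h ⟩
  (10 * (10 * Q * g) + 9 * (M * p)) + 100 * Q * h              ≤⟨ +-monoʳ-≤ _ c ⟩
  (10 * (10 * Q * g) + 9 * (M * p)) + (100 * Q * 1 + M * p)    ≡⟨ e₂ Q M p g ⟩
  10 * (10 * Q * g + M * p) + 100 * Q                          ≤⟨ +-monoˡ-≤ (100 * Q) (*-monoʳ-≤ 10 b) ⟩
  10 * (M * Q + 10 * Q * r) + 100 * Q                          ≡⟨ e₃ Q M r ⟩
  M * (10 * Q) + 10 * (10 * Q) * suc r ∎
  where
  open ≤-Reasoning
  e₁ : ∀ Q M p g h → 10 * (10 * Q) * (g + h) + M * (9 * p) ≡ (10 * (10 * Q * g) + 9 * (M * p)) + 100 * Q * h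
  e₁ = solve-∀
  e₂ : ∀ Q M p g → (10 * (10 * Q * g) + 9 * (M * p)) + (100 * Q * 1 + M * p) ≡ 10 * (10 * Q * g + M * p) + 100 * Q
  e₂ = solve-∀
  e₃ : ∀ Q M r → 10 * (M * Q + 10 * Q * r) + 100 * Q ≡ M * (10 * Q) + 10 * (10 * Q) * (1 + r)
  e₃ = solve-∀

-- The unfinished round costs at most `(M / 100) (9/10) ^ r`, well within the `(M / 10) (9/10) ^ r`
-- that the budget still holds in reserve.
spent : ∀ {Q M P g h r} .{{_ : NonZero Q}} → 10 * Q * g + P ≤ M * Q + 10 * Q * r → 100 * Q * h ≤ 100 * Q * 0 + P →
        10 * (g + h) ≤ M + 10 * r
spent {Q} {M} {P} {g} {h} {r} b c = *-cancelˡ-≤ Q (*-cancelˡ-≤ 10 (begin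
  10 * (Q * (10 * (g + h)))                 ≡⟨ e₁ Q g h ⟩
  10 * (10 * Q * g) + 100 * Q * h           ≤⟨ +-monoʳ-≤ _ c ⟩
  10 * (10 * Q * g) + (100 * Q * 0 + P)     ≤⟨ m≤m+n _ (9 * P) ⟩
  10 * (10 * Q * g) + (100 * Q * 0 + P) + 9 * P ≡⟨ e₂ Q P g ⟩
  10 * (10 * Q * g + P)                     ≤⟨ *-monoʳ-≤ 10 b ⟩
  10 * (M * Q + 10 * Q * r)                 ≡⟨ e₃ Q M r ⟩
  10 * (Q * (M + 10 * r)) ∎))
  where
  open ≤-Reasoning
  e₁ : ∀ Q g h → 10 * (Q * (10 * (g + h))) ≡ 10 * (10 * Q * g) + 100 * Q * h
  e₁ = solve-∀
  e₂ : ∀ Q P g → 10 * (10 * Q * g) + (100 * Q * 0 + P) + 9 * P ≡ 10 * (10 * Q * g + P)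
  e₂ = solve-∀
  e₃ : ∀ Q M r → 10 * (M * Q + 10 * Q * r) ≡ 10 * (Q * (M + 10 * r))
  e₃ = solve-∀

n<2^n : ∀ n → n < 2 ^ n
n<2^n zero = s≤s z≤n
n<2^n (suc n) = begin-strict
  suc n             ≤⟨ n<2^n n ⟩
  2 ^ n             <⟨ m<m+n (2 ^ n) (m^n>0 2 n) ⟩
  2 ^ n + 2 ^ n     ≡⟨ cong (_+_ (2 ^ n)) (+-identityʳ (2 ^ n)) ⟨
  2 ^ suc n ∎
  where open ≤-Reasoning

4*rounds≤2^ : ∀ i → 4 * rounds i ≤ 2 ^ i
4*rounds≤2^ i with 4 ≤? i
... | no 4≰i rewrite m≤n⇒m∸n≡0 (<⇒≤ (≰⇒> 4≰i)) = z≤n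
... | yes 4≤i = begin
  4 * (2 * j)       ≡⟨ e₁ j ⟩
  8 * j             ≤⟨ *-mono-≤ {8} {16} (m≤m+n 8 8) (<⇒≤ (n<2^n j)) ⟩
  16 * 2 ^ j        ≡⟨ ^-distribˡ-+-* 2 4 j ⟨
  2 ^ (4 + j)       ≡⟨ cong (2 ^_) (m+[n∸m]≡n 4≤i) ⟩
  2 ^ i ∎
  where
  open ≤-Reasoning
  j = i ∸ 4
  e₁ : ∀ j → 4 * (2 * j) ≡ 8 * j
  e₁ = solve-∀

-- A phase begins after at most `M / 2 + F / 100` occurrences of `H`, and noise adds at most
-- `F / 100` to the total. With `F ≤ 3 * M` these are `0.53 M` and `0.03 M`, and the supposed `k` is
-- at most `M / 10 + M / 4`; together `0.91 M`, so the total could not have reached `M`.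
phase-not-short : ∀ {M F N s k r R} → 0 < M → M ≤ (s + k) + N → 100 * N ≤ F → 200 * s ≤ 100 * M + 2 * F →
                  F ≤ 3 * M → r ≤ R → 4 * R ≤ M → ¬ 10 * k ≤ M + 10 * r
phase-not-short {M} {F} {N} {s} {k} {r} {R} 0<M hM hN hs hF hr hR hk = <-irrefl refl (begin-strict
  200 * M                                       ≤⟨ *-monoʳ-≤ 200 hM ⟩
  200 * ((s + k) + N)                           ≡⟨ e₁ s k N ⟩
  200 * s + (20 * (10 * k) + 2 * (100 * N))     ≤⟨ +-mono-≤ hs (+-mono-≤ (*-monoʳ-≤ 20 hk) (*-monoʳ-≤ 2 hN)) ⟩
  (100 * M + 2 * F) + (20 * (M + 10 * r) + 2 * F) ≡⟨ e₂ M F r ⟩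
  120 * M + 4 * F + 50 * (4 * r)
    ≤⟨ +-mono-≤ (+-monoʳ-≤ (120 * M) (*-monoʳ-≤ 4 hF)) (*-monoʳ-≤ 50 (≤-trans (*-monoʳ-≤ 4 hr) hR)) ⟩
  120 * M + 4 * (3 * M) + 50 * M                <⟨ m<m+n _ {18 * M} (*-mono-< {0} {18} (s≤s z≤n) 0<M) ⟩
  120 * M + 4 * (3 * M) + 50 * M + 18 * M       ≡⟨ e₃ M ⟩
  200 * M ∎)
  where
  open ≤-Reasoning
  e₁ : ∀ s k N → 200 * ((s + k) + N) ≡ 200 * s + (20 * (10 * k) + 2 * (100 * N))
  e₁ = solve-∀
  e₂ : ∀ M F r → (100 * M + 2 * F) + (20 * (M + 10 * r) + 2 * F) ≡ 120 * M + 4 * F + 50 * (4 * r)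
  e₂ = solve-∀
  e₃ : ∀ M → 120 * M + 4 * (3 * M) + 50 * M + 18 * M ≡ 200 * M
  e₃ = solve-∀

∑-filter-accept : {A : Set} {P : A → Set} (P? : ∀ x → Dec (P x)) (e : A → ℤ) (w : List A) {x : A} → P x →
                  ∑ℤ.∑ (filter P? (w ++ [ x ])) e ≡ ∑ℤ.∑ (filter P? w) e ℤ.+ e x
∑-filter-accept P? e w {x} px = begin
  ∑ℤ.∑ (filter P? (w ++ [ x ])) e              ≡⟨ cong (λ l → ∑ℤ.∑ l e) (List.filter-++ P? w [ x ]) ⟩
  ∑ℤ.∑ (filter P? w ++ filter P? [ x ]) e      ≡⟨ cong (λ l → ∑ℤ.∑ (filter P? w ++ l) e) (List.filter-accept P? px) ⟩
  ∑ℤ.∑ (filter P? w ++ [ x ]) e                ≡⟨ ∑ℤ.∑-++ (filter P? w) [ x ] e ⟩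
  ∑ℤ.∑ (filter P? w) e ℤ.+ (e x ℤ.+ pos 0)     ≡⟨ cong (ℤ._+_ (∑ℤ.∑ (filter P? w) e)) (ℤ.+-identityʳ (e x)) ⟩
  ∑ℤ.∑ (filter P? w) e ℤ.+ e x ∎
  where open ≡-Reasoning

∑-filter-reject : {A : Set} {P : A → Set} (P? : ∀ x → Dec (P x)) (e : A → ℤ) (w : List A) {x : A} → ¬ P x →
                  ∑ℤ.∑ (filter P? (w ++ [ x ])) e ≡ ∑ℤ.∑ (filter P? w) e
∑-filter-reject P? e w {x} ¬px = cong (λ l → ∑ℤ.∑ l e) (trans (List.filter-++ P? w [ x ])
  (trans (cong (filter P? w ++_) (List.filter-reject P? ¬px)) (List.++-identityʳ (filter P? w))))

δ-≢ : ∀ {n} {a b : Fin n} → a ≢ b → δ a b ≡ 0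
δ-≢ {a = a} {b} a≢b with a ≟ b
... | yes a≡b = contradiction a≡b a≢b
... | no _ = refl

module Analysis {n : ℕ} (e : Fin n → ℤ) (hb : Fin n → ℕ → Bool) (∣e∣ : ∀ x → ∣ e x ∣ ≡ 1)
                (σ : List (Fin n)) (H : Fin n) (L : ℕ) where
  open Sketch e hb

  f : List (Fin n) → ℕ
  f w = ∑ w (λ x → δ x H)

  F : ℕ
  F = f σ

  noise₀ : List (Fin n) → ℤ
  noise₀ w = signedSum e (others H w)

  InClass : ℕ → Bool → Fin n → Set
  InClass r c x = x ≢ H × (pf x r ≡ pf H r × hb x r ≡ c)

  inClass? : ∀ r c x → Dec (InClass r c x)
  inClass? r c x = ¬? (x ≟ H) ×-dec ((pf x r ≟ᴸ pf H r) ×-dec (hb x r ≟ᵇ c))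

  noise : ℕ → Bool → List (Fin n) → ℤ
  noise r c w = signedSum e (filter (inClass? r c) w)

  -- Everything a run needs of the seed, stated without reference to the run. The bounds cover all
  -- prefixes of each class, so they apply at whatever times the rounds start. `1800` is
  -- `3 * 4 * 150`: in every phase with `F ≤ 3 * 2 ^ i` the noise stays below a quarter of the
  -- threshold.
  record Good : Set where
    field
      occurs : 1 ≤ F
      noise₀-small : ∀ w v → w ++ v ≡ σ → 100 * ∣ noise₀ w ∣ ≤ F
      noise-small : ∀ r c w v → w ++ v ≡ σ → r < L → 1800 * 10 ^ r * ∣ noise r c w ∣ < F * 9 ^ r
      isolated : ∀ x → x ∈ σ → x ≢ H → ∀ i → F ≤ 3 * 2 ^ i → pf x (rounds i) ≢ pf H (rounds i)
      deep : ∀ i → 2 ^ i ≤ suc (2 * length σ) → rounds i ≤ L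

  f-∷ʳ : ∀ w x → f (w ++ [ x ]) ≡ f w + δ x H
  f-∷ʳ w x = trans (∑-++ w [ x ] _) (cong (_+_ (f w)) (+-identityʳ (δ x H)))

  own : Bool → ℕ → ℕ → ℤ
  own c r h = if does (c ≟ᵇ hb H r) then e H ℤ.* pos h else pos 0

  own-hit : ∀ {c r} h → c ≡ hb H r → own c r h ≡ e H ℤ.* pos h
  own-hit {c} {r} h c≡ = cong (λ b → if b then e H ℤ.* pos h else pos 0) (dec-true (c ≟ᵇ hb H r) c≡)

  own-miss : ∀ {c r} h → c ≢ hb H r → own c r h ≡ pos 0
  own-miss {c} {r} h c≢ = cong (λ b → if b then e H ℤ.* pos h else pos 0) (dec-false (c ≟ᵇ hb H r) c≢)

  own-zero : ∀ c r → own c r 0 ≡ pos 0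
  own-zero c r with does (c ≟ᵇ hb H r)
  ... | true = ℤ.*-zeroʳ (e H)
  ... | false = refl

  ∣eH*∣ : ∀ h → ∣ e H ℤ.* pos h ∣ ≡ h
  ∣eH*∣ h = trans (ℤ.abs-* (e H) (pos h)) (trans (cong (_* h) (∣e∣ H)) (+-identityʳ h))

  eH*suc : ∀ h → e H ℤ.* pos (h + 1) ≡ e H ℤ.* pos h ℤ.+ e H
  eH*suc h = trans (ℤ.*-distribˡ-+ (e H) (pos h) (pos 1)) (cong (ℤ._+_ (e H ℤ.* pos h)) (ℤ.*-identityʳ (e H)))

  -- A counter starts at 0 with its round, whereas `noise` sums from the beginning of the stream.
  -- The `offset` supplied is the value of `noise` at the start of the round, itself a prefix sum
  -- and hence as small as any other.
  record Tracks (w : List (Fin n)) (i r h : ℕ) (c : Bool) (y : ℤ) : Set where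
    constructor tracks
    field
      offset : ℤ
      offset-small : 600 * 10 ^ r * ∣ offset ∣ < 2 ^ i * 9 ^ r
      counter≡ : y ≡ own c r h ℤ.+ (noise r c w ℤ.- offset)

  -- With M = 2 ^ i: the phase began after s occurrences of H, the current round after s + g;
  -- the budget says g ≤ r + (M / 10) (1 - (9/10) ^ r), the sum of the costs of the first r rounds.
  record Tracked (w : List (Fin n)) (i : ℕ) (ph : Phase n) : Set where
    constructor tracked
    r : ℕ
    r = length (learned ph)
    field
      s g h : ℕ
      count : f w ≡ s + (g + h)
      start : 200 * s ≤ 100 * 2 ^ i + 2 * F
      depth : r ≤ rounds i
      correct : learned ph ≡ pf H r
      budget : 10 * 10 ^ r * g + 2 ^ i * 9 ^ r ≤ 2 ^ i * 10 ^ r + 10 * 10 ^ r * r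
      learning : r < rounds i → ∀ c → Tracks w i r h c (counter c ph) × 150 * 10 ^ r * ∣ counter c ph ∣ < 2 ^ i * 9 ^ r
      waiting : ¬ r < rounds i → 1 ≤ h → candidate ph ≡ H

  bump-tracks : ∀ w i h ph x → let r = length (learned ph) in pf x r ≡ pf H r →
                (∀ c → Tracks w i r h c (counter c ph)) →
                ∀ c → Tracks (w ++ [ x ]) i r (h + δ x H) c (counter c (bump x ph))
  bump-tracks w i h ph x match tr c with tr c
  ... | tracks o o< y≡ = tracks o o< (by-item (x ≟ H))
    where
    r = length (learned ph)
    open ≡-Reasoning
    hit : c ≡ hb x r → counter c (bump x ph) ≡ (own c r h ℤ.+ (noise r c w ℤ.- o)) ℤ.+ e x
    hit refl = trans (counter-setCounter c _ ph) (cong (ℤ._+ e x) y≡)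
    miss : c ≢ hb x r → counter c (bump x ph) ≡ own c r h ℤ.+ (noise r c w ℤ.- o)
    miss c≢ = trans (counter-setCounter-≢ _ ph c≢) y≡
    Goal : ℕ → Set
    Goal h' = counter c (bump x ph) ≡ own c r h' ℤ.+ (noise r c (w ++ [ x ]) ℤ.- o)
    e₁ : ∀ a b c d → (a ℤ.+ (b ℤ.- c)) ℤ.+ d ≡ (a ℤ.+ d) ℤ.+ (b ℤ.- c)
    e₁ = ℤSolver.solve-∀
    e₂ : ∀ a b c d → (a ℤ.+ (b ℤ.- c)) ℤ.+ d ≡ a ℤ.+ ((b ℤ.+ d) ℤ.- c)
    e₂ = ℤSolver.solve-∀
    heavy : x ≡ H → Dec (c ≡ hb x r) → Goal (h + 1)
    heavy refl (yes c≡) = begin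
      counter c (bump x ph)                                     ≡⟨ hit c≡ ⟩
      (own c r h ℤ.+ (noise r c w ℤ.- o)) ℤ.+ e H               ≡⟨ e₁ (own c r h) (noise r c w) o (e H) ⟩
      (own c r h ℤ.+ e H) ℤ.+ (noise r c w ℤ.- o)               ≡⟨ cong (λ z → (z ℤ.+ e H) ℤ.+ (noise r c w ℤ.- o)) (own-hit h c≡) ⟩
      (e H ℤ.* pos h ℤ.+ e H) ℤ.+ (noise r c w ℤ.- o)           ≡⟨ cong (ℤ._+ (noise r c w ℤ.- o)) (trans (sym (eH*suc h)) (sym (own-hit (h + 1) c≡))) ⟩
      own c r (h + 1) ℤ.+ (noise r c w ℤ.- o)                   ≡⟨ cong (λ z → own c r (h + 1) ℤ.+ (z ℤ.- o)) (∑-filter-reject (inClass? r c) e w (λ p → proj₁ p refl)) ⟨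
      own c r (h + 1) ℤ.+ (noise r c (w ++ [ H ]) ℤ.- o) ∎
    heavy refl (no c≢) = begin
      counter c (bump x ph)                                     ≡⟨ miss c≢ ⟩
      own c r h ℤ.+ (noise r c w ℤ.- o)                         ≡⟨ cong (ℤ._+ (noise r c w ℤ.- o)) (trans (own-miss h c≢) (sym (own-miss (h + 1) c≢))) ⟩
      own c r (h + 1) ℤ.+ (noise r c w ℤ.- o)                   ≡⟨ cong (λ z → own c r (h + 1) ℤ.+ (z ℤ.- o)) (∑-filter-reject (inClass? r c) e w (λ p → proj₁ p refl)) ⟨
      own c r (h + 1) ℤ.+ (noise r c (w ++ [ H ]) ℤ.- o) ∎
    light : x ≢ H → Dec (c ≡ hb x r) → Goal h
    light x≢H (yes c≡) = begin
      counter c (bump x ph)                                     ≡⟨ hit c≡ ⟩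
      (own c r h ℤ.+ (noise r c w ℤ.- o)) ℤ.+ e x               ≡⟨ e₂ (own c r h) (noise r c w) o (e x) ⟩
      own c r h ℤ.+ ((noise r c w ℤ.+ e x) ℤ.- o)               ≡⟨ cong (λ z → own c r h ℤ.+ (z ℤ.- o)) (∑-filter-accept (inClass? r c) e w (x≢H , match , sym c≡)) ⟨
      own c r h ℤ.+ (noise r c (w ++ [ x ]) ℤ.- o) ∎
    light x≢H (no c≢) = begin
      counter c (bump x ph)                                     ≡⟨ miss c≢ ⟩
      own c r h ℤ.+ (noise r c w ℤ.- o)                         ≡⟨ cong (λ z → own c r h ℤ.+ (z ℤ.- o)) (∑-filter-reject (inClass? r c) e w (λ p → c≢ (sym (proj₂ (proj₂ p))))) ⟨
      own c r h ℤ.+ (noise r c (w ++ [ x ]) ℤ.- o) ∎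
    by-item : Dec (x ≡ H) → Goal (h + δ x H)
    by-item (yes refl) = subst Goal (cong (_+_ h) (sym (δ-refl H))) (heavy refl (c ≟ᵇ hb x r))
    by-item (no x≢H) = subst Goal (sym (trans (cong (_+_ h) (δ-≢ x≢H)) (+-identityʳ h))) (light x≢H (c ≟ᵇ hb x r))

  isolate : ∀ {y a b} → y ≡ a ℤ.+ b → a ≡ y ℤ.- b
  isolate {y} {a} {b} refl = e₁ a b
    where
    e₁ : ∀ a b → a ≡ (a ℤ.+ b) ℤ.- b
    e₁ = ℤSolver.solve-∀

  tracks-bound : ∀ {w i r h y} → (tr : Tracks w i r h (hb H r) y) →
                 h ≤ ∣ y ∣ + (∣ noise r (hb H r) w ∣ + ∣ Tracks.offset tr ∣)
  tracks-bound {w} {i} {r} {h} {y} (tracks o _ y≡) = begin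
    h                                         ≡⟨ ∣eH*∣ h ⟨
    ∣ e H ℤ.* pos h ∣                         ≡⟨ cong ∣_∣ (trans (sym (own-hit {hb H r} {r} h refl)) (isolate y≡)) ⟩
    ∣ y ℤ.- (noise r (hb H r) w ℤ.- o) ∣      ≤⟨ ℤ.∣i-j∣≤∣i∣+∣j∣ y (noise r (hb H r) w ℤ.- o) ⟩
    ∣ y ∣ + ∣ noise r (hb H r) w ℤ.- o ∣      ≤⟨ +-monoʳ-≤ ∣ y ∣ (ℤ.∣i-j∣≤∣i∣+∣j∣ (noise r (hb H r) w) o) ⟩
    ∣ y ∣ + (∣ noise r (hb H r) w ∣ + ∣ o ∣) ∎
    where open ≤-Reasoning

  tracks-miss : ∀ {w i r h c y} → c ≢ hb H r → (tr : Tracks w i r h c y) →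
                ∣ y ∣ ≤ ∣ noise r c w ∣ + ∣ Tracks.offset tr ∣
  tracks-miss {w} {i} {r} {h} {c} {y} c≢ (tracks o _ y≡) = begin
    ∣ y ∣                        ≡⟨ cong ∣_∣ (trans y≡ (trans (cong (ℤ._+ (noise r c w ℤ.- o)) (own-miss h c≢)) (ℤ.+-identityˡ (noise r c w ℤ.- o)))) ⟩
    ∣ noise r c w ℤ.- o ∣        ≤⟨ ℤ.∣i-j∣≤∣i∣+∣j∣ (noise r c w) o ⟩
    ∣ noise r c w ∣ + ∣ o ∣ ∎
    where open ≤-Reasoning

  module _ (good : Good) where
    open Good good

    small : ∀ i r c w v → w ++ v ≡ σ → r < L → F ≤ 3 * 2 ^ i → 600 * 10 ^ r * ∣ noise r c w ∣ < 2 ^ i * 9 ^ r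
    small i r c w v eq r<L F≤ = noise-rescale {10 ^ r} {M = 2 ^ i} {p = 9 ^ r} (noise-small r c w v eq r<L) F≤

    fresh-tracks : ∀ i r w v c → w ++ v ≡ σ → r < L → F ≤ 3 * 2 ^ i → ∀ y → y ≡ pos 0 →
                   Tracks w i r 0 c y × 150 * 10 ^ r * ∣ y ∣ < 2 ^ i * 9 ^ r
    fresh-tracks i r w v c eq r<L F≤ y refl =
      tracks (noise r c w) (small i r c w v eq r<L F≤)
        (sym (trans (cong (ℤ._+ (noise r c w ℤ.- noise r c w)) (own-zero c r))
          (trans (ℤ.+-identityˡ (noise r c w ℤ.- noise r c w)) (ℤ.+-inverseʳ (noise r c w))))) ,
      ≤-<-trans (≤-reflexive (*-zeroʳ (150 * 10 ^ r))) (*-mono-< {0} {2 ^ i} {0} {9 ^ r} (m^n>0 2 i) (m^n>0 9 r))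

    fresh-tracked : ∀ i w v c → w ++ v ≡ σ → rounds i ≤ L → F ≤ 3 * 2 ^ i → 200 * f w ≤ 100 * 2 ^ i + 2 * F →
                    Tracked w i (freshPhase c)
    fresh-tracked i w v c eq R≤L F≤ start = record
      { s = f w ; g = 0 ; h = 0
      ; count = sym (+-identityʳ (f w))
      ; start = start
      ; depth = z≤n
      ; correct = refl
      ; budget = m≤m+n (2 ^ i * 1) 0
      ; learning = λ 0<R d → fresh-tracks i 0 w v d eq (≤-trans 0<R R≤L) F≤ _ (counter-zero d c [])
      ; waiting = λ _ ()
      }

    match-H : ∀ {w i ph} → Tracked w i ph → pf H (length (learned ph)) ≡ learned ph
    match-H t = sym (Tracked.correct t)

    phase-tracked : ∀ i w x v ph ph' → w ++ x ∷ v ≡ σ → rounds i ≤ L → F ≤ 3 * 2 ^ i →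
                    Tracked w i ph → PhaseStep i x ph ph' → Tracked (w ++ [ x ]) i ph'
    phase-tracked i w x v ph ph' eq R≤L F≤ t@(tracked s g h count start depth correct budget learning waiting) = go
      where
      w' = w ++ [ x ]
      r = length (learned ph)
      eq' : w' ++ v ≡ σ
      eq' = trans (List.++-assoc w [ x ] v) eq
      x∈σ : x ∈ σ
      x∈σ = subst (x ∈_) eq (∈-++⁺ʳ w (here refl))
      count' : f w' ≡ s + (g + (h + δ x H))
      count' = trans (f-∷ʳ w x) (trans (cong (_+ δ x H) count) (e₁ s g h (δ x H)))
        where
        e₁ : ∀ s g h d → (s + (g + h)) + d ≡ s + (g + (h + d))
        e₁ = solve-∀
      bumped : pf x r ≡ learned ph → r < rounds i → ∀ c → Tracks w' i r (h + δ x H) c (counter c (bump x ph))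
      bumped match r<R = bump-tracks w i h ph x (trans match correct) (λ c → proj₁ (learning r<R c))
      go : PhaseStep i x ph ph' → Tracked w' i ph'
      go (skips ¬match) = record
        { s = s ; g = g ; h = h
        ; count = trans count' (cong (λ d → s + (g + d)) (trans (cong (_+_ h) (δ-≢ x≢H)) (+-identityʳ h)))
        ; start = start ; depth = depth ; correct = correct ; budget = budget
        ; learning = λ r<R c → same c (proj₁ (learning r<R c)) , proj₂ (learning r<R c)
        ; waiting = waiting }
        where
        x≢H : x ≢ H
        x≢H refl = ¬match (match-H t)
        same : ∀ c → Tracks w i r h c (counter c ph) → Tracks w' i r h c (counter c ph)
        same c (tracks o o< y≡) = tracks o o< (trans y≡ (cong (λ z → own c r h ℤ.+ (z ℤ.- o))
          (sym (∑-filter-reject (inClass? r c) e w (λ p → ¬match (trans (proj₁ (proj₂ p)) (sym correct)))))))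
      go (stores match r≮R) = record
        { s = s ; g = g ; h = h + δ x H ; count = count'
        ; start = start ; depth = depth ; correct = correct ; budget = budget
        ; learning = λ r<R → contradiction r<R r≮R
        ; waiting = λ _ _ → x≡H (x ≟ H) }
        where
        r≡R : r ≡ rounds i
        r≡R = ≤-antisym depth (≮⇒≥ r≮R)
        x≡H : Dec (x ≡ H) → x ≡ H
        x≡H (yes eq) = eq
        x≡H (no x≢H) = ⊥-elim (isolated x x∈σ x≢H i F≤ (subst (λ k → pf x k ≡ pf H k) r≡R (trans match correct)))
      go (bumps match r<R ¬cr) = record
        { s = s ; g = g ; h = h + δ x H ; count = count'
        ; start = start ; depth = depth ; correct = correct ; budget = budget
        ; learning = λ _ c → bumped match r<R c , below c (c ≟ᵇ hb x r)
        ; waiting = λ r≮R → contradiction r<R r≮R }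
        where
        below : ∀ c → Dec (c ≡ hb x r) → 150 * 10 ^ r * ∣ counter c (bump x ph) ∣ < 2 ^ i * 9 ^ r
        below c (yes refl) = ≰⇒> ¬cr
        below c (no c≢) = subst (λ y → 150 * 10 ^ r * ∣ y ∣ < 2 ^ i * 9 ^ r) (sym (counter-setCounter-≢ _ ph c≢)) (proj₂ (learning r<R c))
      go (extends match r<R cr) = record
        { s = s ; g = g + (h + δ x H) ; h = 0
        ; count = trans count' (cong (_+_ s) (sym (+-identityʳ _)))
        ; start = start ; depth = r<R
        ; correct = cong₂ _∷_ bit≡ correct
        ; budget = extend-budget {10 ^ r} {2 ^ i} {9 ^ r} {g} {h + δ x H} {r} budget cost
        ; learning = λ r<R' c → fresh-tracks i (suc r) w' v c eq' (≤-trans r<R' R≤L) F≤ _ (counter-zero c _ _)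
        ; waiting = λ _ () }
        where
        r<L : r < L
        r<L = ≤-trans r<R R≤L
        bit : Dec (hb x r ≡ hb H r) → hb x r ≡ hb H r
        bit (yes b≡) = b≡
        bit (no b≢) = ⊥-elim (no-crossing {10 ^ r} {∣ noise r (hb x r) w' ∣} {∣ Tracks.offset tr ∣} {∣ counter (hb x r) (bump x ph) ∣} {2 ^ i * 9 ^ r}
            (small i r (hb x r) w' v eq' r<L F≤) (Tracks.offset-small tr) (tracks-miss b≢ tr) cr)
          where tr = bumped match r<R (hb x r)
        bit≡ : hb x r ≡ hb H r
        bit≡ = bit (hb x r ≟ᵇ hb H r)
        trH = bumped match r<R (hb H r)
        -- The item that ends the round may be `H` itself and moves its counter by at most one,
        -- whence the summand 1.
        cost : 100 * 10 ^ r * (h + δ x H) ≤ 100 * 10 ^ r * 1 + 2 ^ i * 9 ^ r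
        cost = round-cost {10 ^ r} {2 ^ i * 9 ^ r} {h + δ x H} {∣ counter (hb H r) ph ∣} {∣ noise r (hb H r) w' ∣} {∣ Tracks.offset trH ∣} 1
          (proj₂ (learning r<R (hb H r))) (small i r (hb H r) w' v eq' r<L F≤) (Tracks.offset-small trH)
          (≤-trans (tracks-bound trH) (+-monoˡ-≤ _ (∣counter-bump∣≤ ∣e∣ x ph (hb H r))))

    -- If the phase ended while still learning, or before `H` came back after the last bit, it
    -- consumed too few occurrences of `H` for the total to have reached `2 ^ i`.
    phase-finds : ∀ i w v ph → w ++ v ≡ σ → rounds i ≤ L → F ≤ 3 * 2 ^ i → 2 ^ i ≤ f w + ∣ noise₀ w ∣ →
                  Tracked w i ph → candidate ph ≡ H
    phase-finds i w v ph eq R≤L F≤ M≤ (tracked s g h count start depth correct budget learning waiting) =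
      by-length (r <? rounds i)
      where
      r = length (learned ph)
      instance
        10^r≢0 : NonZero (10 ^ r)
        10^r≢0 = m^n≢0 10 r
      impossible : ¬ 10 * (g + h) ≤ 2 ^ i + 10 * r
      impossible = phase-not-short {2 ^ i} {F} {∣ noise₀ w ∣} {s} {g + h} {r} {rounds i} (m^n>0 2 i)
        (subst (λ k → 2 ^ i ≤ k + ∣ noise₀ w ∣) count M≤) (noise₀-small w v eq) start F≤ depth (4*rounds≤2^ i)
      by-length : Dec (r < rounds i) → candidate ph ≡ H
      by-length (yes r<R) = ⊥-elim (impossible (spent {10 ^ r} {2 ^ i} {2 ^ i * 9 ^ r} {g} {h} {r} budget
        (round-cost {10 ^ r} {2 ^ i * 9 ^ r} {h} {∣ counter (hb H r) ph ∣} {∣ noise r (hb H r) w ∣} {∣ Tracks.offset tr ∣} 0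
          (proj₂ (learning r<R (hb H r))) (small i r (hb H r) w v eq (≤-trans r<R R≤L) F≤) (Tracks.offset-small tr) (tracks-bound tr))))
        where tr = proj₁ (learning r<R (hb H r))
      by-length (no r≮R) = by-count (1 ≤? h)
        where
        by-count : Dec (1 ≤ h) → candidate ph ≡ H
        by-count (yes 1≤h) = waiting r≮R 1≤h
        by-count (no 1≰h) = ⊥-elim (impossible (spent {10 ^ r} {2 ^ i} {2 ^ i * 9 ^ r} {g} {h} {r} budget
          (subst (λ k → 100 * 10 ^ r * k ≤ 100 * 10 ^ r * 0 + 2 ^ i * 9 ^ r) (sym (n<1⇒n≡0 (≰⇒> 1≰h))) (m≤m+n _ _))))

    -- Phases with `3 * 2 ^ i < F` are left uncontrolled, since noise is bounded only relative to
    -- `F`. The index in `answered` is that of the phase completed last, one below the current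
    -- level.
    record Invariant (w : List (Fin n)) (st : State n) : Set where
      constructor invariant
      field
        is-valid : Valid (length w) st
        total≡ : total st ≡ e H ℤ.* pos (f w) ℤ.+ noise₀ w
        total< : ∣ total st ∣ < 2 ^ level st
        answered : ∀ i → level st ≡ suc i → F ≤ 3 * 2 ^ i → answer st ≡ H
        tracking : F ≤ 3 * 2 ^ level st → Tracked w (level st) (phase st)

    total-∷ʳ : ∀ w x t → t ≡ e H ℤ.* pos (f w) ℤ.+ noise₀ w →
               t ℤ.+ e x ≡ e H ℤ.* pos (f (w ++ [ x ])) ℤ.+ noise₀ (w ++ [ x ])
    total-∷ʳ w x t t≡ = by-item (x ≟ H)
      where
      open ≡-Reasoning
      e₁ : ∀ a b d → (a ℤ.+ b) ℤ.+ d ≡ (a ℤ.+ d) ℤ.+ b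
      e₁ = ℤSolver.solve-∀
      by-item : Dec (x ≡ H) → t ℤ.+ e x ≡ e H ℤ.* pos (f (w ++ [ x ])) ℤ.+ noise₀ (w ++ [ x ])
      by-item (yes refl) = begin
        t ℤ.+ e H                                            ≡⟨ cong (ℤ._+ e H) t≡ ⟩
        (e H ℤ.* pos (f w) ℤ.+ noise₀ w) ℤ.+ e H             ≡⟨ e₁ (e H ℤ.* pos (f w)) (noise₀ w) (e H) ⟩
        (e H ℤ.* pos (f w) ℤ.+ e H) ℤ.+ noise₀ w             ≡⟨ cong₂ ℤ._+_ (sym (eH*suc (f w))) (sym (∑-filter-reject (λ y → ¬? (y ≟ H)) e w (λ ne → ne refl))) ⟩
        e H ℤ.* pos (f w + 1) ℤ.+ noise₀ (w ++ [ H ])        ≡⟨ cong (λ k → e H ℤ.* pos k ℤ.+ noise₀ (w ++ [ H ])) (trans (cong (_+_ (f w)) (sym (δ-refl H))) (sym (f-∷ʳ w H))) ⟩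
        e H ℤ.* pos (f (w ++ [ H ])) ℤ.+ noise₀ (w ++ [ H ]) ∎
      by-item (no x≢H) = begin
        t ℤ.+ e x                                            ≡⟨ cong (ℤ._+ e x) t≡ ⟩
        (e H ℤ.* pos (f w) ℤ.+ noise₀ w) ℤ.+ e x             ≡⟨ ℤ.+-assoc (e H ℤ.* pos (f w)) (noise₀ w) (e x) ⟩
        e H ℤ.* pos (f w) ℤ.+ (noise₀ w ℤ.+ e x)             ≡⟨ cong₂ (λ k z → e H ℤ.* pos k ℤ.+ z)
          (sym (trans (f-∷ʳ w x) (trans (cong (_+_ (f w)) (δ-≢ x≢H)) (+-identityʳ (f w)))))
          (sym (∑-filter-accept (λ y → ¬? (y ≟ H)) e w x≢H)) ⟩
        e H ℤ.* pos (f (w ++ [ x ])) ℤ.+ noise₀ (w ++ [ x ]) ∎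

    ∣total∣≤ : ∀ {t w} → t ≡ e H ℤ.* pos (f w) ℤ.+ noise₀ w → ∣ t ∣ ≤ f w + ∣ noise₀ w ∣
    ∣total∣≤ {t} {w} t≡ = begin
      ∣ t ∣                                    ≡⟨ cong ∣_∣ t≡ ⟩
      ∣ e H ℤ.* pos (f w) ℤ.+ noise₀ w ∣       ≤⟨ ℤ.∣i+j∣≤∣i∣+∣j∣ (e H ℤ.* pos (f w)) (noise₀ w) ⟩
      ∣ e H ℤ.* pos (f w) ∣ + ∣ noise₀ w ∣     ≡⟨ cong (_+ ∣ noise₀ w ∣) (∣eH*∣ (f w)) ⟩
      f w + ∣ noise₀ w ∣ ∎
      where open ≤-Reasoning

    f≤∣total∣ : ∀ {t w} → t ≡ e H ℤ.* pos (f w) ℤ.+ noise₀ w → f w ≤ ∣ t ∣ + ∣ noise₀ w ∣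
    f≤∣total∣ {t} {w} t≡ = begin
      f w                        ≡⟨ ∣eH*∣ (f w) ⟨
      ∣ e H ℤ.* pos (f w) ∣      ≡⟨ cong ∣_∣ (isolate {t} {e H ℤ.* pos (f w)} {noise₀ w} t≡) ⟩
      ∣ t ℤ.- noise₀ w ∣         ≤⟨ ℤ.∣i-j∣≤∣i∣+∣j∣ t (noise₀ w) ⟩
      ∣ t ∣ + ∣ noise₀ w ∣ ∎
      where open ≤-Reasoning

    length-prefix : ∀ (w : List (Fin n)) v → w ++ v ≡ σ → length w ≤ length σ
    length-prefix w v eq = ≤-trans (m≤m+n (length w) (length v)) (≤-reflexive (trans (sym (List.length-++ w)) (cong length eq)))

    advance-invariant : ∀ w x v st → w ++ x ∷ v ≡ σ → Invariant w st → Invariant (w ++ [ x ]) (advance x st)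
    advance-invariant w x v st eq (invariant val t≡ t< ans track) = go (advance-view x st) valid'
      where
      w' = w ++ [ x ]
      i = level st
      eq' : w' ++ v ≡ σ
      eq' = trans (List.++-assoc w [ x ] v) eq
      valid' : Valid (length w') (advance x st)
      valid' = subst (λ m → Valid m (advance x st)) (sym (length-∷ʳ w x)) (advance-valid ∣e∣ x st val)
      t≡' = total-∷ʳ w x (total st) t≡
      within : ∀ {w v st} → w ++ v ≡ σ → Valid (length w) st → rounds (level st) ≤ L
      within {w} {v} {st} eq val = deep (level st) (≤-trans (Valid.level≤ val) (s≤s (*-monoʳ-≤ 2 (length-prefix w v eq))))
      R≤L : rounds i ≤ L
      R≤L = within {w} {x ∷ v} {st} eq val
      ph' = phaseStep i x (phase st)
      track' : F ≤ 3 * 2 ^ i → Tracked w' i ph'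
      track' F≤ = phase-tracked i w x v (phase st) ph' eq R≤L F≤ (track F≤) (phaseStep-view i x (phase st))
      go : ∀ {st'} → Step x st st' → Valid (length w') st' → Invariant w' st'
      go (stays ¬p) val' = invariant val' t≡' (≰⇒> ¬p) ans track'
      go (promotes p) val' = invariant val' t≡' t<' found
        (λ F≤ → fresh-tracked (suc i) w' v (candidate ph') eq' (within {w'} {v} eq' val') F≤ start')
        where
        -- The total was below `2 ^ i` and moves by one, so it hits `2 ^ i` exactly and no level is
        -- skipped.
        t≤ : ∣ total st ℤ.+ e x ∣ ≤ 2 ^ i
        t≤ = ≤-trans (∣+e∣≤ ∣e∣ (total st) x) t<
        t<' : ∣ total st ℤ.+ e x ∣ < 2 ^ suc i
        t<' = ≤-<-trans t≤ (^-monoʳ-< 2 (s≤s (s≤s z≤n)) (n<1+n i))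
        found : ∀ j → suc i ≡ suc j → F ≤ 3 * 2 ^ j → candidate ph' ≡ H
        found j refl F≤ = phase-finds i w' v ph' eq' R≤L F≤ (≤-trans p (∣total∣≤ {w = w'} t≡')) (track' F≤)
        start' : 200 * f w' ≤ 100 * 2 ^ suc i + 2 * F
        start' = begin
          200 * f w'                                         ≤⟨ *-monoʳ-≤ 200 (f≤∣total∣ {w = w'} t≡') ⟩
          200 * (∣ total st ℤ.+ e x ∣ + ∣ noise₀ w' ∣)       ≡⟨ e₁ ∣ total st ℤ.+ e x ∣ ∣ noise₀ w' ∣ ⟩
          200 * ∣ total st ℤ.+ e x ∣ + 2 * (100 * ∣ noise₀ w' ∣) ≤⟨ +-mono-≤ (*-monoʳ-≤ 200 t≤) (*-monoʳ-≤ 2 (noise₀-small w' v eq')) ⟩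
          200 * 2 ^ i + 2 * F                                ≡⟨ cong (_+ 2 * F) (e₂ (2 ^ i)) ⟩
          100 * 2 ^ suc i + 2 * F ∎
          where
          open ≤-Reasoning
          e₁ : ∀ a b → 200 * (a + b) ≡ 200 * a + 2 * (100 * b)
          e₁ = solve-∀
          e₂ : ∀ a → 200 * a ≡ 100 * (2 * a)
          e₂ = solve-∀

    finds-heavy : ∀ c → answer (foldl (λ st x → advance x st) (initialState c) σ) ≡ H
    finds-heavy c = conclude (foldl-invariant (λ st x → advance x st) Invariant σ advance-invariant (initialState c) initial)
      where
      initial : Invariant [] (initialState c)
      initial = invariant (initial-valid ∣e∣ c) (sym (trans (cong (ℤ._+ pos 0) (ℤ.*-zeroʳ (e H))) refl)) (s≤s z≤n) (λ _ ())
        (λ F≤ → fresh-tracked 0 [] σ c refl z≤n F≤ z≤n)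
      conclude : ∀ {st} → Invariant σ st → answer st ≡ H
      -- At level 0 the total is 0, so noise would have to offset all `F` occurrences.
      conclude {mkState t zero a ph} (invariant _ t≡ t< _ _) = ⊥-elim (<-irrefl refl (begin-strict
        F                                ≤⟨ f≤∣total∣ {w = σ} t≡ ⟩
        ∣ t ∣ + ∣ noise₀ σ ∣             ≡⟨ cong (_+ ∣ noise₀ σ ∣) (n<1⇒n≡0 t<) ⟩
        ∣ noise₀ σ ∣                     <⟨ noise<F ∣ noise₀ σ ∣ (noise₀-small σ [] (List.++-identityʳ σ)) ⟩
        F ∎))
        where
        open ≤-Reasoning
        noise<F : ∀ m → 100 * m ≤ F → m < F
        noise<F zero _ = occurs
        noise<F (suc m) h = <-≤-trans (m<m*n (suc m) 100 (s≤s (s≤s z≤n))) (≤-trans (≤-reflexive (*-comm (suc m) 100)) h)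
      -- The total is below `2 ^ (i + 1)` and the noise at most `F / 100`, so
      -- `99 * F ≤ 200 * 2 ^ i`; adding `97 * 2 ^ i` rounds this up to `F ≤ 3 * 2 ^ i`.
      conclude {mkState t (suc i) a ph} (invariant _ t≡ t< ans _) = ans i refl (*-cancelˡ-≤ 99 (+-cancelʳ-≤ F _ _ (begin
        99 * F + F                                ≡⟨ +-comm (99 * F) F ⟩
        100 * F                                   ≤⟨ *-monoʳ-≤ 100 (f≤∣total∣ {w = σ} t≡) ⟩
        100 * (∣ t ∣ + ∣ noise₀ σ ∣)              ≡⟨ *-distribˡ-+ 100 ∣ t ∣ ∣ noise₀ σ ∣ ⟩
        100 * ∣ t ∣ + 100 * ∣ noise₀ σ ∣          ≤⟨ +-mono-≤ (*-monoʳ-≤ 100 (<⇒≤ t<)) (noise₀-small σ [] (List.++-identityʳ σ)) ⟩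
        100 * (2 * 2 ^ i) + F                     ≤⟨ +-monoˡ-≤ F (m≤m+n _ (97 * 2 ^ i)) ⟩
        100 * (2 * 2 ^ i) + 97 * 2 ^ i + F        ≡⟨ cong (_+ F) (e₁ (2 ^ i)) ⟩
        99 * (3 * 2 ^ i) + F ∎)))
        where
        open ≤-Reasoning
        e₁ : ∀ a → 100 * (2 * a) + 97 * a ≡ 99 * (3 * a)
        e₁ = solve-∀

-- Most seeds are good

-- Terms at most `Q (b / (b + d)) ^ r` sum to at most `Q (b + d) / d`. Dropping the first term
-- leaves a series of the same kind for `(b + d) * g` and `Q * b`, which avoids division.
∑-applyUpTo-geometric : ∀ (b d : ℕ) .{{_ : NonZero (b + d)}} (L : ℕ) (f g : ℕ → ℕ) Q →
  (∀ r → r < L → g (f r) * (b + d) ^ r ≤ Q * b ^ r) → d * ∑ (applyUpTo f L) g ≤ (b + d) * Q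
∑-applyUpTo-geometric b d zero f g Q h = ≤-trans (≤-reflexive (*-zeroʳ d)) z≤n
∑-applyUpTo-geometric b d (suc L) f g Q h = begin
  d * (g (f 0) + rest)        ≡⟨ *-distribˡ-+ d (g (f 0)) rest ⟩
  d * g (f 0) + d * rest      ≤⟨ +-mono-≤ (*-monoʳ-≤ d first) (*-cancelˡ-≤ (b + d) others≤) ⟩
  d * Q + Q * b               ≡⟨ e₁ b d Q ⟩
  (b + d) * Q ∎
  where
  open ≤-Reasoning
  rest = ∑ (applyUpTo (f ∘ suc) L) g
  e₁ : ∀ b d Q → d * Q + Q * b ≡ (b + d) * Q
  e₁ = solve-∀
  first : g (f 0) ≤ Q
  first = subst₂ _≤_ (*-identityʳ (g (f 0))) (*-identityʳ Q) (h 0 (s≤s z≤n))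
  shifted : ∀ r → r < L → (b + d) * g (f (suc r)) * (b + d) ^ r ≤ Q * b * b ^ r
  shifted r r<L = subst₂ _≤_ (e₂ (g (f (suc r))) (b + d) ((b + d) ^ r)) (sym (*-assoc Q b (b ^ r))) (h (suc r) (s≤s r<L))
    where
    e₂ : ∀ x y z → x * (y * z) ≡ y * x * z
    e₂ = solve-∀
  others≤ : (b + d) * (d * rest) ≤ (b + d) * (Q * b)
  others≤ = begin
    (b + d) * (d * rest)                                          ≡⟨ e₃ (b + d) d rest ⟩
    d * ((b + d) * rest)                                          ≡⟨ cong (d *_) (∑-*ˡ (b + d) (applyUpTo (f ∘ suc) L) g) ⟨
    d * ∑ (applyUpTo (f ∘ suc) L) (λ z → (b + d) * g z)           ≤⟨ ∑-applyUpTo-geometric b d L (f ∘ suc) (λ z → (b + d) * g z) (Q * b) shifted ⟩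
    (b + d) * (Q * b) ∎
    where
    e₃ : ∀ x y z → x * (y * z) ≡ y * (x * z)
    e₃ = solve-∀

p4-* : ∀ x y → p4 (x * y) ≡ p4 x * p4 y
p4-* = e₁
  where
  e₁ : ∀ x y → ((x * y) * (x * y)) * ((x * y) * (x * y)) ≡ ((x * x) * (x * x)) * ((y * y) * (y * y))
  e₁ = solve-∀

^-*-distrib : ∀ r a b → (a * b) ^ r ≡ a ^ r * b ^ r
^-*-distrib zero a b = refl
^-*-distrib (suc r) a b = trans (cong (a * b *_) (^-*-distrib r a b)) (e₁ a b (a ^ r) (b ^ r))
  where
  e₁ : ∀ a b c d → a * b * (c * d) ≡ a * c * (b * d)
  e₁ = solve-∀

p4-^ : ∀ a r → p4 (a ^ r) ≡ p4 a ^ r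
p4-^ a r = sym (trans (^-*-distrib r (a * a) (a * a)) (cong (λ z → z * z) (^-*-distrib r a a)))

p4>0 : ∀ {x} → 0 < x → 0 < p4 x
p4>0 0<x = *-mono-< {0} {_} {0} (*-mono-< {0} {_} {0} 0<x 0<x) (*-mono-< {0} {_} {0} 0<x 0<x)

markov : ∀ {P : Set} (d : Dec P) {x y} → (P → y ≤ x) → ⟦ does d ⟧ * p4 y ≤ p4 x
markov (yes p) {x} {y} h = ≤-trans (≤-reflexive (+-identityʳ (p4 y))) (p4-mono (h p))
markov (no _) h = z≤n

⟦does⟧≡0 : ∀ {P : Set} (d : Dec P) → ⟦ does d ⟧ ≡ 0 → ¬ P
⟦does⟧≡0 (no ¬p) _ = ¬p

∑≡0 : {A : Set} (xs : List A) (f : A → ℕ) → ∑ xs f ≡ 0 → ∀ {x} → x ∈ xs → f x ≡ 0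
∑≡0 xs f eq x∈ = n≤0⇒n≡0 (≤-trans (∑-member xs f x∈) (≤-reflexive eq))

∑-filter-mono : {A : Set} {P Q : A → Set} (P? : ∀ x → Dec (P x)) (Q? : ∀ x → Dec (Q x)) (xs : List A) {f g : A → ℕ} →
                (∀ x → P x → Q x × f x ≤ g x) → ∑ (filter P? xs) f ≤ ∑ (filter Q? xs) g
∑-filter-mono P? Q? [] h = z≤n
∑-filter-mono P? Q? (x ∷ xs) {f} {g} h with P? x | Q? x
... | yes p | yes q = +-mono-≤ (proj₂ (h x p)) (∑-filter-mono P? Q? xs h)
... | yes p | no ¬q = contradiction (proj₁ (h x p)) ¬q
... | no ¬p | yes q = ≤-trans (∑-filter-mono P? Q? xs h) (m≤n+m _ (g x))
... | no ¬p | no ¬q = ∑-filter-mono P? Q? xs h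

prefixBits-≤ : ∀ (b c : ℕ → Bool) {q r} → q ≤ r → prefixBits b r ≡ prefixBits c r → prefixBits b q ≡ prefixBits c q
prefixBits-≤ b c {q} {zero} z≤n eq = refl
prefixBits-≤ b c {q} {suc r} q≤ eq with m≤n⇒m<n∨m≡n q≤
... | inj₁ (s≤s q≤r) = prefixBits-≤ b c q≤r (List.∷-injectiveʳ eq)
... | inj₂ refl = eq

-- Isolation is required in every phase with `F ≤ 3 * 2 ^ i`. A longer hash prefix only separates
-- more, so it is enough to have it at the least such scale, and one collision event is charged
-- instead of one per phase.
least-scale : ∀ F → ∃[ i ] (F ≤ 3 * 2 ^ i × (∀ j → F ≤ 3 * 2 ^ j → i ≤ j))
least-scale F = search F 0 (≤-trans (<⇒≤ (n<2^n F)) (m≤m+n _ _)) (λ _ _ → z≤n)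
  where
  search : ∀ d i → F ≤ 3 * 2 ^ (i + d) → (∀ j → F ≤ 3 * 2 ^ j → i ≤ j) →
           ∃[ i' ] (F ≤ 3 * 2 ^ i' × (∀ j → F ≤ 3 * 2 ^ j → i' ≤ j))
  search zero i top low = i , subst (λ k → F ≤ 3 * 2 ^ k) (+-identityʳ i) top , low
  search (suc d) i top low = decide (F ≤? 3 * 2 ^ i)
    where
    decide : Dec (F ≤ 3 * 2 ^ i) → ∃[ i' ] (F ≤ 3 * 2 ^ i' × (∀ j → F ≤ 3 * 2 ^ j → i' ≤ j))
    decide (yes hit) = i , hit , low
    decide (no miss) = search d (suc i) (subst (λ k → F ≤ 3 * 2 ^ k) (+-suc i d) top)
      (λ j h → ≤∧≢⇒< (low j h) (λ { refl → miss h }))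

-- `2304` is `9 * 2 ^ 8`: the 9 from squaring the 3, the `2 ^ 8` from the subtraction of 4 in
-- `rounds`. The expected number of entries colliding with `H` is then at most `2304 D / F²`, small
-- by heaviness.
least-scale-square : ∀ {F i} → F ≤ 3 * 2 ^ i → F * F ≤ 2304 * 2 ^ rounds i
least-scale-square {F} {i} h = begin
  F * F                               ≤⟨ *-mono-≤ h h ⟩
  3 * 2 ^ i * (3 * 2 ^ i)             ≡⟨ e₁ (2 ^ i) ⟩
  9 * (2 ^ i * 2 ^ i)                 ≡⟨ cong (9 *_) (^-distribˡ-+-* 2 i i) ⟨
  9 * 2 ^ (i + i)                     ≤⟨ *-monoʳ-≤ 9 (^-monoʳ-≤ 2 exponent) ⟩
  9 * 2 ^ (8 + rounds i)              ≡⟨ cong (9 *_) (^-distribˡ-+-* 2 8 (rounds i)) ⟩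
  9 * (256 * 2 ^ rounds i)            ≡⟨ *-assoc 9 256 (2 ^ rounds i) ⟨
  2304 * 2 ^ rounds i ∎
  where
  open ≤-Reasoning
  e₁ : ∀ x → 3 * x * (3 * x) ≡ 9 * (x * x)
  e₁ = solve-∀
  e₂ : ∀ j → (4 + j) + (4 + j) ≡ 8 + 2 * j
  e₂ = solve-∀
  exponent : i + i ≤ 8 + rounds i
  exponent = ≤-trans (+-mono-≤ (m≤n+m∸n i 4) (m≤n+m∸n i 4)) (≤-reflexive (e₂ (i ∸ 4)))

length-others : ∀ {n} (H : Fin n) σ → length σ ≡ ∑ σ (λ x → δ x H) + length (others H σ)
length-others H [] = refl
length-others H (x ∷ σ) with x ≟ H
... | yes _ = cong suc (length-others H σ)
... | no _ = trans (cong suc (length-others H σ)) (sym (+-suc _ _))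

scaled-bound : ∀ {A S K T} .{{_ : NonZero K}} → A * S ≤ K * T → 100 * K ≤ A → 100 * S ≤ T
scaled-bound {A} {S} {K} {T} h KA = *-cancelˡ-≤ K (begin
  K * (100 * S)      ≡⟨ e₁ K S ⟩
  100 * K * S        ≤⟨ *-monoˡ-≤ S KA ⟩
  A * S              ≤⟨ h ⟩
  K * T ∎)
  where
  open ≤-Reasoning
  e₁ : ∀ K S → K * (100 * S) ≡ 100 * K * S
  e₁ = solve-∀

-- Heaviness enters squared: it turns `D²` into `F⁴ / α²`, and `F⁴` cancels.
cancel-moment : ∀ {α D F X c K T} → 0 < F → α * D ≤ F * F → c * (p4 F * X) ≤ K * (D * D) * T → c * (α * α) * X ≤ K * T
cancel-moment {α} {D} {F} {X} {c} {K} {T} 0<F hα h = *-cancelˡ-≤ (p4 F) {{>-nonZero (p4>0 0<F)}} (begin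
  p4 F * (c * (α * α) * X)          ≡⟨ e₁ (p4 F) c α X ⟩
  α * α * (c * (p4 F * X))          ≤⟨ *-monoʳ-≤ (α * α) h ⟩
  α * α * (K * (D * D) * T)         ≡⟨ e₂ α K D T ⟩
  (α * D) * (α * D) * (K * T)       ≤⟨ *-monoˡ-≤ (K * T) (*-mono-≤ hα hα) ⟩
  p4 F * (K * T) ∎)
  where
  open ≤-Reasoning
  e₁ : ∀ p c α X → p * (c * (α * α) * X) ≡ α * α * (c * (p * X))
  e₁ = solve-∀
  e₂ : ∀ α K D T → α * α * (K * (D * D) * T) ≡ (α * D) * (α * D) * (K * T)
  e₂ = solve-∀

-- `ratio` says that `2 ^ -r (q / p) ^ 4r` decays like `(p4 q / (p4 q + d)) ^ r`: the halving of the
-- noise outweighs the shrinking of the threshold.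
module Seeds {n k : ℕ} (v : Fin n → Vec Bool k) (qf : QuadFree v) (σ : List (Fin n)) (H : Fin n)
             (L m : ℕ) (L+k≤m : L + k ≤ m)
             (A B₀ B p q d : ℕ) (ratio : 2 * p4 p ≡ p4 q + d)
             (maximal : ∀ w → ∑ (allBits k) (λ s → p4 (maxSum (signs v s) w)) ≤ A * (F₂ w * F₂ w) * 2 ^ k) where

  hashSeeds = allBits m
  signSeeds = allBits k
  oth = others H σ
  D = F₂ oth

  F : ℕ
  F = ∑ σ (λ x → δ x H)

  T : ℕ
  T = 2 ^ m * 2 ^ k

  𝔼 : (Vec Bool m → Vec Bool k → ℕ) → ℕ
  𝔼 g = ∑ hashSeeds (λ a → ∑ signSeeds (g a))

  hashes : Vec Bool m → Fin n → ℕ → Bool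
  hashes a x = hashBit (v x) (toList a)

  ∣signs∣ : ∀ s x → ∣ signs v s x ∣ ≡ 1
  ∣signs∣ s x = ∣sign∣ (dot (v x) (toList s))

  module An (a : Vec Bool m) (s : Vec Bool k) = Analysis (signs v s) (hashes a) (∣signs∣ s) σ H L

  Match : Vec Bool m → ℕ → Fin n → Set
  Match a r x = hashPrefix (v x) (toList a) r ≡ hashPrefix (v H) (toList a) r

  match? : ∀ a r x → Dec (Match a r x)
  match? a r x = hashPrefix (v x) (toList a) r ≟ᴸ hashPrefix (v H) (toList a) r

  class? : ∀ a r c x → Dec (x ≢ H × (Match a r x × hashes a x r ≡ c))
  class? a r c x = ¬? (x ≟ H) ×-dec (match? a r x ×-dec (hashes a x r ≟ᵇ c))

  loud₀? : ∀ s → Dec (F < B₀ * maxSum (signs v s) oth)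
  loud₀? s = F <? B₀ * maxSum (signs v s) oth

  loud? : ∀ a s r c → Dec (F * p ^ r ≤ B * q ^ r * maxSum (signs v s) (filter (class? a r c) σ))
  loud? a s r c = F * p ^ r ≤? B * q ^ r * maxSum (signs v s) (filter (class? a r c) σ)

  collisions : ℕ → Vec Bool m → ℕ
  collisions r a = ∑ oth (λ x → ⟦ does (match? a r x) ⟧)

  𝔼-+ : ∀ g h → 𝔼 (λ a s → g a s + h a s) ≡ 𝔼 g + 𝔼 h
  𝔼-+ g h = trans (∑-cong hashSeeds (λ a → ∑-+ signSeeds (g a) (h a))) (∑-+ hashSeeds _ _)

  𝔼-sign : ∀ g → 𝔼 (λ a s → g s) ≡ 2 ^ m * ∑ signSeeds g
  𝔼-sign g = trans (∑-allBits-const m (∑ signSeeds g)) (*-comm _ (2 ^ m))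

  𝔼-hash : ∀ g → 𝔼 (λ a s → g a) ≡ ∑ hashSeeds g * 2 ^ k
  𝔼-hash g = trans (∑-cong hashSeeds (λ a → ∑-allBits-const k (g a))) (∑-*ʳ (2 ^ k) hashSeeds g)

  𝔼-∑ : (xs : List ℕ) (X : ℕ → Vec Bool m → Vec Bool k → ℕ) → 𝔼 (λ a s → ∑ xs (λ r → X r a s)) ≡ ∑ xs (λ r → 𝔼 (X r))
  𝔼-∑ xs X = trans (∑-cong hashSeeds (λ a → ∑-swap signSeeds xs _)) (∑-swap hashSeeds xs _)

  -- Linearity over the other items, each colliding with `H` with probability at most `2 ^ -r`. The
  -- weight `f` is the frequency of the item when noise is bounded, and 1 when colliding entries are
  -- counted.
  collision-mean : ∀ r → r ≤ L → (f : Fin n → ℕ) →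
    2 ^ r * ∑ hashSeeds (λ a → ∑ oth (λ x → ⟦ does (match? a r x) ⟧ * f x)) ≤ ∑ oth f * 2 ^ m
  collision-mean r r≤L f = begin
    2 ^ r * ∑ hashSeeds (λ a → ∑ oth (λ x → ⟦ does (match? a r x) ⟧ * f x))
      ≡⟨ cong (2 ^ r *_) (∑-swap hashSeeds oth _) ⟩
    2 ^ r * ∑ oth (λ x → ∑ hashSeeds (λ a → ⟦ does (match? a r x) ⟧ * f x))
      ≡⟨ cong (2 ^ r *_) (∑-cong oth (λ x → ∑-*ʳ (f x) hashSeeds _)) ⟩
    2 ^ r * ∑ oth (λ x → ∑ hashSeeds (λ a → ⟦ does (match? a r x) ⟧) * f x)
      ≡⟨ ∑-*ˡ (2 ^ r) oth _ ⟨
    ∑ oth (λ x → 2 ^ r * (∑ hashSeeds (λ a → ⟦ does (match? a r x) ⟧) * f x))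
      ≤⟨ ∑-mono-∈ oth (λ x x∈ → ≤-trans (≤-reflexive (sym (*-assoc (2 ^ r) _ (f x))))
           (≤-trans (*-monoˡ-≤ (f x) (hashPrefix-collision (v x) (v H) (distinct x x∈) r m (≤-trans (+-monoˡ-≤ k r≤L) L+k≤m)))
             (≤-reflexive (*-comm (2 ^ m) (f x))))) ⟩
    ∑ oth (λ x → f x * 2 ^ m)
      ≡⟨ ∑-*ʳ (2 ^ m) oth f ⟩
    ∑ oth f * 2 ^ m ∎
    where
    open ≤-Reasoning
    distinct : ∀ x → x ∈ oth → v x ≢ v H
    distinct x x∈ eq = proj₂ (∈-filter⁻ (λ y → ¬? (y ≟ H)) {xs = σ} x∈) (quadFree-injective {v = v} qf eq)

  loud₀-count : p4 F * ∑ signSeeds (λ s → ⟦ does (loud₀? s) ⟧) ≤ p4 B₀ * A * (D * D) * 2 ^ k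
  loud₀-count = begin
    p4 F * ∑ signSeeds (λ s → ⟦ does (loud₀? s) ⟧)
      ≡⟨ trans (*-comm (p4 F) _) (sym (∑-*ʳ (p4 F) signSeeds _)) ⟩
    ∑ signSeeds (λ s → ⟦ does (loud₀? s) ⟧ * p4 F)
      ≤⟨ ∑-mono signSeeds (λ s → ≤-trans (markov (loud₀? s) {B₀ * maxSum (signs v s) oth} <⇒≤) (≤-reflexive (p4-* B₀ (maxSum (signs v s) oth)))) ⟩
    ∑ signSeeds (λ s → p4 B₀ * p4 (maxSum (signs v s) oth))
      ≡⟨ ∑-*ˡ (p4 B₀) signSeeds _ ⟩
    p4 B₀ * ∑ signSeeds (λ s → p4 (maxSum (signs v s) oth))
      ≤⟨ *-monoʳ-≤ (p4 B₀) (maximal oth) ⟩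
    p4 B₀ * (A * (D * D) * 2 ^ k)
      ≡⟨ e₁ (p4 B₀) A (D * D) (2 ^ k) ⟩
    p4 B₀ * A * (D * D) * 2 ^ k ∎
    where
    open ≤-Reasoning
    e₁ : ∀ a b c d → a * (b * c * d) ≡ a * b * c * d
    e₁ = solve-∀

  -- Of each pair of equal entries only the first is asked to match, which makes the bound linear in
  -- the collision indicators.
  class-F₂ : ∀ a r c → F₂ (filter (class? a r c) σ) ≤ ∑ oth (λ x → ⟦ does (match? a r x) ⟧ * ∑ oth (δ x))
  class-F₂ a r c = ∑-filter-mono (class? a r c) (λ x → ¬? (x ≟ H)) σ (λ x p → proj₁ p ,
    subst (λ b → ∑ (filter (class? a r c) σ) (δ x) ≤ ⟦ b ⟧ * ∑ oth (δ x)) (sym (dec-true (match? a r x) (proj₁ (proj₂ p))))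
      (≤-trans (∑-filter-mono (class? a r c) (λ x → ¬? (x ≟ H)) σ (λ y q → proj₁ q , ≤-refl)) (≤-reflexive (sym (+-identityʳ _)))))

  class-F₂≤D : ∀ a r c → F₂ (filter (class? a r c) σ) ≤ D
  class-F₂≤D a r c = ∑-filter-mono (class? a r c) (λ x → ¬? (x ≟ H)) σ (λ x p → proj₁ p ,
    ∑-filter-mono (class? a r c) (λ x → ¬? (x ≟ H)) σ (λ y q → proj₁ q , ≤-refl))

  -- Markov for the fourth moment, given the hash. Of the two factors `F₂` in the moment one is
  -- replaced by `D`, the other averages to at most `D / 2 ^ r` over the hash; the `2 ^ r` so gained
  -- pays for the threshold shrinking by `(p / q) ^ r`.
  loud-count : ∀ r c → r ≤ L → p4 F * 𝔼 (λ a s → ⟦ does (loud? a s r c) ⟧) * (p4 q + d) ^ r ≤ p4 B * A * (D * D) * T * p4 q ^ r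
  loud-count r c r≤L = begin
    p4 F * X * (p4 q + d) ^ r
      ≡⟨ cong (p4 F * X *_) (trans (cong (_^ r) (sym ratio)) (^-*-distrib r 2 (p4 p))) ⟩
    p4 F * X * (2 ^ r * p4 p ^ r)
      ≡⟨ e₁ (p4 F) X (2 ^ r) (p4 p ^ r) ⟩
    2 ^ r * (X * (p4 F * p4 p ^ r))
      ≡⟨ cong (λ z → 2 ^ r * (X * z)) (trans (cong (p4 F *_) (sym (p4-^ p r))) (sym (p4-* F (p ^ r)))) ⟩
    2 ^ r * (X * p4 (F * p ^ r))
      ≤⟨ *-monoʳ-≤ (2 ^ r) scaled ⟩
    2 ^ r * (p4 (B * q ^ r) * A * D * 2 ^ k * ∑ hashSeeds G)
      ≡⟨ e₂ (2 ^ r) (p4 (B * q ^ r) * A * D * 2 ^ k) (∑ hashSeeds G) ⟩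
    p4 (B * q ^ r) * A * D * 2 ^ k * (2 ^ r * ∑ hashSeeds G)
      ≤⟨ *-monoʳ-≤ (p4 (B * q ^ r) * A * D * 2 ^ k) (collision-mean r r≤L (λ x → ∑ oth (δ x))) ⟩
    p4 (B * q ^ r) * A * D * 2 ^ k * (D * 2 ^ m)
      ≡⟨ cong (λ z → z * A * D * 2 ^ k * (D * 2 ^ m)) (trans (p4-* B (q ^ r)) (cong (p4 B *_) (p4-^ q r))) ⟩
    p4 B * p4 q ^ r * A * D * 2 ^ k * (D * 2 ^ m)
      ≡⟨ e₃ (p4 B) (p4 q ^ r) A D (2 ^ k) (2 ^ m) ⟩
    p4 B * A * (D * D) * T * p4 q ^ r ∎
    where
    open ≤-Reasoning
    X = 𝔼 (λ a s → ⟦ does (loud? a s r c) ⟧)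
    G : Vec Bool m → ℕ
    G a = ∑ oth (λ x → ⟦ does (match? a r x) ⟧ * ∑ oth (δ x))
    e₁ : ∀ a b c d → a * b * (c * d) ≡ c * (b * (a * d))
    e₁ = solve-∀
    e₂ : ∀ a b c → a * (b * c) ≡ b * (a * c)
    e₂ = solve-∀
    e₃ : ∀ a b c d x y → a * b * c * d * x * (d * y) ≡ a * c * (d * d) * (y * x) * b
    e₃ = solve-∀
    per-hash : ∀ a → ∑ signSeeds (λ s → ⟦ does (loud? a s r c) ⟧) * p4 (F * p ^ r) ≤ p4 (B * q ^ r) * A * D * 2 ^ k * G a
    per-hash a = begin
      ∑ signSeeds (λ s → ⟦ does (loud? a s r c) ⟧) * p4 (F * p ^ r)
        ≡⟨ ∑-*ʳ (p4 (F * p ^ r)) signSeeds _ ⟨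
      ∑ signSeeds (λ s → ⟦ does (loud? a s r c) ⟧ * p4 (F * p ^ r))
        ≤⟨ ∑-mono signSeeds (λ s → ≤-trans (markov (loud? a s r c) {B * q ^ r * maxSum (signs v s) w} (λ p → p))
             (≤-reflexive (p4-* (B * q ^ r) (maxSum (signs v s) w)))) ⟩
      ∑ signSeeds (λ s → P * p4 (maxSum (signs v s) w))
        ≡⟨ ∑-*ˡ P signSeeds _ ⟩
      P * ∑ signSeeds (λ s → p4 (maxSum (signs v s) w))
        ≤⟨ *-monoʳ-≤ P (maximal w) ⟩
      P * (A * (F₂ w * F₂ w) * 2 ^ k)
        ≤⟨ *-monoʳ-≤ P (*-monoˡ-≤ (2 ^ k) (*-monoʳ-≤ A (*-mono-≤ (class-F₂≤D a r c) (class-F₂ a r c)))) ⟩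
      P * (A * (D * G a) * 2 ^ k)
        ≡⟨ e₄ P A D (G a) (2 ^ k) ⟩
      P * A * D * 2 ^ k * G a ∎
      where
      w = filter (class? a r c) σ
      P = p4 (B * q ^ r)
      e₄ : ∀ a b c d x → a * (b * (c * d) * x) ≡ a * b * c * x * d
      e₄ = solve-∀
    scaled : X * p4 (F * p ^ r) ≤ p4 (B * q ^ r) * A * D * 2 ^ k * ∑ hashSeeds G
    scaled = begin
      X * p4 (F * p ^ r)
        ≡⟨ ∑-*ʳ (p4 (F * p ^ r)) hashSeeds _ ⟨
      ∑ hashSeeds (λ a → ∑ signSeeds (λ s → ⟦ does (loud? a s r c) ⟧) * p4 (F * p ^ r))
        ≤⟨ ∑-mono hashSeeds per-hash ⟩
      ∑ hashSeeds (λ a → p4 (B * q ^ r) * A * D * 2 ^ k * G a)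
        ≡⟨ ∑-*ˡ (p4 (B * q ^ r) * A * D * 2 ^ k) hashSeeds G ⟩
      p4 (B * q ^ r) * A * D * 2 ^ k * ∑ hashSeeds G ∎

  roundIndices : List ℕ
  roundIndices = applyUpTo (λ r → r) L

  louds : Bool → Vec Bool m → Vec Bool k → ℕ
  louds c a s = ∑ roundIndices (λ r → ⟦ does (loud? a s r c) ⟧)

  -- A union bound in the form of a count of failures: its mean is a sum of means, and where it
  -- vanishes nothing has failed.
  penalty : ℕ → Vec Bool m → Vec Bool k → ℕ
  penalty R₀ a s = ⟦ does (loud₀? s) ⟧ + ((louds false a s + louds true a s) + collisions R₀ a)

  module _ {R₀ : ℕ} (a : Vec Bool m) (s : Vec Bool k) (no-penalty : penalty R₀ a s ≡ 0) where
    private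
      tail≡0 = m+n≡0⇒n≡0 ⟦ does (loud₀? s) ⟧ no-penalty
      louds≡0 = m+n≡0⇒m≡0 (louds false a s + louds true a s) tail≡0

    quiet₀ : ∀ w u → w ++ u ≡ σ → B₀ * ∣ An.noise₀ a s w ∣ ≤ F
    quiet₀ w u refl = ≤-trans
      (*-monoʳ-≤ B₀ (subst (λ l → ∣ signedSum (signs v s) (others H w) ∣ ≤ maxSum (signs v s) l)
        (sym (List.filter-++ (λ x → ¬? (x ≟ H)) w u)) (prefix≤maxSum (signs v s) (others H w) (others H u))))
      (≮⇒≥ (⟦does⟧≡0 (loud₀? s) (m+n≡0⇒m≡0 _ no-penalty)))

    quiet : ∀ r c w u → w ++ u ≡ σ → r < L → B * q ^ r * ∣ An.noise a s r c w ∣ < F * p ^ r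
    quiet r c w u refl r<L = ≤-<-trans
      (*-monoʳ-≤ (B * q ^ r) (subst (λ l → ∣ signedSum (signs v s) (filter (class? a r c) w) ∣ ≤ maxSum (signs v s) l)
        (sym (List.filter-++ (class? a r c) w u)) (prefix≤maxSum (signs v s) (filter (class? a r c) w) (filter (class? a r c) u))))
      (≰⇒> (⟦does⟧≡0 (loud? a s r c) (∑≡0 roundIndices (λ r → ⟦ does (loud? a s r c) ⟧) (sums c) (∈-applyUpTo⁺ (λ r → r) r<L))))
      where
      sums : ∀ c → louds c a s ≡ 0
      sums false = m+n≡0⇒m≡0 (louds false a s) louds≡0
      sums true = m+n≡0⇒n≡0 (louds false a s) louds≡0

    no-collision : ∀ x → x ∈ σ → x ≢ H → ¬ Match a R₀ x
    no-collision x x∈ x≢H = ⟦does⟧≡0 (match? a R₀ x) (∑≡0 oth (λ x → ⟦ does (match? a R₀ x) ⟧)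
      (m+n≡0⇒n≡0 (louds false a s + louds true a s) tail≡0)
      (∈-filter⁺ (λ y → ¬? (y ≟ H)) x∈ x≢H))

  module _ (α E R₀ : ℕ) .{{_ : NonZero E}} .{{_ : NonZero (p4 q + d)}} .{{_ : NonZero (p4 B₀ * A)}} .{{_ : NonZero ((p4 q + d) * (p4 B * A))}}
           (0<F : 0 < F) (heavy : α * D ≤ F * F) (R₀≤L : R₀ ≤ L) (F²≤ : F * F ≤ E * 2 ^ R₀)
           (α-large₀ : 100 * (p4 B₀ * A) ≤ 1 * (α * α)) (α-large : 100 * ((p4 q + d) * (p4 B * A)) ≤ d * (α * α)) (α-large₁ : 100 * E ≤ α) where

    loud₀-rare : 100 * 𝔼 (λ a s → ⟦ does (loud₀? s) ⟧) ≤ T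
    loud₀-rare = scaled-bound {1 * (α * α)} {X} {p4 B₀ * A} {T} (cancel-moment {α} {D} {F} {X} {1} {p4 B₀ * A} {T} 0<F heavy (begin
      1 * (p4 F * X)                                                       ≡⟨ +-identityʳ (p4 F * X) ⟩
      p4 F * X                                                             ≡⟨ cong (p4 F *_) (𝔼-sign _) ⟩
      p4 F * (2 ^ m * ∑ signSeeds (λ s → ⟦ does (loud₀? s) ⟧))             ≡⟨ e₁ (p4 F) (2 ^ m) _ ⟩
      2 ^ m * (p4 F * ∑ signSeeds (λ s → ⟦ does (loud₀? s) ⟧))             ≤⟨ *-monoʳ-≤ (2 ^ m) loud₀-count ⟩
      2 ^ m * (p4 B₀ * A * (D * D) * 2 ^ k)                                ≡⟨ e₁ (2 ^ m) (p4 B₀ * A * (D * D)) (2 ^ k) ⟩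
      p4 B₀ * A * (D * D) * T ∎)) α-large₀
      where
      open ≤-Reasoning
      X = 𝔼 (λ a s → ⟦ does (loud₀? s) ⟧)
      e₁ : ∀ x y z → x * (y * z) ≡ y * (x * z)
      e₁ = solve-∀

    loud-rare : ∀ c → 100 * 𝔼 (louds c) ≤ T
    loud-rare c = scaled-bound {d * (α * α)} {X} {(p4 q + d) * (p4 B * A)} {T}
      (cancel-moment {α} {D} {F} {X} {d} {(p4 q + d) * (p4 B * A)} {T} 0<F heavy (begin
        d * (p4 F * X)
          ≡⟨ cong (λ z → d * (p4 F * z)) (𝔼-∑ roundIndices (λ r a s → ⟦ does (loud? a s r c) ⟧)) ⟩
        d * (p4 F * ∑ roundIndices Y)
          ≡⟨ cong (d *_) (∑-*ˡ (p4 F) roundIndices Y) ⟨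
        d * ∑ roundIndices (λ r → p4 F * Y r)
          ≤⟨ ∑-applyUpTo-geometric (p4 q) d L (λ r → r) (λ r → p4 F * Y r) (p4 B * A * (D * D) * T) (λ r r<L → loud-count r c (<⇒≤ r<L)) ⟩
        (p4 q + d) * (p4 B * A * (D * D) * T)
          ≡⟨ e₁ (p4 q + d) (p4 B * A) (D * D) T ⟩
        (p4 q + d) * (p4 B * A) * (D * D) * T ∎)) α-large
      where
      open ≤-Reasoning
      X = 𝔼 (louds c)
      Y : ℕ → ℕ
      Y r = 𝔼 (λ a s → ⟦ does (loud? a s r c) ⟧)
      e₁ : ∀ x y z w → x * (y * z * w) ≡ x * y * z * w
      e₁ = solve-∀

    collisions-rare : 100 * 𝔼 (λ a s → collisions R₀ a) ≤ T
    collisions-rare = scaled-bound {α} {X} {E} {T} (*-cancelˡ-≤ (F * F) {{>-nonZero (*-mono-< {0} {F} {0} 0<F 0<F)}} (begin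
      F * F * (α * X)                  ≤⟨ *-monoˡ-≤ (α * X) F²≤ ⟩
      E * 2 ^ R₀ * (α * X)             ≡⟨ e₁ E (2 ^ R₀) α X ⟩
      α * E * (2 ^ R₀ * X)             ≤⟨ *-monoʳ-≤ (α * E) mean ⟩
      α * E * (D * T)                  ≡⟨ e₂ α E D T ⟩
      α * D * (E * T)                  ≤⟨ *-monoˡ-≤ (E * T) heavy ⟩
      F * F * (E * T) ∎)) α-large₁
      where
      open ≤-Reasoning
      X = 𝔼 (λ a s → collisions R₀ a)
      e₁ : ∀ x y z w → x * y * (z * w) ≡ z * x * (y * w)
      e₁ = solve-∀
      e₂ : ∀ x y z w → x * y * (z * w) ≡ x * z * (y * w)
      e₂ = solve-∀
      mean : 2 ^ R₀ * X ≤ D * T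
      mean = begin
        2 ^ R₀ * X
          ≡⟨ cong (2 ^ R₀ *_) (𝔼-hash (collisions R₀)) ⟩
        2 ^ R₀ * (∑ hashSeeds (collisions R₀) * 2 ^ k)
          ≡⟨ *-assoc (2 ^ R₀) _ (2 ^ k) ⟨
        2 ^ R₀ * ∑ hashSeeds (collisions R₀) * 2 ^ k
          ≡⟨ cong (λ z → 2 ^ R₀ * z * 2 ^ k) (∑-cong hashSeeds (λ a → ∑-cong oth (λ x → sym (*-identityʳ ⟦ does (match? a R₀ x) ⟧)))) ⟩
        2 ^ R₀ * ∑ hashSeeds (λ a → ∑ oth (λ x → ⟦ does (match? a R₀ x) ⟧ * 1)) * 2 ^ k
          ≤⟨ *-monoˡ-≤ (2 ^ k) (collision-mean R₀ R₀≤L (λ _ → 1)) ⟩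
        ∑ oth (λ _ → 1) * 2 ^ m * 2 ^ k
          ≤⟨ *-monoˡ-≤ (2 ^ k) (*-monoˡ-≤ (2 ^ m) (≤-trans (≤-reflexive (∑-ones oth)) (length≤F₂ oth))) ⟩
        D * 2 ^ m * 2 ^ k
          ≡⟨ *-assoc D (2 ^ m) (2 ^ k) ⟩
        D * T ∎

    penalty-rare : 100 * 𝔼 (penalty R₀) ≤ 4 * T
    penalty-rare = begin
      100 * 𝔼 (penalty R₀)
        ≡⟨ cong (100 *_) (trans (𝔼-+ _ _) (cong (_+_ X₀) (trans (𝔼-+ _ _) (cong (_+ Z) (𝔼-+ _ _))))) ⟩
      100 * (X₀ + ((Y₀ + Y₁) + Z))
        ≡⟨ e₁ X₀ Y₀ Y₁ Z ⟩
      100 * X₀ + ((100 * Y₀ + 100 * Y₁) + 100 * Z)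
        ≤⟨ +-mono-≤ loud₀-rare (+-mono-≤ (+-mono-≤ (loud-rare false) (loud-rare true)) collisions-rare) ⟩
      T + ((T + T) + T)
        ≡⟨ e₂ T ⟩
      4 * T ∎
      where
      open ≤-Reasoning
      X₀ = 𝔼 (λ a s → ⟦ does (loud₀? s) ⟧)
      Y₀ = 𝔼 (louds false)
      Y₁ = 𝔼 (louds true)
      Z = 𝔼 (λ a s → collisions R₀ a)
      e₁ : ∀ x y z w → 100 * (x + ((y + z) + w)) ≡ 100 * x + ((100 * y + 100 * z) + 100 * w)
      e₁ = solve-∀
      e₂ : ∀ t → t + ((t + t) + t) ≡ 4 * t
      e₂ = solve-∀

    -- Four kinds of failure have mean at most one percent each: a loud total, a loud class for
    -- either bit, a collision. One percent remains to spare.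
    mostly : (W : Vec Bool m → Vec Bool k → ℕ) → (∀ a s → penalty R₀ a s ≡ 0 → W a s ≡ 1) → 95 * T ≤ 100 * 𝔼 W
    mostly W win = +-cancelʳ-≤ (4 * T) _ _ (begin
      95 * T + 4 * T                   ≤⟨ m≤m+n _ T ⟩
      95 * T + 4 * T + T               ≡⟨ e₁ T ⟩
      100 * T                          ≡⟨ cong (100 *_) (trans (𝔼-hash (λ _ → 1)) (cong (_* 2 ^ k) (trans (∑-allBits-const m 1) (+-identityʳ (2 ^ m))))) ⟨
      100 * 𝔼 (λ a s → 1)              ≤⟨ *-monoʳ-≤ 100 (∑-mono hashSeeds (λ a → ∑-mono signSeeds (λ s → covered a s (penalty R₀ a s) refl))) ⟩
      100 * 𝔼 (λ a s → W a s + penalty R₀ a s) ≡⟨ cong (100 *_) (𝔼-+ W (penalty R₀)) ⟩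
      100 * (𝔼 W + 𝔼 (penalty R₀))     ≡⟨ *-distribˡ-+ 100 (𝔼 W) (𝔼 (penalty R₀)) ⟩
      100 * 𝔼 W + 100 * 𝔼 (penalty R₀) ≤⟨ +-monoʳ-≤ (100 * 𝔼 W) penalty-rare ⟩
      100 * 𝔼 W + 4 * T ∎)
      where
      open ≤-Reasoning
      e₁ : ∀ t → 95 * t + 4 * t + t ≡ 100 * t
      e₁ = solve-∀
      covered : ∀ a s x → penalty R₀ a s ≡ x → 1 ≤ W a s + penalty R₀ a s
      covered a s zero eq = ≤-trans (≤-reflexive (sym (win a s eq))) (m≤m+n (W a s) _)
      covered a s (suc x) eq = ≤-trans (≤-trans (s≤s z≤n) (≤-reflexive (sym eq))) (m≤n+m _ (W a s))

-- Storing the state in bits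

record Codec (A : Set) (s : ℕ) : Set₁ where
  field
    Fits : A → Set
    encode : A → Vec Bool s
    decode : Vec Bool s → A
    decode-encode : ∀ a → Fits a → decode (encode a) ≡ a
open Codec

take-++ : ∀ {A : Set} {m n} (x : Vec A m) (y : Vec A n) → Vec.take m (x Vec.++ y) ≡ x
take-++ [] y = refl
take-++ (a ∷ x) y = cong (a ∷_) (take-++ x y)

drop-++ : ∀ {A : Set} {m n} (x : Vec A m) (y : Vec A n) → Vec.drop m (x Vec.++ y) ≡ y
drop-++ [] y = refl
drop-++ (a ∷ x) y = drop-++ x y

bitsCodec : ∀ s → Codec (Vec Bool s) s
bitsCodec s = record { Fits = λ _ → ⊤ ; encode = λ v → v ; decode = λ v → v ; decode-encode = λ _ _ → refl }

infixr 4 _×-codec_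
_×-codec_ : ∀ {A B s t} → Codec A s → Codec B t → Codec (A × B) (s + t)
_×-codec_ {s = s} C D = record
  { Fits = λ (a , b) → Fits C a × Fits D b
  ; encode = λ (a , b) → encode C a Vec.++ encode D b
  ; decode = λ v → decode C (Vec.take s v) , decode D (Vec.drop s v)
  ; decode-encode = λ (a , b) (fa , fb) → cong₂ _,_
      (trans (cong (decode C) (take-++ (encode C a) (encode D b))) (decode-encode C a fa))
      (trans (cong (decode D) (drop-++ (encode C a) (encode D b))) (decode-encode D b fb))
  }

retractCodec : ∀ {A B s} (f : B → A) (g : A → B) → (∀ b → g (f b) ≡ b) → Codec A s → Codec B s
retractCodec f g gf C = record
  { Fits = λ b → Fits C (f b)
  ; encode = λ b → encode C (f b)
  ; decode = λ v → g (decode C v)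
  ; decode-encode = λ b fits → trans (cong g (decode-encode C (f b) fits)) (gf b)
  }

encodeℕ : ∀ s → ℕ → Vec Bool s
encodeℕ zero x = []
encodeℕ (suc s) x = (x % 2 ≡ᵇ 1) ∷ encodeℕ s (x / 2)

decodeℕ : ∀ {s} → Vec Bool s → ℕ
decodeℕ [] = 0
decodeℕ (b ∷ v) = ⟦ b ⟧ + decodeℕ v * 2

decodeℕ-encodeℕ : ∀ s x → x < 2 ^ s → decodeℕ (encodeℕ s x) ≡ x
decodeℕ-encodeℕ zero x (s≤s z≤n) = refl
decodeℕ-encodeℕ (suc s) x x< = begin
  ⟦ x % 2 ≡ᵇ 1 ⟧ + decodeℕ (encodeℕ s (x / 2)) * 2   ≡⟨ cong₂ (λ a b → a + b * 2) (bit (x % 2) (m%n<n x 2))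
                                                          (decodeℕ-encodeℕ s (x / 2) (m<n*o⇒m/o<n (≤-trans x< (≤-reflexive (*-comm 2 (2 ^ s)))))) ⟩
  x % 2 + x / 2 * 2                                   ≡⟨ m≡m%n+[m/n]*n x 2 ⟨
  x ∎
  where
  open ≡-Reasoning
  bit : ∀ y → y < 2 → ⟦ y ≡ᵇ 1 ⟧ ≡ y
  bit 0 _ = refl
  bit 1 _ = refl
  bit (suc (suc y)) (s≤s (s≤s ()))

natCodec : ∀ s → Codec ℕ s
natCodec s = record { Fits = _< 2 ^ s ; encode = encodeℕ s ; decode = decodeℕ ; decode-encode = decodeℕ-encodeℕ s }

intCodec : ∀ s → Codec ℤ (suc s)
intCodec s = record
  { Fits = λ z → ∣ z ∣ < 2 ^ s
  ; encode = λ z → negative z ∷ encodeℕ s ∣ z ∣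
  ; decode = λ { (b ∷ v) → signed b (decodeℕ v) }
  ; decode-encode = λ z fits → trans (cong (signed (negative z)) (decodeℕ-encodeℕ s ∣ z ∣ fits)) (signed-negative z)
  }
  where
  negative : ℤ → Bool
  negative (pos _) = false
  negative -[1+ _ ] = true
  signed : Bool → ℕ → ℤ
  signed b x = if b then ℤ.- pos x else pos x
  signed-negative : ∀ z → signed (negative z) ∣ z ∣ ≡ z
  signed-negative (pos x) = refl
  signed-negative -[1+ x ] = refl

finCodec : ∀ {n} s → suc n ≤ 2 ^ s → Codec (Fin (suc n)) s
finCodec {n} s n≤ = record
  { Fits = λ _ → ⊤
  ; encode = λ i → encodeℕ s (toℕ i)
  ; decode = λ v → clip (decodeℕ v)
  ; decode-encode = λ i _ → trans (cong clip (decodeℕ-encodeℕ s (toℕ i) (≤-trans (toℕ<n i) n≤))) (clip-toℕ i (toℕ i <? suc n))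
  }
  where
  clipped : ∀ x → Dec (x < suc n) → Fin (suc n)
  clipped x (yes x<) = fromℕ< x<
  clipped x (no _) = zero
  clip : ℕ → Fin (suc n)
  clip x = clipped x (x <? suc n)
  clip-toℕ : ∀ i d → clipped (toℕ i) d ≡ i
  clip-toℕ i (yes i<) = fromℕ<-toℕ i i<
  clip-toℕ i (no i≮) = contradiction (toℕ<n i) i≮

-- Each slot is a presence bit followed by a data bit, so every list of length at most `s` takes the
-- same number of bits.
encodeList : ∀ s → List Bool → Vec Bool (s * 2)
encodeList zero l = []
encodeList (suc s) [] = false ∷ false ∷ encodeList s []
encodeList (suc s) (b ∷ l) = true ∷ b ∷ encodeList s l

decodeList : ∀ s → Vec Bool (s * 2) → List Bool
decodeList zero v = []
decodeList (suc s) (false ∷ _ ∷ v) = []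
decodeList (suc s) (true ∷ b ∷ v) = b ∷ decodeList s v

listCodec : ∀ s → Codec (List Bool) (s * 2)
listCodec s = record { Fits = λ l → length l ≤ s ; encode = encodeList s ; decode = decodeList s ; decode-encode = λ l → inverse s l }
  where
  inverse : ∀ s l → length l ≤ s → decodeList s (encodeList s l) ≡ l
  inverse zero [] _ = refl
  inverse (suc s) [] _ = refl
  inverse (suc s) (b ∷ l) (s≤s len) = cong (b ∷_) (inverse s l len)

stateSize : ℕ → ℕ → ℕ
stateSize w L = suc w + (w + (w + (w + (L * 2 + (suc w + suc w)))))

stateCodec : ∀ {n} w L → suc n ≤ 2 ^ w → Codec (State (suc n)) (stateSize w L)
stateCodec {n} w L n≤ = retractCodec
  (λ (mkState t l a (mkPhase c b y₀ y₁)) → t , l , a , c , b , y₀ , y₁)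
  (λ (t , l , a , c , b , y₀ , y₁) → mkState t l a (mkPhase c b y₀ y₁))
  (λ _ → refl)
  (intCodec w ×-codec natCodec w ×-codec finCodec w n≤ ×-codec finCodec w n≤ ×-codec listCodec L ×-codec intCodec w ×-codec intCodec w)

module Simulation {A P S : Set} {s : ℕ} (C : Codec (P × S) s) (adv : P → A → S → S) where

  memoryStep : A → Vec Bool s → Vec Bool s
  memoryStep x mem = encode C (proj₁ (decode C mem) , adv (proj₁ (decode C mem)) x (proj₂ (decode C mem)))

  -- `Ok j` holds after `j` items and guarantees that no re-encoding along the stream loses
  -- information. The seed `ρ` stays in memory unchanged.
  simulates : ∀ (ρ : P) (M : ℕ) (Ok : ℕ → S → Set) → (∀ j st → Ok j st → j ≤ M → Fits C (ρ , st)) →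
    (∀ j x st → Ok j st → Ok (suc j) (adv ρ x st)) → ∀ j st (σ : List A) → Ok j st → j + length σ ≤ M →
    decode C (foldl (λ mem x → memoryStep x mem) (encode C (ρ , st)) σ) ≡ (ρ , foldl (λ st x → adv ρ x st) st σ)
  simulates ρ M Ok fits preserved j st [] ok le = decode-encode C (ρ , st) (fits j st ok (≤-trans (m≤m+n j 0) le))
  simulates ρ M Ok fits preserved j st (x ∷ σ) ok le = trans
    (cong (λ z → decode C (foldl (λ mem x → memoryStep x mem) (encode C (proj₁ z , adv (proj₁ z) x (proj₂ z))) σ))
      (decode-encode C (ρ , st) (fits j st ok (≤-trans (m≤m+n j _) le))))
    (simulates ρ M Ok fits preserved (suc j) (adv ρ x st) σ (preserved j x st ok) (≤-trans (≤-reflexive (sym (+-suc j (length σ)))) le))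

module Machine {n k : ℕ} (v : Fin (suc n) → Vec Bool k) (m w L : ℕ) (n≤ : suc n ≤ 2 ^ w) where

  codec = bitsCodec (m + k) ×-codec stateCodec w L n≤

  module Sk (ρ : Vec Bool (m + k)) = Sketch (signs v (Vec.drop m ρ)) (λ x → hashBit (v x) (toList (Vec.take m ρ)))

  open Simulation codec Sk.advance

  alg : StreamAlg (suc n) (m + k + stateSize w L) (m + k)
  alg = record
    { init = λ ρ → encode codec (ρ , initialState zero)
    ; step = memoryStep
    ; out = λ mem → answer (proj₂ (decode codec mem))
    }

  module _ (M : ℕ) (M< : suc (2 * M) < 2 ^ w) (deep : ∀ i → 2 ^ i ≤ suc (2 * M) → rounds i ≤ L) where

    valid-fits : ∀ ρ j st → Sk.Valid ρ j st → j ≤ M → Fits codec (ρ , st)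
    valid-fits ρ j (mkState t l a (mkPhase c b y₀ y₁)) (Sketch.valid t≤ l≤ b≤ c≤) j≤ =
      tt , bound t≤ , <-trans (n<2^n l) (≤-<-trans l≤' M<) , tt , tt , ≤-trans b≤ (deep l l≤') , bound (c≤ false) , bound (c≤ true)
      where
      l≤' : 2 ^ l ≤ suc (2 * M)
      l≤' = ≤-trans l≤ (s≤s (*-monoʳ-≤ 2 j≤))
      bound : ∀ {x} → x ≤ j → x < 2 ^ w
      bound x≤ = ≤-<-trans (≤-trans x≤ (≤-trans j≤ (≤-trans (m≤m+n M _) (n≤1+n _)))) M<

    run≡ : ∀ ρ σ → length σ ≤ M → run alg ρ σ ≡ answer (foldl (λ st x → Sk.advance ρ x st) (initialState zero) σ)
    run≡ ρ σ le = cong (answer ∘ proj₂) (simulates ρ M (Sk.Valid ρ) (valid-fits ρ)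
      (λ j x st → Sk.advance-valid ρ ∣e∣ x st) 0 (initialState zero) σ (Sk.initial-valid ρ ∣e∣ zero) le)
      where
      ∣e∣ : ∀ y → ∣ signs v (Vec.drop m ρ) y ∣ ≡ 1
      ∣e∣ y = ∣sign∣ (dot (v y) (toList (Vec.drop m ρ)))

-- Choice of parameters and conclusion

freq≡ : ∀ {n} (σ : List (Fin n)) H → freq σ H ≡ ∑ σ (λ x → δ x H)
freq≡ σ H = length-filter (λ p → p ≟ H) σ

-- If `H` never occurred, heaviness would force `F₂` of the other items, hence the length of the
-- stream, to be zero.
heavy-occurs : ∀ {n} (σ : List (Fin n)) H α → 1 ≤ α → 1 ≤ length σ → α * F₂ (others H σ) ≤ ∑ σ (λ x → δ x H) * ∑ σ (λ x → δ x H) →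
               1 ≤ ∑ σ (λ x → δ x H)
heavy-occurs σ H α 1≤α 1≤len heavy with ∑ σ (λ x → δ x H) | length-others H σ
... | suc _ | _ = s≤s z≤n
... | zero | len = ≤-trans 1≤len (begin
  length σ              ≡⟨ len ⟩
  length (others H σ)   ≤⟨ length≤F₂ (others H σ) ⟩
  F₂ (others H σ)       ≡⟨ +-identityʳ _ ⟨
  1 * F₂ (others H σ)   ≤⟨ *-monoˡ-≤ _ 1≤α ⟩
  α * F₂ (others H σ)   ≤⟨ heavy ⟩
  0 ∎)
  where open ≤-Reasoning

-- By minimality the scale one below has `3 * 2 ^ j < F`, so the least scale is within the range of
-- levels that `L` provides for.
least-scale-small : ∀ {F M i} → F ≤ M → (∀ j → F ≤ 3 * 2 ^ j → i ≤ j) → 2 ^ i ≤ suc (2 * M)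
least-scale-small {i = zero} _ _ = s≤s z≤n
least-scale-small {F} {M} {suc j} F≤M low = ≤-trans (*-monoʳ-≤ 2 (≤-trans (m≤m+n (2 ^ j) (2 * 2 ^ j)) (≤-trans (<⇒≤ (≰⇒> above)) F≤M))) (n≤1+n _)
  where
  above : ¬ F ≤ 3 * 2 ^ j
  above F≤ = <-irrefl refl (low j F≤)

alg-succeeds : ∀ {n k} (v : Fin (suc n) → Vec Bool k) → QuadFree v → ∀ m w L (n≤ : suc n ≤ 2 ^ w) → L + k ≤ m →
  ∀ M → suc (2 * M) < 2 ^ w → (∀ i → 2 ^ i ≤ suc (2 * M) → rounds i ≤ L) →
  ∀ α → 1 ≤ α → 100 * (p4 100 * 1500) ≤ 1 * (α * α) → 100 * (13122 * (p4 1800 * 1500)) ≤ 3122 * (α * α) → 100 * 2304 ≤ α →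
  ∀ σ → 1 ≤ length σ → length σ ≤ M → ∀ H → HeavyHitter α σ H →
  95 * 2 ^ (m + k) ≤ 100 * successes (Machine.alg v m w L n≤) σ H
alg-succeeds {n} {k} v qf m w L n≤ L+k≤m M M< deep α 1≤α α₀ α₁ α₂ σ 1≤len len≤ H heavy =
  subst₂ (λ a b → 95 * a ≤ 100 * b) (sym (^-distribˡ-+-* 2 m k)) (sym count)
    (S.mostly α 2304 (rounds i₀) occurs heavy' R₀≤L (least-scale-square {i = i₀} (proj₁ (proj₂ least)))
      α₀ α₁ α₂ W win)
  where
  -- `1500` is the constant of `maximal-inequality`, `100` and `1800` are those of `Good`, `9` and
  -- `10` give the ratio of successive thresholds, and `3122` is `2 * 9 ^ 4 - 10 ^ 4`, whence
  -- `refl`.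
  module S = Seeds v qf σ H L m L+k≤m 1500 100 1800 9 10 3122 refl (maximal-inequality v qf)
  module Mc = Machine v m w L n≤
  F = S.F
  heavy' : α * S.D ≤ F * F
  heavy' = ≤-trans (*-monoʳ-≤ α (F₂-others σ H)) (subst (λ f → α * restF2 σ H ≤ f * f) (freq≡ σ H) heavy)
  occurs : 1 ≤ F
  occurs = heavy-occurs σ H α 1≤α 1≤len heavy'
  least = least-scale F
  i₀ = proj₁ least
  F≤len : F ≤ length σ
  F≤len = ≤-trans (m≤m+n F _) (≤-reflexive (sym (length-others H σ)))
  R₀≤L : rounds i₀ ≤ L
  R₀≤L = deep i₀ (least-scale-small {F} {M} (≤-trans F≤len len≤) (proj₂ (proj₂ least)))
  W : Vec Bool m → Vec Bool k → ℕ
  W a s = ⟦ does (run Mc.alg (a Vec.++ s) σ ≟ H) ⟧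
  count : successes Mc.alg σ H ≡ S.𝔼 W
  count = trans (length-filter (λ ρ → run Mc.alg ρ σ ≟ H) (allBits (m + k))) (∑-allBits-++ m k _)
  win : ∀ a s → S.penalty (rounds i₀) a s ≡ 0 → W a s ≡ 1
  win a s no-pen = cong ⟦_⟧ (dec-true (run Mc.alg (a Vec.++ s) σ ≟ H) (trans (Mc.run≡ M M< deep (a Vec.++ s) σ len≤) found))
    where
    good : S.An.Good a s
    good = record
      { occurs = occurs
      ; noise₀-small = S.quiet₀ {rounds i₀} a s no-pen
      ; noise-small = S.quiet {rounds i₀} a s no-pen
      ; isolated = λ x x∈ x≢H i F≤ eq → S.no-collision {rounds i₀} a s no-pen x x∈ x≢H
          (prefixBits-≤ (S.hashes a x) (S.hashes a H) (*-monoʳ-≤ 2 (∸-monoˡ-≤ 4 (proj₂ (proj₂ least) i F≤))) eq)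
      ; deep = λ i h → deep i (≤-trans h (s≤s (*-monoʳ-≤ 2 len≤)))
      }
    found : answer (foldl (λ st x → Mc.Sk.advance (a Vec.++ s) x st) (initialState zero) σ) ≡ H
    found = subst₂ (λ a' s' → answer (foldl (λ st x → Sketch.advance (signs v s') (S.hashes a') x st) (initialState zero) σ) ≡ H)
      (sym (take-++ a s)) (sym (drop-++ a s)) (S.An.finds-heavy a s good zero)

n<2^[1+⌊log₂n⌋] : ∀ n → n < 2 ^ suc ⌊log₂ n ⌋
n<2^[1+⌊log₂n⌋] n = ≰⇒> λ 2^≤n → <-irrefl refl
  (≤-trans (≤-reflexive (sym (⌊log₂[2^n]⌋≡n (suc ⌊log₂ n ⌋)))) (⌊log₂⌋-mono-≤ 2^≤n))

-- Here `l` is the integer part of the logarithm of `n`, and `n ≤ 2 ^ (2 * l)`. So `2 ^ t` bounds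
-- the stream length `n ^ c`, `L` bounds the rounds at any level reached, `k` leaves room for the
-- `n ^ 3` forbidden sums, `m` is the length of the Toeplitz seed, and `w` bits hold an item or the
-- size of a counter.
module Parameters (c l : ℕ) where
  t L k m w : ℕ
  t = 2 * l * c
  L = 2 * (t + 2)
  k = 6 * l
  m = L + k
  w = 2 * l + (t + 2)

  1+2M<2^[t+2] : ∀ {M} → M ≤ 2 ^ t → suc (2 * M) < 2 ^ (t + 2)
  1+2M<2^[t+2] {M} M≤ = begin-strict
    suc (2 * M)              ≤⟨ s≤s (*-monoʳ-≤ 2 M≤) ⟩
    1 + 2 * 2 ^ t            <⟨ +-monoˡ-< (2 * 2 ^ t) (*-monoʳ-≤ 2 (m^n>0 2 t)) ⟩
    2 * 2 ^ t + 2 * 2 ^ t    ≡⟨ e₁ (2 ^ t) ⟩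
    2 ^ t * 4                ≡⟨ ^-distribˡ-+-* 2 t 2 ⟨
    2 ^ (t + 2) ∎
    where
    open ≤-Reasoning
    e₁ : ∀ x → 2 * x + 2 * x ≡ x * 4
    e₁ = solve-∀

  rounds≤L : ∀ {M} → M ≤ 2 ^ t → ∀ i → 2 ^ i ≤ suc (2 * M) → rounds i ≤ L
  rounds≤L M≤ i h = *-monoʳ-≤ 2 {i ∸ 4} {t + 2} (≤-trans (m∸n≤m i 4) (≮⇒≥ λ t+2<i →
    <-irrefl refl (<-≤-trans (<-trans (1+2M<2^[t+2] M≤) (^-monoʳ-< 2 (s≤s (s≤s z≤n)) t+2<i)) h)))

  module _ (1≤l : 1 ≤ l) (n : ℕ) (n< : n < 2 ^ suc l) where

    n≤2^2l : n ≤ 2 ^ (2 * l)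
    n≤2^2l = ≤-trans (<⇒≤ n<) (^-monoʳ-≤ 2 (≤-trans (+-monoˡ-≤ l 1≤l) (≤-reflexive (cong (_+_ l) (sym (+-identityʳ l))))))

    n≤2^w : n ≤ 2 ^ w
    n≤2^w = ≤-trans n≤2^2l (^-monoʳ-≤ 2 (m≤m+n (2 * l) (t + 2)))

    n^c≤2^t : n ^ c ≤ 2 ^ t
    n^c≤2^t = ≤-trans (^-monoˡ-≤ c n≤2^2l) (≤-reflexive (^-*-assoc 2 (2 * l) c))

    n³≤2^k : n * (n * n) ≤ 2 ^ k
    n³≤2^k = begin
      n * (n * n)                                ≤⟨ *-mono-≤ n≤2^2l (*-mono-≤ n≤2^2l n≤2^2l) ⟩
      2 ^ (2 * l) * (2 ^ (2 * l) * 2 ^ (2 * l))  ≡⟨ cong (2 ^ (2 * l) *_) (^-distribˡ-+-* 2 (2 * l) (2 * l)) ⟨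
      2 ^ (2 * l) * 2 ^ (2 * l + 2 * l)          ≡⟨ ^-distribˡ-+-* 2 (2 * l) (2 * l + 2 * l) ⟨
      2 ^ (2 * l + (2 * l + 2 * l))              ≡⟨ cong (2 ^_) (e₁ l) ⟩
      2 ^ k ∎
      where
      open ≤-Reasoning
      e₁ : ∀ l → 2 * l + (2 * l + 2 * l) ≡ 6 * l
      e₁ = solve-∀

  -- The size is exactly `(24 * c + 24) * l + 27`, linear in `l`; with `l = 1 + j`, adding `27 * j`
  -- tops it up to a multiple of `l`.
  size≤ : 1 ≤ l → m + k + stateSize w L ≤ (24 * c + 51) * l
  size≤ (s≤s {n = j} z≤n) = ≤-trans (m≤m+n _ (27 * j)) (≤-reflexive (e₁ c j))
    where
    e₁ : ∀ c j → let l = 1 + j ; t = 2 * l * c ; L = 2 * (t + 2) ; w = 2 * l + (t + 2) in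
         L + 6 * l + 6 * l + ((1 + w) + (w + (w + (w + (L * 2 + ((1 + w) + (1 + w))))))) + 27 * j ≡ (24 * c + 51) * l
    e₁ = solve-∀

theorem3 : Σ ℕ λ C → 1 ≤ C ×
    ((c : ℕ) → Σ ℕ λ K → Σ ℕ λ N₀ → (n : ℕ) → N₀ ≤ n →
    Σ ℕ λ s → Σ ℕ λ r → Σ (StreamAlg n s r) λ A →
    s ≤ K * (⌊log₂ n ⌋ * ⌊log₂ ⌊log₂ n ⌋ ⌋) ×
    r ≤ K * (⌊log₂ n ⌋ * ⌊log₂ ⌊log₂ n ⌋ ⌋) ×
    ((σ : List (Fin n)) → 1 ≤ length σ → length σ ≤ n ^ c →
    (H : Fin n) → HeavyHitter (400 * (C * C)) σ H →
    95 * 2 ^ r ≤ 100 * successes A σ H))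
-- From `n = 4` on the iterated logarithm is at least 1, so a size linear in `⌊log₂ n ⌋` is within
-- the required bound.
theorem3 = C , s≤s z≤n , λ c → 24 * c + 51 , 4 , construct c
  where
  C : ℕ
  -- The strictest demand on `α` comes from the class noise, `α² ≥ 100 * 13122 * 1800 ^ 4 * 1500 /
  -- 3122`, met from about `α = 2.6 * 10 ^ 9` on; here `α = 4 * 10 ^ 10`.
  C = 10000
  construct : ∀ c n → 4 ≤ n → Σ ℕ λ s → Σ ℕ λ r → Σ (StreamAlg n s r) λ A →
    s ≤ (24 * c + 51) * (⌊log₂ n ⌋ * ⌊log₂ ⌊log₂ n ⌋ ⌋) ×
    r ≤ (24 * c + 51) * (⌊log₂ n ⌋ * ⌊log₂ ⌊log₂ n ⌋ ⌋) ×
    ((σ : List (Fin n)) → 1 ≤ length σ → length σ ≤ n ^ c →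
    (H : Fin n) → HeavyHitter (400 * (C * C)) σ H →
    95 * 2 ^ r ≤ 100 * successes A σ H)
  construct c n@(suc n-1) 4≤n =
    m + k + stateSize w L , m + k , Machine.alg v m w L n≤w , size , ≤-trans (m≤m+n (m + k) _) size ,
    alg-succeeds v qf m w L n≤w ≤-refl (n ^ c)
      (<-≤-trans (1+2M<2^[t+2] n^c≤) (^-monoʳ-≤ 2 (m≤n+m (t + 2) (2 * l)))) (rounds≤L n^c≤)
      (400 * (C * C)) (≤ᵇ⇒≤ _ _ tt) (≤ᵇ⇒≤ _ _ tt) (≤ᵇ⇒≤ _ _ tt) (≤ᵇ⇒≤ _ _ tt)
    where
    l = ⌊log₂ n ⌋
    2≤l : 2 ≤ l
    2≤l = ≤-trans (≤-reflexive (sym (⌊log₂[2^n]⌋≡n 2))) (⌊log₂⌋-mono-≤ 4≤n)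
    1≤l : 1 ≤ l
    1≤l = ≤-trans (s≤s z≤n) 2≤l
    1≤ll : 1 ≤ ⌊log₂ l ⌋
    1≤ll = ≤-trans (≤-reflexive (sym (⌊log₂[2^n]⌋≡n 1))) (⌊log₂⌋-mono-≤ 2≤l)
    open Parameters c l
    n≤w : n ≤ 2 ^ w
    n≤w = n≤2^w 1≤l n (n<2^[1+⌊log₂n⌋] n)
    n^c≤ : n ^ c ≤ 2 ^ t
    n^c≤ = n^c≤2^t 1≤l n (n<2^[1+⌊log₂n⌋] n)
    vectors = ∃-quadFree k n (n³≤2^k 1≤l n (n<2^[1+⌊log₂n⌋] n))
    v = proj₁ vectors
    qf = proj₂ vectors
    size : m + k + stateSize w L ≤ (24 * c + 51) * (l * ⌊log₂ l ⌋)
    size = ≤-trans (size≤ 1≤l) (*-monoʳ-≤ (24 * c + 51) (≤-trans (≤-reflexive (sym (*-identityʳ l))) (*-monoʳ-≤ l 1≤ll)))
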